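{- Let $r,n$ be positive integers, let $\epsilon\in\{1,-1\}$, $h\in\{0,1,\dots,r-1\}$, and let $\chi_{\epsilon,h}$ be the corresponding one-dimensional character of $G_{r,n}$. Let $k,b$ be integers with $1\le k\le n-1$, $k\le b\le n$ and $b\equiv n\pmod 2$. Then the following identities of polynomials in $q$ hold. (i) If $n-k\equiv 0\pmod 2$, then $$\sum_{\pi\in G_{r,n}(b-k+1\,:\,b)}\chi_{\epsilon,h}(\pi)\,q^{\mathrm{fmaj}(\pi)}=\prod_{i=k+1}^{n}[ir]_{\epsilon^{i-1}\zeta^h q}.$$ (ii) If $n-k\equiv 1\pmod 2$, then $$\sum_{\pi\in G_{r,n}(b-k+1\,:\,b)}\chi_{\epsilon,h}(\pi)\,q^{\mathrm{fmaj}(\pi)}=[k+1]_{\epsilon q^r}\,[r]_{\zeta^h q}\prod_{i=k+2}^{n}[ir]_{\epsilon^{i-1}\zeta^h q}.$$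
   Context: Here $q$ is an indeterminate, $\zeta\in\mathbb{C}$ is a fixed primitive $r$th root of unity, and $[m]_x:=1+x+\cdots+x^{m-1}$ for an integer $m\ge 0$. Empty products equal $1$. $G_{r,n}=\mathbb{Z}_r\wr S_n$ is the group of colored permutations: its elements are $\pi=(\pi_1,\dots,\pi_n)=(\sigma_1^{z_1},\dots,\sigma_n^{z_n})$ with $\sigma=(\sigma_1,\dots,\sigma_n)\in S_n$ (one-line notation) and colors $z_i\in\{0,\dots,r-1\}$. Write $|\pi|=\sigma$ and $\mathrm{col}(\pi)=z_1+\cdots+z_n$ (sum of integers). A colored integer of color $0$ is written without exponent. For $\sigma\in S_n$, $\mathrm{inv}(\sigma)=\#\{i<j:\sigma_i>\sigma_j\}$. The one-dimensional character is $\chi_{\epsilon,h}(\pi)=\epsilon^{\mathrm{inv}(|\pi|)}\zeta^{h\cdot\mathrm{col}(\pi)}$. Colored integers are compared in the linear order $$1^{r-1}<\cdots<n^{r-1}<\cdots<1^1<\cdots<n^1<1<\cdots<n.$$ With this order, $\mathrm{maj}_F(\pi)=\sum_{1\le i\le n-1,\ \pi_i>\pi_{i+1}}i$ and $\mathrm{fmaj}(\pi)=r\cdot\mathrm{maj}_F(\pi)+\mathrm{col}(\pi)$. For integers $1\le a\le c\le n$, $G_{r,n}(a:c)$ is the set of $\pi\in G_{r,n}$ whose word $(\pi_1,\dots,\pi_n)$ contains $(a,a+1,\dots,c)$, all entries of color $0$, as a (not necessarily contiguous) subsequence. -}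

module Defs where

open import Level using (Level)
open import Algebra.Bundles using (CommutativeRing; RawSemiring; Semiring)
import Algebra.Definitions.RawSemiring as RawSemiringDefs
open import Data.Bool.Base using (if_then_else_)
open import Data.Fin.Base using (Fin; toℕ)
import Data.Fin.Properties as Fin
open import Data.List.Base as List using (List; []; _∷_)
open import Data.List.Relation.Binary.Sublist.Propositional using (_⊆_)
import Data.List.Relation.Binary.Sublist.DecPropositional as DecSublist
import Data.List.Relation.Unary.Unique.DecPropositional as DecUnique
open import Data.Nat.Base using (ℕ; zero; suc; _+_; _*_; _∸_; _≤_; _<_)
import Data.Nat.Properties as ℕ
open import Data.Product.Base using (_×_; _,_)
open import Data.Product.Properties using (≡-dec)
open import Data.Sum.Base using (_⊎_)
open import Data.Vec.Base as Vec using (Vec; []; _∷_)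
open import Relation.Binary.Definitions using (Decidable)
open import Relation.Binary.PropositionalEquality using (_≡_)
open import Relation.Nullary using (¬_; Dec; does)
open import Relation.Nullary.Decidable using (_×-dec_; _⊎-dec_)

private
  variable
    a c ℓ : Level
    A : Set a

-- The colored integer i^z is the pair (i , z).
ColoredInteger : Set
ColoredInteger = ℕ × ℕ

infix 4 _≺_ _≺?_

-- The order 1^{r-1} < ⋯ < n^{r-1} < ⋯ < 1^1 < ⋯ < n^1 < 1 < ⋯ < n, in which
-- a larger color makes a smaller colored integer.
_≺_ : ColoredInteger → ColoredInteger → Set
(i , z) ≺ (j , y) = y < z ⊎ (z ≡ y × i < j)

_≺?_ : Decidable _≺_
(i , z) ≺? (j , y) = (y ℕ.<? z) ⊎-dec ((z ℕ.≟ y) ×-dec (i ℕ.<? j))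

-- One-line notation of a permutation together with the colors.  That the
-- entries of ∣_∣ are distinct is imposed in the enumeration `G` below.
-- The element i of Fin n stands for the integer i + 1.
record Colored (r n : ℕ) : Set where
  constructor _coloredBy_
  field
    ∣_∣    : Vec (Fin n) n
    colors : Vec (Fin r) n

open Colored public

allVecs : List A → (n : ℕ) → List (Vec A n)
allVecs xs zero    = [] ∷ []
allVecs xs (suc n) = List.cartesianProductWith _∷_ xs (allVecs xs n)

permutations : (n : ℕ) → List (Vec (Fin n) n)
permutations n =
  List.filter (λ σ → DecUnique.unique? Fin._≟_ (Vec.toList σ))
              (allVecs (List.allFin n) n)

-- The group G_{r,n}, every element listed exactly once.
G : (r n : ℕ) → List (Colored r n)
G r n = List.cartesianProductWith _coloredBy_ (permutations n)
                                         (allVecs (List.allFin r) n)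

module _ {r n : ℕ} where

  word : Colored r n → List ColoredInteger
  word π = Vec.toList
    (Vec.zipWith (λ i z → suc (toℕ i) , toℕ z) ∣ π ∣ (colors π))

  col : Colored r n → ℕ
  col π = Vec.sum (Vec.map toℕ (colors π))

inv : ∀ {n m} → Vec (Fin n) m → ℕ
inv []      = 0
inv (i ∷ σ) = Vec.count (Fin._<? i) σ + inv σ

-- Sum of the positions of the descents, the first letter being at position p.
majFrom : (p : ℕ) → List ColoredInteger → ℕ
majFrom p []          = 0
majFrom p (_ ∷ [])    = 0
majFrom p (x ∷ y ∷ w) =
  (if does (y ≺? x) then p else 0) + majFrom (suc p) (y ∷ w)

module _ {r n : ℕ} where

  majF : Colored r n → ℕ
  majF π = majFrom 1 (word π)

  fmaj : Colored r n → ℕ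
  fmaj π = r * majF π + col π

[_⋯_] : ℕ → ℕ → List ℕ
[ lo ⋯ hi ] = List.applyUpTo (lo +_) (suc hi ∸ lo)

uncolored : ℕ → ℕ → List ColoredInteger
uncolored lo hi = List.map (_, 0) [ lo ⋯ hi ]

-- `_⊆_` on lists is the (not necessarily contiguous) subsequence relation.
HasSubsequence : ∀ {r n} → ℕ → ℕ → Colored r n → Set
HasSubsequence lo hi π = uncolored lo hi ⊆ word π

hasSubsequence? : ∀ {r n} lo hi (π : Colored r n) → Dec (HasSubsequence lo hi π)
hasSubsequence? lo hi π =
  DecSublist._⊆?_ (≡-dec ℕ._≟_ ℕ._≟_) (uncolored lo hi) (word π)

G_,_⟨_∶_⟩ : (r n lo hi : ℕ) → List (Colored r n)
G r , n ⟨ lo ∶ hi ⟩ = List.filter (hasSubsequence? lo hi) (G r n)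

module BigOperators (S : RawSemiring c ℓ) where

  private module S = RawSemiring S
  open RawSemiringDefs S using () renaming (_^_ to _^ˢ_)

  ∑ : List A → (A → S.Carrier) → S.Carrier
  ∑ xs f = List.foldr (λ x s → f x S.+ s) S.0# xs

  ∏ : List A → (A → S.Carrier) → S.Carrier
  ∏ xs f = List.foldr (λ x p → f x S.* p) S.1# xs

  infix 5 ∑ ∏
  syntax ∑ xs (λ x → e) = ∑[ x ∈ xs ] e
  syntax ∏ xs (λ x → e) = ∏[ x ∈ xs ] e

  [_]⟨_⟩ : ℕ → S.Carrier → S.Carrier
  [ m ]⟨ x ⟩ = ∑[ j ∈ List.upTo m ] x ^ˢ j

-- The coefficient ring R is arbitrary here and below, ℂ being the case of
-- interest: the library has no complex numbers.
module Polynomials (R : CommutativeRing c ℓ) where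

  private module R = CommutativeRing R

  infix  4 _≈ᴾ_
  infixl 6 _+ᴾ_
  infixl 7 _*ᴾ_

  -- Coefficients in order of increasing degree; trailing zeros are allowed,
  -- so two lists are the same polynomial when they agree under _≈ᴾ_.
  Poly : Set c
  Poly = List R.Carrier

  coeff : Poly → ℕ → R.Carrier
  coeff []      _       = R.0#
  coeff (x ∷ f) zero    = x
  coeff (x ∷ f) (suc i) = coeff f i

  _≈ᴾ_ : Poly → Poly → Set ℓ
  f ≈ᴾ g = ∀ i → coeff f i R.≈ coeff g i

  _+ᴾ_ : Poly → Poly → Poly
  []      +ᴾ g       = g
  (x ∷ f) +ᴾ []      = x ∷ f
  (x ∷ f) +ᴾ (y ∷ g) = (x R.+ y) ∷ (f +ᴾ g)

  _*ᴾ_ : Poly → Poly → Poly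
  []      *ᴾ g = []
  (x ∷ f) *ᴾ g = List.map (x R.*_) g +ᴾ (R.0# ∷ (f *ᴾ g))

  constant : R.Carrier → Poly
  constant x = x ∷ []

  q : Poly
  q = R.0# ∷ R.1# ∷ []

  polynomials : RawSemiring c ℓ
  polynomials = record
    { Carrier = Poly
    ; _≈_     = _≈ᴾ_
    ; _+_     = _+ᴾ_
    ; _*_     = _*ᴾ_
    ; 0#      = []
    ; 1#      = constant R.1#
    }

  open RawSemiringDefs polynomials public using () renaming (_^_ to _^ᴾ_)
  open BigOperators polynomials public

module Characters (R : CommutativeRing c ℓ) where

  private module R = CommutativeRing R
  open RawSemiringDefs (Semiring.rawSemiring R.semiring)
    public using () renaming (_^_ to _^ᴿ_)

  IsPrimitiveRoot : ℕ → R.Carrier → Set ℓ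
  IsPrimitiveRoot r ζ =
    (ζ ^ᴿ r R.≈ R.1#) × (∀ m → 1 ≤ m → m < r → ¬ (ζ ^ᴿ m R.≈ R.1#))

  IsSign : R.Carrier → Set ℓ
  IsSign ε = (ε R.≈ R.1#) ⊎ (ε R.≈ R.- R.1#)

  χ : (ζ ε : R.Carrier) (h : ℕ) {r n : ℕ} → Colored r n → R.Carrier
  χ ζ ε h π = (ε ^ᴿ inv ∣ π ∣) R.* (ζ ^ᴿ (h * col π))

{-# OPTIONS --safe #-}
module Submission where

-- Put x = ζ^h q and y = x^r.  Since ζ^r = 1, the sum in question is the sum of
-- ε^inv x^fmaj.  Every word that contains the uncolored block b - k + 1, …, b
-- arises in exactly one way from the block by inserting the other letters, with
-- all colors and at all places; by the parity assumptions these form pairs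
-- a, a + 1, except for the letter 1 in case (ii), which is inserted first.
--
-- If ε = 1, inserting any letter into a word of length m multiplies the sum by
-- [(m + 1) r]_x.  If ε = -1, insert a and a + 1 together: exchanging them while
-- keeping the colors in place changes the sign and keeps the descents, unless
-- the two letters are neighbours of the same color.  Only these insertions
-- survive, and (1 - x^2) times their sum is (1 - y^(m+1)) (1 - y^(m+2)) times
-- the weight of the word; here (1 - y^(m+1)) (1 - y^(m+2)) is (1 - x^2) times
-- the product of the two factors claimed.  The divisions by 1 - x^j are
-- cancellations: in a polynomial ring 1 - t is regular when t has no constant
-- term.

open import Level using (Level)
open import Algebra.Bundles using (CommutativeRing; Semiring)
import Algebra.Properties.AbelianGroup
import Algebra.Properties.CommutativeSemigroup
import Algebra.Properties.CommutativeSemiring.Exp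
import Algebra.Properties.Group
import Algebra.Properties.Ring
import Algebra.Properties.Semiring.Exp
import Algebra.Properties.Semiring.Mult.TCOptimised
import Algebra.Solver.Ring as RingSolver
import Algebra.Solver.Ring.AlmostCommutativeRing as AlmostCommutativeRing
open import Data.Bool.Base using (true; false; not; if_then_else_)
open import Data.Fin.Base as Fin using (Fin; toℕ; fromℕ<)
import Data.Fin.Properties as Fin
import Data.Integer.Base as ℤ
import Data.Integer.Properties as ℤ
open import Data.List.Base as List using (List; []; _∷_; _++_; length; map; concatMap; upTo; applyUpTo; applyDownFrom)
open import Data.List.Membership.Propositional using (_∈_; _∉_; find; lose)
open import Data.List.Membership.Propositional.Properties using (∈-map⁺; ∈-map⁻; ∈-++⁺ˡ; ∈-++⁺ʳ; ∈-++⁻; ∈-∃++; ∈-concatMap⁺; ∈-concatMap⁻; ∈-upTo⁺; ∈-upTo⁻; ∈-filter⁺; ∈-filter⁻; ∈-allFin; ∈-cartesianProductWith⁺; ∈-cartesianProductWith⁻; ∈-applyUpTo⁺; ∈-applyUpTo⁻; ∈-applyDownFrom⁺)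
open import Data.List.Membership.Propositional.Properties.WithK using (unique∧set⇒bag)
open import Data.List.Properties as List using (∷-injective; ∷-injectiveˡ; ∷-injectiveʳ; length-map; map-++; map-∘; map-upTo; applyUpTo-∷ʳ; applyDownFrom-∷ʳ)
open import Data.List.Relation.Binary.BagAndSetEquality using (∼bag⇒↭)
open import Data.List.Relation.Binary.Permutation.Propositional as Perm using (_↭_; prep; swap; ↭-refl; ↭-sym; ↭-trans; ↭-reflexive; ↭⇒↭ₛ)
open import Data.List.Relation.Binary.Permutation.Propositional.Properties as ↭ using (∈-resp-↭; All-resp-↭; ↭-length; shift; drop-mid)
import Data.List.Relation.Binary.Permutation.Setoid.Properties as ↭ₛ
open import Data.List.Relation.Binary.Pointwise using (Pointwise-≡⇒≡)
import Data.List.Relation.Binary.Sublist.Heterogeneous.Properties as Sublist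
open import Data.List.Relation.Binary.Sublist.Propositional using (_⊆_; []; _∷_; _∷ʳ_; ⊆-refl; ⊆-trans)
open import Data.List.Relation.Unary.All as All using (All; []; _∷_)
import Data.List.Relation.Unary.All.Properties as All
open import Data.List.Relation.Unary.AllPairs as AllPairs using (AllPairs; []; _∷_)
import Data.List.Relation.Unary.AllPairs.Properties as AllPairs
open import Data.List.Relation.Unary.Any using (here; there)
open import Data.List.Relation.Unary.Linked using (Linked; []; [-]; _∷_)
open import Data.List.Relation.Unary.Unique.Propositional using (Unique)
import Data.List.Relation.Unary.Unique.Propositional.Properties as Unique
open import Data.Maybe.Base using (Maybe; nothing; just)
open import Data.Nat.Base as ℕ using (ℕ; zero; suc; _≤_; _<_)
open import Data.Nat.DivMod using (_%_)
import Data.Nat.Induction as ℕ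
open import Data.Nat.ListAction using (sum)
open import Data.Nat.ListAction.Properties using (sum-↭)
import Data.Nat.Properties as ℕ
open import Data.Nat.Solver using (module +-*-Solver)
open import Data.Product.Base using (_×_; _,_; proj₁; proj₂; ∃; ∃₂)
open import Data.Sum.Base as Sum using (_⊎_; inj₁; inj₂)
open import Data.Vec.Base as Vec using (Vec; []; _∷_; toList)
open import Data.Vec.Properties using (length-toList)
open import Function.Base using (_∘_; id)
open import Function.Bundles using (_⇔_; mk⇔; module Equivalence)
open import Function.Properties.Equivalence using () renaming (sym to ⇔-sym; refl to ⇔-refl)
open import Relation.Binary.Definitions using (tri<; tri≈; tri>)
open import Relation.Binary.PropositionalEquality as ≡ using (_≡_; _≢_; refl; sym; trans; cong; cong₂; subst; module ≡-Reasoning)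
import Relation.Binary.Reasoning.Setoid
open import Relation.Nullary using (¬_; Dec; yes; no; does; contradiction)
open import Relation.Nullary.Decidable using (dec-true; dec-false; does-⇔)
open import Defs

-- What takes its place is that no integer lies between a and a + 1: every other letter compares
-- with both alike, and two such neighbours of one color meet the rest of the word like a single
-- letter of width two. One summation over the gaps of a word therefore serves both for one letter
-- and for a pair.
--
-- The pair is treated as a unit when ε = -1 because the sign of a single inserted letter changes
-- from gap to gap with the letters of the word. In one gap, the orders a, a + 1 and a + 1, a differ
-- by the sign and by one descent inside the pair; together they carry a factor 1 - y^j, where j is
-- the position of that descent. This factor is the weight in the gap summation.
--
-- The sign is invisible in the numerators: since m (m + 1) is even, the geometric sum of (m + 1) r
-- powers of ε^m x always has the numerator 1 - y^(m+1). The letter 1 in case (ii) has no partner;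
-- it is smaller than the whole increasing block, so its inversions and its descent can be read off
-- directly, which is the origin of [k + 1] at ε q^r.

private
  variable
    c ℓ : Level
    A B : Set c

-- Equality in S need not be decidable, so a solver with coefficients in S itself could
-- not discard terms that cancel.
module IntegerCoefficients (S : CommutativeRing c ℓ) where

  open CommutativeRing S renaming (refl to ≈-refl; sym to ≈-sym; trans to ≈-trans)
  open Algebra.Properties.Ring ring
    using (-‿distribˡ-*; -‿distribʳ-*; -0#≈0#; -‿involutive)
  open Algebra.Properties.AbelianGroup +-abelianGroup using (⁻¹-∙-comm)
  open Algebra.Properties.Semiring.Mult.TCOptimised semiring
    using (×-homo-+; ×1-homo-*; 1+×) renaming (_×_ to _×ˢ_)
  open Relation.Binary.Reasoning.Setoid setoid

  -- With these multiples `1 ×ˢ 1#` is `1#` by definition, so `con ℤ.1ℤ` in the solver denotes `1#`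
  -- itself.
  ⟦_⟧ : ℤ.ℤ → Carrier
  ⟦ ℤ.+ n ⟧      = n ×ˢ 1#
  ⟦ ℤ.-[1+ n ] ⟧ = - (suc n ×ˢ 1#)

  ⟦⟧-neg : ∀ i → ⟦ ℤ.- i ⟧ ≈ - ⟦ i ⟧
  ⟦⟧-neg (ℤ.+ zero)    = ≈-sym -0#≈0#
  ⟦⟧-neg (ℤ.+ suc n)   = ≈-refl
  ⟦⟧-neg ℤ.-[1+ n ]    = ≈-sym (-‿involutive _)

  ⟦⟧-⊖ : ∀ m n → ⟦ m ℤ.⊖ n ⟧ ≈ m ×ˢ 1# - n ×ˢ 1#
  ⟦⟧-⊖ m zero = begin
    ⟦ m ℤ.⊖ 0 ⟧      ≡⟨ cong ⟦_⟧ (ℤ.⊖-≥ (ℕ.z≤n {m})) ⟩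
    m ×ˢ 1#           ≈⟨ +-identityʳ _ ⟨
    m ×ˢ 1# + 0#      ≈⟨ +-congˡ -0#≈0# ⟨
    m ×ˢ 1# - 0#      ∎
  ⟦⟧-⊖ zero (suc n) = ≈-sym (+-identityˡ _)
  ⟦⟧-⊖ (suc m) (suc n) = begin
    ⟦ suc m ℤ.⊖ suc n ⟧                  ≡⟨ cong ⟦_⟧ (ℤ.[1+m]⊖[1+n]≡m⊖n m n) ⟩
    ⟦ m ℤ.⊖ n ⟧                          ≈⟨ ⟦⟧-⊖ m n ⟩
    m ×ˢ 1# - n ×ˢ 1#                      ≈⟨ +-congˡ (+-identityˡ _) ⟨
    m ×ˢ 1# + (0# - n ×ˢ 1#)               ≈⟨ +-congˡ (+-congʳ (-‿inverseʳ 1#)) ⟨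
    m ×ˢ 1# + (1# - 1# - n ×ˢ 1#)          ≈⟨ +-congˡ (+-assoc _ _ _) ⟩
    m ×ˢ 1# + (1# + (- 1# - n ×ˢ 1#))      ≈⟨ +-assoc _ _ _ ⟨
    m ×ˢ 1# + 1# + (- 1# - n ×ˢ 1#)        ≈⟨ +-cong (+-comm _ _) (⁻¹-∙-comm _ _) ⟩
    1# + m ×ˢ 1# - (1# + n ×ˢ 1#)          ≈⟨ +-cong (1+× m 1#) (-‿cong (1+× n 1#)) ⟨
    suc m ×ˢ 1# - suc n ×ˢ 1#              ∎

  ⟦⟧-+ : ∀ i j → ⟦ i ℤ.+ j ⟧ ≈ ⟦ i ⟧ + ⟦ j ⟧
  ⟦⟧-+ (ℤ.+ m)    (ℤ.+ n)    = ×-homo-+ 1# m n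
  ⟦⟧-+ (ℤ.+ m)    ℤ.-[1+ n ] = ⟦⟧-⊖ m (suc n)
  ⟦⟧-+ ℤ.-[1+ m ] (ℤ.+ n)    = ≈-trans (⟦⟧-⊖ n (suc m)) (+-comm _ _)
  ⟦⟧-+ ℤ.-[1+ m ] ℤ.-[1+ n ] = begin
    - (suc (suc (m ℕ.+ n)) ×ˢ 1#)       ≡⟨ cong (λ k → - (suc k ×ˢ 1#)) (ℕ.+-suc m n) ⟨
    - ((suc m ℕ.+ suc n) ×ˢ 1#)         ≈⟨ -‿cong (×-homo-+ 1# (suc m) (suc n)) ⟩
    - (suc m ×ˢ 1# + suc n ×ˢ 1#)        ≈⟨ ⁻¹-∙-comm _ _ ⟨
    - (suc m ×ˢ 1#) - suc n ×ˢ 1#        ∎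

  ⟦⟧-pos-* : ∀ m j → ⟦ ℤ.+ m ℤ.* j ⟧ ≈ m ×ˢ 1# * ⟦ j ⟧
  ⟦⟧-pos-* m (ℤ.+ n) = begin
    ⟦ ℤ.+ m ℤ.* ℤ.+ n ⟧   ≡⟨ cong ⟦_⟧ (ℤ.pos-* m n) ⟨
    (m ℕ.* n) ×ˢ 1#        ≈⟨ ×1-homo-* m n ⟩
    m ×ˢ 1# * n ×ˢ 1#       ∎
  ⟦⟧-pos-* m ℤ.-[1+ n ] = begin
    ⟦ ℤ.+ m ℤ.* ℤ.-[1+ n ] ⟧      ≡⟨ cong ⟦_⟧ (ℤ.neg-distribʳ-* (ℤ.+ m) (ℤ.+ suc n)) ⟨
    ⟦ ℤ.- (ℤ.+ m ℤ.* ℤ.+ suc n) ⟧ ≈⟨ ⟦⟧-neg (ℤ.+ m ℤ.* ℤ.+ suc n) ⟩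
    - ⟦ ℤ.+ m ℤ.* ℤ.+ suc n ⟧     ≈⟨ -‿cong (⟦⟧-pos-* m (ℤ.+ suc n)) ⟩
    - (m ×ˢ 1# * suc n ×ˢ 1#)       ≈⟨ -‿distribʳ-* _ _ ⟩
    m ×ˢ 1# * - (suc n ×ˢ 1#)       ∎

  ⟦⟧-* : ∀ i j → ⟦ i ℤ.* j ⟧ ≈ ⟦ i ⟧ * ⟦ j ⟧
  ⟦⟧-* (ℤ.+ m) j = ⟦⟧-pos-* m j
  ⟦⟧-* ℤ.-[1+ m ] j = begin
    ⟦ ℤ.-[1+ m ] ℤ.* j ⟧          ≡⟨ cong ⟦_⟧ (ℤ.neg-distribˡ-* (ℤ.+ suc m) j) ⟨
    ⟦ ℤ.- (ℤ.+ suc m ℤ.* j) ⟧     ≈⟨ ⟦⟧-neg (ℤ.+ suc m ℤ.* j) ⟩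
    - ⟦ ℤ.+ suc m ℤ.* j ⟧         ≈⟨ -‿cong (⟦⟧-pos-* (suc m) j) ⟩
    - (suc m ×ˢ 1# * ⟦ j ⟧)        ≈⟨ -‿distribˡ-* _ _ ⟩
    - (suc m ×ˢ 1#) * ⟦ j ⟧        ∎

  homomorphism : ℤ.+-*-rawRing AlmostCommutativeRing.-Raw-AlmostCommutative⟶
                 AlmostCommutativeRing.fromCommutativeRing S
  homomorphism = record
    { ⟦_⟧    = ⟦_⟧
    ; +-homo = ⟦⟧-+
    ; *-homo = ⟦⟧-*
    ; -‿homo = ⟦⟧-neg
    ; 0-homo = ≈-refl
    ; 1-homo = ≈-refl
    }

  _≟_ : ∀ i j → Maybe (⟦ i ⟧ ≈ ⟦ j ⟧)
  i ≟ j with i ℤ.≟ j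
  ... | yes refl = just ≈-refl
  ... | no  _    = nothing

  open RingSolver ℤ.+-*-rawRing (AlmostCommutativeRing.fromCommutativeRing S)
    homomorphism _≟_ public
    using (solve; _:=_; _:+_; _:*_; _:-_; :-_; con)

-- Polynomials

module PolynomialRing (R : CommutativeRing c ℓ) where

  open CommutativeRing R renaming (refl to ≈-refl; sym to ≈-sym; trans to ≈-trans)
  open Algebra.Properties.Ring ring using (-0#≈0#)
  open Algebra.Properties.CommutativeSemigroup +-commutativeSemigroup using (interchange)
  open Polynomials R
  open Relation.Binary.Reasoning.Setoid setoid

  infix  4 _≐_
  infixl 7 _⊛_

  _≐_ : (F H : ℕ → Carrier) → Set ℓ
  F ≐ H = ∀ i → F i ≈ H i

  -- The Cauchy product. Equality of polynomials is equality of coefficient sequences, so the ring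
  -- laws are proved for sequences, where trailing zeros leave no trace, and carried over by
  -- `coeff-+` and `coeff-*`.
  _⊛_ : (F H : ℕ → Carrier) → ℕ → Carrier
  (F ⊛ H) zero    = F 0 * H 0
  (F ⊛ H) (suc i) = F 0 * H (suc i) + ((λ j → F (suc j)) ⊛ H) i

  private
    variable
      F F′ H H′ K : ℕ → Carrier

  ⊛-cong : F ≐ F′ → H ≐ H′ → F ⊛ H ≐ F′ ⊛ H′
  ⊛-cong p q zero    = *-cong (p 0) (q 0)
  ⊛-cong p q (suc i) =
    +-cong (*-cong (p 0) (q (suc i))) (⊛-cong (λ j → p (suc j)) q i)

  ⊛-zeroˡ : (∀ i → F i ≈ 0#) → ∀ i → (F ⊛ H) i ≈ 0#
  ⊛-zeroˡ p zero    = ≈-trans (*-congʳ (p 0)) (zeroˡ _)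
  ⊛-zeroˡ p (suc i) = ≈-trans
    (+-cong (≈-trans (*-congʳ (p 0)) (zeroˡ _)) (⊛-zeroˡ (λ j → p (suc j)) i))
    (+-identityˡ 0#)

  -- The definition splits off the first term of the convolution, this the last; commutativity
  -- exchanges the two.
  ⊛-sucʳ : ∀ F H i → (F ⊛ H) (suc i) ≈ (F ⊛ (λ j → H (suc j))) i + F (suc i) * H 0
  ⊛-sucʳ F H zero    = ≈-refl
  ⊛-sucʳ F H (suc i) = ≈-trans
    (+-congˡ (⊛-sucʳ (λ j → F (suc j)) H i)) (≈-sym (+-assoc _ _ _))

  ⊛-comm : ∀ F H → F ⊛ H ≐ H ⊛ F
  ⊛-comm F H zero    = *-comm _ _
  ⊛-comm F H (suc i) = begin
    F 0 * H (suc i) + ((λ j → F (suc j)) ⊛ H) i   ≈⟨ +-cong (*-comm _ _) (⊛-comm _ H i) ⟩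
    H (suc i) * F 0 + (H ⊛ (λ j → F (suc j))) i   ≈⟨ +-comm _ _ ⟩
    (H ⊛ (λ j → F (suc j))) i + H (suc i) * F 0   ≈⟨ ⊛-sucʳ H F i ⟨
    (H ⊛ F) (suc i)                               ∎

  ⊛-distribʳ : ∀ H F K → (λ i → F i + K i) ⊛ H ≐ (λ i → (F ⊛ H) i + (K ⊛ H) i)
  ⊛-distribʳ H F K zero    = distribʳ _ _ _
  ⊛-distribʳ H F K (suc i) = begin
    (F 0 + K 0) * H (suc i) + ((λ j → F (suc j) + K (suc j)) ⊛ H) i
      ≈⟨ +-cong (distribʳ _ _ _) (⊛-distribʳ H _ _ i) ⟩
    (F 0 * H (suc i) + K 0 * H (suc i)) +
      (((λ j → F (suc j)) ⊛ H) i + ((λ j → K (suc j)) ⊛ H) i)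
      ≈⟨ interchange _ _ _ _ ⟩
    (F ⊛ H) (suc i) + (K ⊛ H) (suc i) ∎

  ⊛-scale : ∀ x F H → (λ i → x * F i) ⊛ H ≐ (λ i → x * (F ⊛ H) i)
  ⊛-scale x F H zero    = *-assoc _ _ _
  ⊛-scale x F H (suc i) = ≈-trans
    (+-cong (*-assoc _ _ _) (⊛-scale x _ H i)) (≈-sym (distribˡ _ _ _))

  ⊛-assoc : ∀ F H K → (F ⊛ H) ⊛ K ≐ F ⊛ (H ⊛ K)
  ⊛-assoc F H K zero    = *-assoc _ _ _
  ⊛-assoc F H K (suc i) = begin
    F 0 * H 0 * K (suc i) +
      ((λ j → F 0 * H (suc j) + ((λ j → F (suc j)) ⊛ H) j) ⊛ K) i
      ≈⟨ +-cong (*-assoc _ _ _) (⊛-distribʳ K _ _ i) ⟩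
    F 0 * (H 0 * K (suc i)) +
      (((λ j → F 0 * H (suc j)) ⊛ K) i + (((λ j → F (suc j)) ⊛ H) ⊛ K) i)
      ≈⟨ +-congˡ (+-cong (⊛-scale (F 0) _ K i) (⊛-assoc _ H K i)) ⟩
    F 0 * (H 0 * K (suc i)) +
      (F 0 * ((λ j → H (suc j)) ⊛ K) i + ((λ j → F (suc j)) ⊛ (H ⊛ K)) i)
      ≈⟨ +-assoc _ _ _ ⟨
    F 0 * (H 0 * K (suc i)) + F 0 * ((λ j → H (suc j)) ⊛ K) i +
      ((λ j → F (suc j)) ⊛ (H ⊛ K)) i
      ≈⟨ +-congʳ (distribˡ _ _ _) ⟨
    F 0 * (H ⊛ K) (suc i) + ((λ j → F (suc j)) ⊛ (H ⊛ K)) i ∎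

  coeff-+ : ∀ f g i → coeff (f +ᴾ g) i ≈ coeff f i + coeff g i
  coeff-+ []      g       i       = ≈-sym (+-identityˡ _)
  coeff-+ (x ∷ f) []      i       = ≈-sym (+-identityʳ _)
  coeff-+ (x ∷ f) (y ∷ g) zero    = ≈-refl
  coeff-+ (x ∷ f) (y ∷ g) (suc i) = coeff-+ f g i

  coeff-scale : ∀ x f i → coeff (List.map (x *_) f) i ≈ x * coeff f i
  coeff-scale x []      i       = ≈-sym (zeroʳ x)
  coeff-scale x (y ∷ f) zero    = ≈-refl
  coeff-scale x (y ∷ f) (suc i) = coeff-scale x f i

  coeff-* : ∀ f g → coeff (f *ᴾ g) ≐ coeff f ⊛ coeff g
  coeff-* []      g i       = ≈-sym (⊛-zeroˡ (λ _ → ≈-refl) i)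
  coeff-* (x ∷ f) g zero    = begin
    coeff (List.map (x *_) g +ᴾ (0# ∷ f *ᴾ g)) 0  ≈⟨ coeff-+ (List.map (x *_) g) _ 0 ⟩
    coeff (List.map (x *_) g) 0 + 0#              ≈⟨ +-identityʳ _ ⟩
    coeff (List.map (x *_) g) 0                   ≈⟨ coeff-scale x g 0 ⟩
    x * coeff g 0                                 ∎
  coeff-* (x ∷ f) g (suc i) = begin
    coeff (List.map (x *_) g +ᴾ (0# ∷ f *ᴾ g)) (suc i)
      ≈⟨ coeff-+ (List.map (x *_) g) _ (suc i) ⟩
    coeff (List.map (x *_) g) (suc i) + coeff (f *ᴾ g) i
      ≈⟨ +-cong (coeff-scale x g (suc i)) (coeff-* f g i) ⟩
    x * coeff g (suc i) + (coeff f ⊛ coeff g) i ∎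

  -ᴾ_ : Poly → Poly
  -ᴾ_ = List.map (-_)

  coeff-neg : ∀ f i → coeff (-ᴾ f) i ≈ - coeff f i
  coeff-neg []      i       = ≈-sym -0#≈0#
  coeff-neg (x ∷ f) zero    = ≈-refl
  coeff-neg (x ∷ f) (suc i) = coeff-neg f i

  constant-⊛ : ∀ x H → coeff (constant x) ⊛ H ≐ (λ i → x * H i)
  constant-⊛ x H zero    = ≈-refl
  constant-⊛ x H (suc i) = ≈-trans (+-congˡ (⊛-zeroˡ (λ _ → ≈-refl) i)) (+-identityʳ _)

  ⊛-identityˡ : ∀ H → coeff (constant 1#) ⊛ H ≐ H
  ⊛-identityˡ H i = ≈-trans (constant-⊛ 1# H i) (*-identityˡ _)

  +ᴾ-cong : ∀ {f f′ g g′} → f ≈ᴾ f′ → g ≈ᴾ g′ → f +ᴾ g ≈ᴾ f′ +ᴾ g′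
  +ᴾ-cong {f} {f′} {g} {g′} p q i =
    ≈-trans (coeff-+ f g i) (≈-trans (+-cong (p i) (q i)) (≈-sym (coeff-+ f′ g′ i)))

  *ᴾ-cong : ∀ {f f′ g g′} → f ≈ᴾ f′ → g ≈ᴾ g′ → f *ᴾ g ≈ᴾ f′ *ᴾ g′
  *ᴾ-cong {f} {f′} {g} {g′} p q i =
    ≈-trans (coeff-* f g i) (≈-trans (⊛-cong p q i) (≈-sym (coeff-* f′ g′ i)))

  +ᴾ-assoc : ∀ f g h → (f +ᴾ g) +ᴾ h ≈ᴾ f +ᴾ (g +ᴾ h)
  +ᴾ-assoc f g h i = begin
    coeff ((f +ᴾ g) +ᴾ h) i                 ≈⟨ coeff-+ (f +ᴾ g) h i ⟩
    coeff (f +ᴾ g) i + coeff h i            ≈⟨ +-congʳ (coeff-+ f g i) ⟩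
    coeff f i + coeff g i + coeff h i       ≈⟨ +-assoc _ _ _ ⟩
    coeff f i + (coeff g i + coeff h i)     ≈⟨ +-congˡ (coeff-+ g h i) ⟨
    coeff f i + coeff (g +ᴾ h) i            ≈⟨ coeff-+ f (g +ᴾ h) i ⟨
    coeff (f +ᴾ (g +ᴾ h)) i                 ∎

  +ᴾ-comm : ∀ f g → f +ᴾ g ≈ᴾ g +ᴾ f
  +ᴾ-comm f g i =
    ≈-trans (coeff-+ f g i) (≈-trans (+-comm _ _) (≈-sym (coeff-+ g f i)))

  +ᴾ-identityʳ : ∀ f → f +ᴾ [] ≈ᴾ f
  +ᴾ-identityʳ f i = ≈-trans (coeff-+ f [] i) (+-identityʳ _)

  +ᴾ-inverseˡ : ∀ f → -ᴾ f +ᴾ f ≈ᴾ []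
  +ᴾ-inverseˡ f i = ≈-trans (coeff-+ (-ᴾ f) f i)
    (≈-trans (+-congʳ (coeff-neg f i)) (-‿inverseˡ _))

  *ᴾ-assoc : ∀ f g h → (f *ᴾ g) *ᴾ h ≈ᴾ f *ᴾ (g *ᴾ h)
  *ᴾ-assoc f g h i = begin
    coeff ((f *ᴾ g) *ᴾ h) i                 ≈⟨ coeff-* (f *ᴾ g) h i ⟩
    (coeff (f *ᴾ g) ⊛ coeff h) i            ≈⟨ ⊛-cong (coeff-* f g) (λ _ → ≈-refl) i ⟩
    (coeff f ⊛ coeff g ⊛ coeff h) i         ≈⟨ ⊛-assoc _ _ _ i ⟩
    (coeff f ⊛ (coeff g ⊛ coeff h)) i       ≈⟨ ⊛-cong (λ _ → ≈-refl) (coeff-* g h) i ⟨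
    (coeff f ⊛ coeff (g *ᴾ h)) i            ≈⟨ coeff-* f (g *ᴾ h) i ⟨
    coeff (f *ᴾ (g *ᴾ h)) i                 ∎

  *ᴾ-comm : ∀ f g → f *ᴾ g ≈ᴾ g *ᴾ f
  *ᴾ-comm f g i =
    ≈-trans (coeff-* f g i) (≈-trans (⊛-comm _ _ i) (≈-sym (coeff-* g f i)))

  *ᴾ-identityˡ : ∀ f → constant 1# *ᴾ f ≈ᴾ f
  *ᴾ-identityˡ f i = ≈-trans (coeff-* (constant 1#) f i) (⊛-identityˡ _ i)

  *ᴾ-distribʳ : ∀ h f g → (f +ᴾ g) *ᴾ h ≈ᴾ f *ᴾ h +ᴾ g *ᴾ h
  *ᴾ-distribʳ h f g i = begin
    coeff ((f +ᴾ g) *ᴾ h) i                       ≈⟨ coeff-* (f +ᴾ g) h i ⟩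
    (coeff (f +ᴾ g) ⊛ coeff h) i                  ≈⟨ ⊛-cong (coeff-+ f g) (λ _ → ≈-refl) i ⟩
    ((λ j → coeff f j + coeff g j) ⊛ coeff h) i   ≈⟨ ⊛-distribʳ _ _ _ i ⟩
    (coeff f ⊛ coeff h) i + (coeff g ⊛ coeff h) i ≈⟨ +-cong (coeff-* f h i) (coeff-* g h i) ⟨
    coeff (f *ᴾ h) i + coeff (g *ᴾ h) i           ≈⟨ coeff-+ (f *ᴾ h) (g *ᴾ h) i ⟨
    coeff (f *ᴾ h +ᴾ g *ᴾ h) i                    ∎

  *ᴾ-distribˡ : ∀ h f g → h *ᴾ (f +ᴾ g) ≈ᴾ h *ᴾ f +ᴾ h *ᴾ g
  *ᴾ-distribˡ h f g i = begin
    coeff (h *ᴾ (f +ᴾ g)) i         ≈⟨ *ᴾ-comm h (f +ᴾ g) i ⟩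
    coeff ((f +ᴾ g) *ᴾ h) i         ≈⟨ *ᴾ-distribʳ h f g i ⟩
    coeff (f *ᴾ h +ᴾ g *ᴾ h) i
      ≈⟨ +ᴾ-cong {f *ᴾ h} {h *ᴾ f} {g *ᴾ h} {h *ᴾ g} (*ᴾ-comm f h) (*ᴾ-comm g h) i ⟩
    coeff (h *ᴾ f +ᴾ h *ᴾ g) i      ∎

  commutativeRing : CommutativeRing c ℓ
  commutativeRing = record
    { Carrier = Poly
    ; _≈_     = _≈ᴾ_
    ; _+_     = _+ᴾ_
    ; _*_     = _*ᴾ_
    ; -_      = -ᴾ_
    ; 0#      = []
    ; 1#      = constant 1#
    ; isCommutativeRing = record
      { isRing = record
        { +-isAbelianGroup = record
          { isGroup = record
            { isMonoid = record
              { isSemigroup = record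
                { isMagma = record
                  { isEquivalence = record
                    { refl = λ _ → ≈-refl
                    ; sym = λ p i → ≈-sym (p i)
                    ; trans = λ p q i → ≈-trans (p i) (q i)
                    }
                  ; ∙-cong = λ {f} {f′} {g} {g′} → +ᴾ-cong {f} {f′} {g} {g′}
                  }
                ; assoc = +ᴾ-assoc
                }
              ; identity = (λ _ _ → ≈-refl) , +ᴾ-identityʳ
              }
            ; inverse = +ᴾ-inverseˡ
                      , λ f i → ≈-trans (+ᴾ-comm f (-ᴾ f) i) (+ᴾ-inverseˡ f i)
            ; ⁻¹-cong = λ {f} {g} p i →
                ≈-trans (coeff-neg f i) (≈-trans (-‿cong (p i)) (≈-sym (coeff-neg g i)))
            }
          ; comm = +ᴾ-comm
          }
        ; *-cong     = λ {f} {f′} {g} {g′} → *ᴾ-cong {f} {f′} {g} {g′}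
        ; *-assoc    = *ᴾ-assoc
        ; *-identity = *ᴾ-identityˡ
                     , λ f i → ≈-trans (*ᴾ-comm f (constant 1#) i) (*ᴾ-identityˡ f i)
        ; distrib    = *ᴾ-distribˡ , *ᴾ-distribʳ
        }
      ; *-comm = *ᴾ-comm
      }
    }

  constant-cong : ∀ {x y} → x ≈ y → constant x ≈ᴾ constant y
  constant-cong p zero    = p
  constant-cong p (suc i) = ≈-refl

  constant-* : ∀ x y → constant (x * y) ≈ᴾ constant x *ᴾ constant y
  constant-* x y i = ≈-sym (≈-trans (coeff-* (constant x) (constant y) i)
    (≈-trans (constant-⊛ x _ i) (scaled i)))
    where
    scaled : ∀ i → x * coeff (constant y) i ≈ coeff (constant (x * y)) i
    scaled zero    = ≈-refl
    scaled (suc i) = zeroʳ x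

  -- The terms are F j H (i - j): the one with j = 0 vanishes through F, all others through H.
  ⊛-vanishes : ∀ F H i → F 0 ≈ 0# → (∀ j → j ℕ.< i → H j ≈ 0#) → (F ⊛ H) i ≈ 0#
  ⊛-vanishes F H zero    F0 _ = ≈-trans (*-congʳ F0) (zeroˡ _)
  ⊛-vanishes F H (suc i) F0 H<  = ≈-trans
    (+-cong (≈-trans (*-congʳ F0) (zeroˡ _)) (below (λ j → F (suc j)) i (λ j j≤i → H< j (ℕ.s≤s j≤i))))
    (+-identityˡ 0#)
    where
    below : ∀ F i → (∀ j → j ℕ.≤ i → H j ≈ 0#) → (F ⊛ H) i ≈ 0#
    below F zero    p = ≈-trans (*-congˡ (p 0 ℕ.z≤n)) (zeroʳ _)
    below F (suc i) p = ≈-trans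
      (+-cong (≈-trans (*-congˡ (p (suc i) ℕ.≤-refl)) (zeroʳ _))
              (below (λ j → F (suc j)) i (λ j j≤i → p j (ℕ.m≤n⇒m≤1+n j≤i))))
      (+-identityˡ 0#)

  -- As t has no constant term, the coefficient of degree i in t f involves only coefficients of f
  -- of lower degree; strong induction on i removes them all.
  fixed⇒zero : ∀ t f → coeff t 0 ≈ 0# → f ≈ᴾ t *ᴾ f → f ≈ᴾ []
  fixed⇒zero t f t0 fix = ℕ.<-rec (λ i → coeff f i ≈ 0#) λ i below →
    ≈-trans (fix i) (≈-trans (coeff-* t f i) (⊛-vanishes _ _ i t0 (λ j j<i → below j<i)))

-- Insertions and the major index

does-true⁻ : (a? : Dec A) → does a? ≡ true → A
does-true⁻ (yes p) _ = p

≺-trans : ∀ {u v w} → u ≺ v → v ≺ w → u ≺ w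
≺-trans (inj₁ p)          (inj₁ q)          = inj₁ (ℕ.<-trans q p)
≺-trans (inj₁ p)          (inj₂ (refl , _)) = inj₁ p
≺-trans (inj₂ (refl , _)) (inj₁ q)          = inj₁ q
≺-trans (inj₂ (refl , p)) (inj₂ (refl , q)) = inj₂ (refl , ℕ.<-trans p q)

≺-irrefl : ∀ {u} → ¬ (u ≺ u)
≺-irrefl (inj₁ p)       = ℕ.<-irrefl refl p
≺-irrefl (inj₂ (_ , p)) = ℕ.<-irrefl refl p

≺-connex : ∀ {u v} → u ≢ v → u ≺ v ⊎ v ≺ u
≺-connex {i , z} {j , y} u≢v with ℕ.<-cmp z y
... | tri< z<y _ _ = inj₂ (inj₁ z<y)
... | tri> _ _ y<z = inj₁ (inj₁ y<z)
... | tri≈ _ refl _ with ℕ.<-cmp i j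
...   | tri< i<j _ _ = inj₁ (inj₂ (refl , i<j))
...   | tri> _ _ j<i = inj₂ (inj₂ (refl , j<i))
...   | tri≈ _ refl _ = contradiction refl u≢v

does-≺-flip : ∀ {u v} → u ≢ v → does (u ≺? v) ≡ not (does (v ≺? u))
does-≺-flip {u} {v} u≢v with ≺-connex u≢v
... | inj₁ u≺v = trans (dec-true (u ≺? v) u≺v)
  (sym (cong not (dec-false (v ≺? u) λ v≺u → ≺-irrefl {u} (≺-trans {u} {v} {u} u≺v v≺u))))
... | inj₂ v≺u = trans (dec-false (u ≺? v) λ u≺v → ≺-irrefl {u} (≺-trans {u} {v} {u} u≺v v≺u))
  (sym (cong not (dec-true (v ≺? u) v≺u)))

des : List ColoredInteger → ℕ
des []          = 0
des (_ ∷ [])    = 0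
des (x ∷ y ∷ w) = (if does (y ≺? x) then 1 else 0) ℕ.+ des (y ∷ w)

-- The effect of s inserted letters on the part of the word behind them: every descent there moves
-- by s places.
majFrom-+ : ∀ s p w → majFrom (s ℕ.+ p) w ≡ majFrom p w ℕ.+ s ℕ.* des w
majFrom-+ s p []          = sym (ℕ.*-zeroʳ s)
majFrom-+ s p (_ ∷ [])    = sym (ℕ.*-zeroʳ s)
majFrom-+ s p (x ∷ y ∷ w) = begin
  (if y≺x then s ℕ.+ p else 0) ℕ.+ majFrom (suc (s ℕ.+ p)) (y ∷ w)
    ≡⟨ cong (λ q → (if y≺x then s ℕ.+ p else 0) ℕ.+ majFrom q (y ∷ w)) (ℕ.+-suc s p) ⟨
  (if y≺x then s ℕ.+ p else 0) ℕ.+ majFrom (s ℕ.+ suc p) (y ∷ w)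
    ≡⟨ cong ((if y≺x then s ℕ.+ p else 0) ℕ.+_) (majFrom-+ s (suc p) (y ∷ w)) ⟩
  (if y≺x then s ℕ.+ p else 0) ℕ.+ (majFrom (suc p) (y ∷ w) ℕ.+ s ℕ.* des (y ∷ w))
    ≡⟨ collect y≺x ⟩
  (if y≺x then p else 0) ℕ.+ majFrom (suc p) (y ∷ w) ℕ.+ s ℕ.* ((if y≺x then 1 else 0) ℕ.+ des (y ∷ w)) ∎
  where
  open ≡-Reasoning
  open +-*-Solver
  y≺x = does (y ≺? x)
  collect : ∀ b {m d} → (if b then s ℕ.+ p else 0) ℕ.+ (m ℕ.+ s ℕ.* d) ≡
                        (if b then p else 0) ℕ.+ m ℕ.+ s ℕ.* ((if b then 1 else 0) ℕ.+ d)
  collect false = refl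
  collect true {m} {d} = solve 4 (λ s p m d →
    (s :+ p) :+ (m :+ s :* d) := (p :+ m) :+ s :* (con 1 :+ d)) refl s p m d

majFrom-0 : ∀ c w → majFrom 0 (c ∷ w) ≡ majFrom 1 w
majFrom-0 c []      = refl
majFrom-0 c (d ∷ w) with does (d ≺? c)
... | false = refl
... | true  = refl

-- Summation over the gaps of a word

module GapSums (S : CommutativeRing c ℓ) (y : CommutativeRing.Carrier S) where

  open CommutativeRing S renaming (refl to ≈-refl; sym to ≈-sym; trans to ≈-trans)
  open Algebra.Properties.Semiring.Exp semiring using (_^_; ^-homo-*; ^-congʳ)
  open IntegerCoefficients S using (solve; _:=_; _:+_; _:*_; _:-_; :-_; con)
  open Relation.Binary.Reasoning.Setoid setoid

  ^-if : ∀ b n → y ^ (if b then n else 0) ≈ (if b then y ^ n else 1#)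
  ^-if true  n = ≈-refl
  ^-if false n = ≈-refl

  if-cong : ∀ b {u v} → u ≈ v → (if b then u else 1#) ≈ (if b then v else 1#)
  if-cong true  p = p
  if-cong false _ = ≈-refl

  -- The step of the induction for three letters c, v, d with a = [v ≺ c],
  -- b = [d ≺ v] and e = [d ≺ c].
  letter-step : ∀ a b e → (a ≡ true → b ≡ true → e ≡ true) →
    (a ≡ false → b ≡ false → e ≡ false) → ∀ η Y →
    (1# - η) * ((if a then Y else 1#) * (if b then η * Y else 1#))
      + (if e then Y else 1#) * - ((if b then η else 1#) * (1# - η * Y))
    ≈ (if e then Y else 1#) *
        - ((if e then η else 1#) * (if not a then η else 1#) * (1# - Y))
  letter-step true  true  false p q η Y with () ← p refl refl
  letter-step false false true  p q η Y with () ← q refl refl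
  letter-step true  true  true  p q η Y = solve 2 (λ η Y → let 𝟙 = con ℤ.1ℤ in
    (𝟙 :- η) :* (Y :* (η :* Y)) :+ Y :* (:- (η :* (𝟙 :- η :* Y)))
    := Y :* (:- (η :* 𝟙 :* (𝟙 :- Y)))) ≈-refl η Y
  letter-step true  false true  p q η Y = solve 2 (λ η Y → let 𝟙 = con ℤ.1ℤ in
    (𝟙 :- η) :* (Y :* 𝟙) :+ Y :* (:- (𝟙 :* (𝟙 :- η :* Y)))
    := Y :* (:- (η :* 𝟙 :* (𝟙 :- Y)))) ≈-refl η Y
  letter-step true  false false p q η Y = solve 2 (λ η Y → let 𝟙 = con ℤ.1ℤ in
    (𝟙 :- η) :* (Y :* 𝟙) :+ 𝟙 :* (:- (𝟙 :* (𝟙 :- η :* Y)))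
    := 𝟙 :* (:- (𝟙 :* 𝟙 :* (𝟙 :- Y)))) ≈-refl η Y
  letter-step false true  true  p q η Y = solve 2 (λ η Y → let 𝟙 = con ℤ.1ℤ in
    (𝟙 :- η) :* (𝟙 :* (η :* Y)) :+ Y :* (:- (η :* (𝟙 :- η :* Y)))
    := Y :* (:- (η :* η :* (𝟙 :- Y)))) ≈-refl η Y
  letter-step false true  false p q η Y = solve 2 (λ η Y → let 𝟙 = con ℤ.1ℤ in
    (𝟙 :- η) :* (𝟙 :* (η :* Y)) :+ 𝟙 :* (:- (η :* (𝟙 :- η :* Y)))
    := 𝟙 :* (:- (𝟙 :* η :* (𝟙 :- Y)))) ≈-refl η Y
  letter-step false false false p q η Y = solve 2 (λ η Y → let 𝟙 = con ℤ.1ℤ in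
    (𝟙 :- η) :* (𝟙 :* 𝟙) :+ 𝟙 :* (:- (𝟙 :* (𝟙 :- η :* Y)))
    := 𝟙 :* (:- (𝟙 :* η :* (𝟙 :- Y)))) ≈-refl η Y

  module _ (s : ℕ) (g : ℕ → Carrier) (v : ColoredInteger) where

    -- A block of s increasing letters, all comparing with other letters as v
    -- does, is inserted into each gap of w, w being preceded by c at position
    -- p; the weight g depends on the position of the block.  The recurrence
    -- assumed for g below is that of the q-binomial coefficients; it is used
    -- with g = 1 for s = 1 and with g p = 1 - y ^ p for s = 2.
    gapSum : ℕ → ColoredInteger → List ColoredInteger → Carrier
    gapSum p c []      = y ^ (if does (v ≺? c) then p else 0) * g (suc p)
    gapSum p c (d ∷ w) =
      y ^ ((if does (v ≺? c) then p else 0) ℕ.+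
           ((if does (d ≺? v) then s ℕ.+ p else 0) ℕ.+ majFrom (s ℕ.+ suc p) (d ∷ w)))
        * g (suc p)
      + y ^ (if does (d ≺? c) then p else 0) * gapSum (suc p) d w

    η : Carrier
    η = y ^ s

    κ : ℕ → Carrier
    κ m = (1# - y ^ (s ℕ.+ m)) * g (suc m)

    module _ (g-step : ∀ p → (1# - y ^ suc p) * g (suc (suc p)) ≈ (1# - η * y ^ p) * g (suc p)) where

      -- For s = 1 and g = 1 the gaps of a word of length m raise the major index by 0, ..., m, each
      -- value once. The p gaps before c are not in the sum, and the subtracted term is their share:
      -- p consecutive exponents, starting at the number of descents of c ∷ w, plus one if c ≺ v.
      -- Keeping p and c general lets the induction on w pass from one gap to the next.
      gapSum-closed : ∀ p c w → v ≢ c → All (v ≢_) w →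
        (1# - η) * gapSum p c w ≈
        y ^ majFrom p (c ∷ w) *
          (κ (p ℕ.+ length w) - y ^ (s ℕ.* des (c ∷ w)) *
            (if does (c ≺? v) then η else 1#) * ((1# - y ^ p) * g (suc p)))
      gapSum-closed p c [] v≢c [] rewrite does-≺-flip (λ c≡v → v≢c (sym c≡v)) = begin
        (1# - η) * (y ^ (if does (v ≺? c) then p else 0) * g (suc p))
          ≈⟨ *-congˡ (*-congʳ (^-if (does (v ≺? c)) p)) ⟩
        (1# - η) * ((if does (v ≺? c) then y ^ p else 1#) * g (suc p))
          ≈⟨ base (does (v ≺? c)) ⟩
        1# * ((1# - η * y ^ p) * g (suc p) - 1# * (if not (does (v ≺? c)) then η else 1#) * ((1# - y ^ p) * g (suc p)))
          ≈⟨ *-congˡ (+-cong (*-cong (+-congˡ (-‿cong (≈-sym (≈-trans (^-congʳ y (cong (s ℕ.+_) (ℕ.+-identityʳ p))) (^-homo-* y s p)))))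
                                     (reflexive (cong (λ m → g (suc m)) (sym (ℕ.+-identityʳ p)))))
                    (-‿cong (*-congʳ (*-congʳ (^-congʳ y (sym (ℕ.*-zeroʳ s))))))) ⟩
        1# * (κ (p ℕ.+ 0) - y ^ (s ℕ.* 0) * (if not (does (v ≺? c)) then η else 1#) * ((1# - y ^ p) * g (suc p))) ∎
        where
        base : ∀ b → (1# - η) * ((if b then y ^ p else 1#) * g (suc p)) ≈
               1# * ((1# - η * y ^ p) * g (suc p) - 1# * (if not b then η else 1#) * ((1# - y ^ p) * g (suc p)))
        base true  = solve 3 (λ η Y g → let 𝟙 = con ℤ.1ℤ in
          (𝟙 :- η) :* (Y :* g) := 𝟙 :* ((𝟙 :- η :* Y) :* g :- 𝟙 :* 𝟙 :* ((𝟙 :- Y) :* g))) ≈-refl η (y ^ p) (g (suc p))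
        base false = solve 3 (λ η Y g → let 𝟙 = con ℤ.1ℤ in
          (𝟙 :- η) :* (𝟙 :* g) := 𝟙 :* ((𝟙 :- η :* Y) :* g :- 𝟙 :* η :* ((𝟙 :- Y) :* g))) ≈-refl η (y ^ p) (g (suc p))
      gapSum-closed p c (d ∷ w) v≢c (v≢d ∷ v∉w) = begin
        (1# - η) * (y ^ (α ℕ.+ (β ℕ.+ majFrom (s ℕ.+ suc p) (d ∷ w))) * g (suc p)
                      + y ^ ε * gapSum (suc p) d w)
          ≈⟨ *-congˡ (+-cong (*-congʳ front) (*-congʳ (^-if e p))) ⟩
        (1# - η) * (⟨a⟩ * (⟨b⟩ * (N * E)) * g₁ + ⟨e⟩ * gapSum (suc p) d w)
          ≈⟨ solve 8 (λ η a b N E g e F → let 𝟙 = con ℤ.1ℤ in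
               (𝟙 :- η) :* (a :* (b :* (N :* E)) :* g :+ e :* F)
               := ((𝟙 :- η) :* (a :* b)) :* (N :* E :* g) :+ e :* ((𝟙 :- η) :* F)) ≈-refl
               η ⟨a⟩ ⟨b⟩ N E g₁ ⟨e⟩ (gapSum (suc p) d w) ⟩
        (1# - η) * (⟨a⟩ * ⟨b⟩) * (N * E * g₁) + ⟨e⟩ * ((1# - η) * gapSum (suc p) d w)
          ≈⟨ +-congˡ (*-congˡ (gapSum-closed (suc p) d w v≢d v∉w)) ⟩
        (1# - η) * (⟨a⟩ * ⟨b⟩) * (N * E * g₁)
          + ⟨e⟩ * (N * (κ (suc p ℕ.+ length w) - E * ⟨b⟩η * ((1# - y ^ suc p) * g (suc (suc p)))))
          -- The recurrence for g brings the correction term of the shorter word to the factor `g₁`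
          -- of the first gap, so that the two can be collected.
          ≈⟨ +-congˡ (*-congˡ (*-congˡ (+-congˡ (-‿cong (*-congˡ (g-step p)))))) ⟩
        (1# - η) * (⟨a⟩ * ⟨b⟩) * (N * E * g₁)
          + ⟨e⟩ * (N * (κ (suc p ℕ.+ length w) - E * ⟨b⟩η * ((1# - η * y ^ p) * g₁)))
          ≈⟨ solve 9 (λ η ab N E g e κ b Y → let 𝟙 = con ℤ.1ℤ in
               ((𝟙 :- η) :* ab) :* (N :* E :* g)
                 :+ e :* (N :* (κ :- E :* b :* ((𝟙 :- η :* Y) :* g)))
               := ((𝟙 :- η) :* ab :+ e :* (:- (b :* (𝟙 :- η :* Y)))) :* (N :* E :* g) :+ e :* N :* κ) ≈-refl
               η (⟨a⟩ * ⟨b⟩) N E g₁ ⟨e⟩ (κ (suc p ℕ.+ length w)) ⟨b⟩η (y ^ p) ⟩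
        ((1# - η) * (⟨a⟩ * ⟨b⟩) + ⟨e⟩ * - (⟨b⟩η * (1# - η * y ^ p))) * (N * E * g₁)
          + ⟨e⟩ * N * κ (suc p ℕ.+ length w)
          -- What is left depends only on how c, v and d compare.
          ≈⟨ +-congʳ (*-congʳ (letter-step a b e true-trans false-trans η (y ^ p))) ⟩
        (⟨e⟩ * - (⟨e⟩η * ⟨¬a⟩η * (1# - y ^ p))) * (N * E * g₁)
          + ⟨e⟩ * N * κ (suc p ℕ.+ length w)
          ≈⟨ solve 8 (λ e eη aη Y N E g κ → let 𝟙 = con ℤ.1ℤ in
               (e :* (:- (eη :* aη :* (𝟙 :- Y)))) :* (N :* E :* g) :+ e :* N :* κ
               := e :* N :* (κ :- eη :* E :* aη :* ((𝟙 :- Y) :* g))) ≈-refl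
               ⟨e⟩ ⟨e⟩η ⟨¬a⟩η (y ^ p) N E g₁ (κ (suc p ℕ.+ length w)) ⟩
        ⟨e⟩ * N * (κ (suc p ℕ.+ length w) - ⟨e⟩η * E * ⟨¬a⟩η * ((1# - y ^ p) * g₁))
          ≈⟨ *-cong (*-congʳ (^-if e p)) (+-cong (reflexive (cong κ (ℕ.+-suc p (length w))))
               (-‿cong (*-congʳ (*-cong (reassemble e) (reflexive (cong (λ b → if b then η else 1#) (does-≺-flip (λ c≡v → v≢c (sym c≡v))))))))) ⟨
        y ^ ε * N * (κ (p ℕ.+ length (d ∷ w)) - y ^ (s ℕ.* des (c ∷ d ∷ w)) *
            (if does (c ≺? v) then η else 1#) * ((1# - y ^ p) * g₁))
          ≈⟨ *-congʳ (^-homo-* y ε _) ⟨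
        y ^ majFrom p (c ∷ d ∷ w) * (κ (p ℕ.+ length (d ∷ w)) - y ^ (s ℕ.* des (c ∷ d ∷ w)) *
            (if does (c ≺? v) then η else 1#) * ((1# - y ^ p) * g₁)) ∎
        where
        a = does (v ≺? c)
        b = does (d ≺? v)
        e = does (d ≺? c)
        α = if a then p else 0
        β = if b then s ℕ.+ p else 0
        ε = if e then p else 0
        ⟨a⟩ = if a then y ^ p else 1#
        ⟨b⟩ = if b then η * y ^ p else 1#
        ⟨e⟩ = if e then y ^ p else 1#
        ⟨b⟩η = if b then η else 1#
        ⟨e⟩η = if e then η else 1#
        ⟨¬a⟩η = if not a then η else 1#
        g₁ = g (suc p)
        N = y ^ majFrom (suc p) (d ∷ w)
        E = y ^ (s ℕ.* des (d ∷ w))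

        -- Transitivity of `≺` excludes two of the eight patterns of a, b and e.
        true-trans : a ≡ true → b ≡ true → e ≡ true
        true-trans p q = dec-true (d ≺? c)
          (≺-trans {d} {v} {c} (does-true⁻ (d ≺? v) q) (does-true⁻ (v ≺? c) p))

        false-trans : a ≡ false → b ≡ false → e ≡ false
        false-trans p q = dec-false (d ≺? c) λ d≺c → ≺-irrefl {c} (≺-trans {c} {d} {c}
          (≺-trans {c} {v} {d}
            (does-true⁻ (c ≺? v) (trans (does-≺-flip (λ c≡v → v≢c (sym c≡v))) (cong not p)))
            (does-true⁻ (v ≺? d) (trans (does-≺-flip v≢d) (cong not q)))) d≺c)

        front : y ^ (α ℕ.+ (β ℕ.+ majFrom (s ℕ.+ suc p) (d ∷ w))) ≈ ⟨a⟩ * (⟨b⟩ * (N * E))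
        front = begin
          y ^ (α ℕ.+ (β ℕ.+ majFrom (s ℕ.+ suc p) (d ∷ w)))
            ≈⟨ ^-homo-* y α _ ⟩
          y ^ α * y ^ (β ℕ.+ majFrom (s ℕ.+ suc p) (d ∷ w))
            ≈⟨ *-cong (^-if a p) (^-homo-* y β _) ⟩
          ⟨a⟩ * (y ^ β * y ^ majFrom (s ℕ.+ suc p) (d ∷ w))
            ≈⟨ *-congˡ (*-cong (≈-trans (^-if b _) (if-cong b (^-homo-* y s p)))
                 (≈-trans (^-congʳ y (majFrom-+ s (suc p) (d ∷ w)))
                          (^-homo-* y (majFrom (suc p) (d ∷ w)) _))) ⟩
          ⟨a⟩ * (⟨b⟩ * (N * E)) ∎

        reassemble : ∀ e → y ^ (s ℕ.* ((if e then 1 else 0) ℕ.+ des (d ∷ w))) ≈ (if e then η else 1#) * E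
        reassemble false = ≈-sym (*-identityˡ E)
        reassemble true  = ≈-trans (^-congʳ y (ℕ.*-suc s (des (d ∷ w)))) (^-homo-* y s _)

      -- With c at position 0 no gap is missing: the correction contains 1 - y^0.
      gapSum-total : ∀ c w → v ≢ c → All (v ≢_) w →
        (1# - η) * gapSum 0 c w ≈ y ^ majFrom 1 w * κ (length w)
      gapSum-total c w v≢c v∉w = begin
        (1# - η) * gapSum 0 c w
          ≈⟨ gapSum-closed 0 c w v≢c v∉w ⟩
        y ^ majFrom 0 (c ∷ w) * (κ (length w) - t * ((1# - 1#) * g 1))
          ≈⟨ *-cong (^-congʳ y (majFrom-0 c w))
               (solve 3 (λ κ t g → let 𝟙 = con ℤ.1ℤ in κ :- t :* ((𝟙 :- 𝟙) :* g) := κ) ≈-refl (κ (length w)) t (g 1)) ⟩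
        y ^ majFrom 1 w * κ (length w) ∎
        where t = y ^ (s ℕ.* des (c ∷ w)) * (if does (c ≺? v) then η else 1#)

-- Words and permutations

-- Pigeonhole: an injection between finite sets of the same size is onto. The entry x is removed
-- from both lists at each step.
unique-⊆⇒↭ : ∀ {xs ys : List A} → Unique xs → (∀ {v} → v ∈ xs → v ∈ ys) →
             length xs ≡ length ys → xs ↭ ys
unique-⊆⇒↭ {xs = []}     {[]}    _             _  _  = ↭-refl
unique-⊆⇒↭ {xs = x ∷ xs} {ys} (x∉xs ∷ uniq) xs⊆ys eq
  with ys₁ , ys₂ , refl ← ∈-∃++ (xs⊆ys (here refl)) =
  ↭-trans (prep x (unique-⊆⇒↭ uniq others
            (ℕ.suc-injective (trans eq (↭-length (shift x ys₁ ys₂))))))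
          (↭-sym (shift x ys₁ ys₂))
  where
  others : ∀ {v} → v ∈ xs → v ∈ ys₁ ++ ys₂
  others v∈xs with ∈-resp-↭ (shift x ys₁ ys₂) (xs⊆ys (there v∈xs))
  ... | here refl = contradiction refl (All.lookup x∉xs v∈xs)
  ... | there v∈  = v∈

concatMap-unique : ∀ {f : A → List B} {xs} → Unique xs →
  (∀ {x} → x ∈ xs → Unique (f x)) →
  (∀ {x y v} → x ∈ xs → y ∈ xs → v ∈ f x → v ∈ f y → x ≡ y) →
  Unique (concatMap f xs)
concatMap-unique []            _ _ = []
concatMap-unique {f = f} {x ∷ xs} (x∉xs ∷ uniq) inner inj =
  Unique.++⁺ (inner (here refl))
    (concatMap-unique uniq (inner ∘ there) (λ y∈ z∈ → inj (there y∈) (there z∈)))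
    λ (v∈fx , v∈rest) →
      let y , y∈xs , v∈fy = find (∈-concatMap⁻ f v∈rest)
      in All.lookup x∉xs y∈xs (inj (here refl) (there y∈xs) v∈fx v∈fy)

Word : Set
Word = List ColoredInteger

letters : Word → List ℕ
letters = map proj₁

letters-uncolored : ∀ lo hi → letters (uncolored lo hi) ≡ [ lo ⋯ hi ]
letters-uncolored lo hi = trans (sym (List.map-∘ [ lo ⋯ hi ])) (List.map-id [ lo ⋯ hi ])

insertions : ColoredInteger → Word → List Word
insertions v []      = (v ∷ []) ∷ []
insertions v (c ∷ w) = (v ∷ c ∷ w) ∷ map (c ∷_) (insertions v w)

insertions-↭ : ∀ {v s} w → s ∈ insertions v w → s ↭ v ∷ w
insertions-↭ []      (here refl) = ↭-refl
insertions-↭ (c ∷ w) (here refl) = ↭-refl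
insertions-↭ {v} (c ∷ w) (there s∈) with s′ , s′∈ , refl ← ∈-map⁻ (c ∷_) s∈ =
  ↭-trans (prep c (insertions-↭ w s′∈)) (swap c v ↭-refl)

insertions-⊆ : ∀ {v s} w → s ∈ insertions v w → w ⊆ s
insertions-⊆ {v} []      (here refl) = v ∷ʳ []
insertions-⊆ {v} (c ∷ w) (here refl) = v ∷ʳ ⊆-refl
insertions-⊆ (c ∷ w) (there s∈) with s′ , s′∈ , refl ← ∈-map⁻ (c ∷_) s∈ =
  refl ∷ insertions-⊆ w s′∈

∈-insertions : ∀ v w₁ w₂ → w₁ ++ v ∷ w₂ ∈ insertions v (w₁ ++ w₂)
∈-insertions v []       []       = here refl
∈-insertions v []       (c ∷ w₂) = here refl
∈-insertions v (c ∷ w₁) w₂       = there (∈-map⁺ (c ∷_) (∈-insertions v w₁ w₂))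

insertions-unique : ∀ {v} w → v ∉ w → Unique (insertions v w)
insertions-unique []      _   = [] ∷ []
insertions-unique {v} (c ∷ w) v∉w =
  All.tabulate (λ s∈ eq → head≢ s∈ (sym eq))
  ∷ Unique.map⁺ ∷-injectiveʳ (insertions-unique w (v∉w ∘ there))
  where
  head≢ : ∀ {s} → s ∈ map (c ∷_) (insertions v w) → s ≢ v ∷ c ∷ w
  head≢ s∈ refl with _ , _ , eq ← ∈-map⁻ (c ∷_) s∈ = v∉w (here (∷-injectiveˡ eq))

-- Erasing the letter i, whatever its color, recovers the word into which it was inserted.
insertions-injective : ∀ {i z z′ s} w w′ → i ∉ letters w → i ∉ letters w′ →
  s ∈ insertions (i , z) w → s ∈ insertions (i , z′) w′ → w ≡ w′
insertions-injective {i} w w′ i∉w i∉w′ s∈ s∈′ =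
  trans (sym (erase-insertions w i∉w s∈)) (erase-insertions w′ i∉w′ s∈′)
  where
  erase : Word → Word
  erase []      = []
  erase (c ∷ w) with proj₁ c ℕ.≟ i
  ... | yes _ = erase w
  ... | no  _ = c ∷ erase w

  erase-∉ : ∀ w → i ∉ letters w → erase w ≡ w
  erase-∉ []      _   = refl
  erase-∉ (c ∷ w) i∉w with proj₁ c ℕ.≟ i
  ... | yes refl = contradiction (here refl) i∉w
  ... | no  _    = cong (c ∷_) (erase-∉ w (i∉w ∘ there))

  erase-∷ : ∀ z w → erase ((i , z) ∷ w) ≡ erase w
  erase-∷ z w with i ℕ.≟ i
  ... | yes _   = refl
  ... | no  i≢i = contradiction refl i≢i

  erase-insertions : ∀ {z s} w → i ∉ letters w → s ∈ insertions (i , z) w → erase s ≡ w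
  erase-insertions {z} []      i∉w (here refl) = erase-∷ z []
  erase-insertions {z} (c ∷ w) i∉w (here refl) =
    trans (erase-∷ z (c ∷ w)) (erase-∉ (c ∷ w) i∉w)
  erase-insertions (c ∷ w) i∉w (there s∈)
    with s′ , s′∈ , refl ← ∈-map⁻ (c ∷_) s∈ with proj₁ c ℕ.≟ i
  ... | yes refl = contradiction (here refl) i∉w
  ... | no  _    = cong (c ∷_) (erase-insertions w (i∉w ∘ there) s′∈)

insertions-color-injective : ∀ {i z z′ s} w → i ∉ letters w →
  s ∈ insertions (i , z) w → s ∈ insertions (i , z′) w → z ≡ z′
insertions-color-injective w i∉w s∈ s∈′
  with ∈-resp-↭ (↭-trans (↭-sym (insertions-↭ w s∈)) (insertions-↭ w s∈′)) (here refl)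
... | here refl = refl
... | there ∈w  = contradiction (∈-map⁺ proj₁ ∈w) i∉w

⊆-remove : ∀ {v : A} {xs} w₁ {w₂} → v ∉ xs → xs ⊆ w₁ ++ v ∷ w₂ → xs ⊆ w₁ ++ w₂
⊆-remove []       v∉xs (_ ∷ʳ xs⊆)    = xs⊆
⊆-remove []       v∉xs (refl ∷ xs⊆)  = contradiction (here refl) v∉xs
⊆-remove (c ∷ w₁) v∉xs (_ ∷ʳ xs⊆)    = c ∷ʳ ⊆-remove w₁ v∉xs xs⊆
⊆-remove (c ∷ w₁) v∉xs (refl ∷ xs⊆)  = refl ∷ ⊆-remove w₁ (v∉xs ∘ there) xs⊆

-- Words obtained from a base word by insertions

module _ (r : ℕ) (base : Word) where

  -- The list is in reverse order of insertion: its head goes in last.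
  arrangements : List ℕ → List Word
  arrangements []       = base ∷ []
  arrangements (l ∷ ls) =
    concatMap (λ w → concatMap (λ z → insertions (l , z) w) (upTo r)) (arrangements ls)

  arrangements-∷⁻ : ∀ {l ls s} → s ∈ arrangements (l ∷ ls) →
    ∃₂ λ w z → w ∈ arrangements ls × z < r × s ∈ insertions (l , z) w
  arrangements-∷⁻ {l} {ls} s∈ =
    let w , w∈ , s∈w  = find (∈-concatMap⁻ (λ w → concatMap (λ z → insertions (l , z) w) (upTo r)) {xs = arrangements ls} s∈)
        z , z∈ , s∈wz = find (∈-concatMap⁻ (λ z → insertions (l , z) w) {xs = upTo r} s∈w)
    in w , z , w∈ , ∈-upTo⁻ z∈ , s∈wz

  arrangements-∷⁺ : ∀ {l ls s w z} → w ∈ arrangements ls → z < r →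
    s ∈ insertions (l , z) w → s ∈ arrangements (l ∷ ls)
  arrangements-∷⁺ {l} {w = w} w∈ z<r s∈ =
    ∈-concatMap⁺ (λ w → concatMap (λ z → insertions (l , z) w) (upTo r))
      (lose w∈ (∈-concatMap⁺ (λ z → insertions (l , z) w) (lose (∈-upTo⁺ z<r) s∈)))

  arrangements-letters : ∀ ls {w} → w ∈ arrangements ls → letters w ↭ ls ++ letters base
  arrangements-letters []       (here refl) = ↭-refl
  arrangements-letters (l ∷ ls) s∈ =
    let w , z , w∈ , _ , s∈w = arrangements-∷⁻ {ls = ls} s∈
    in ↭-trans (↭.map⁺ proj₁ (insertions-↭ w s∈w)) (prep l (arrangements-letters ls w∈))

  arrangements-colors : All (λ c → proj₂ c < r) base →
    ∀ ls {w} → w ∈ arrangements ls → All (λ c → proj₂ c < r) w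
  arrangements-colors base< []       (here refl) = base<
  arrangements-colors base< (l ∷ ls) s∈ =
    let w , z , w∈ , z<r , s∈w = arrangements-∷⁻ {ls = ls} s∈
    in All-resp-↭ (↭-sym (insertions-↭ w s∈w)) (z<r ∷ arrangements-colors base< ls w∈)

  arrangements-⊆ : ∀ ls {w} → w ∈ arrangements ls → base ⊆ w
  arrangements-⊆ []       (here refl) = ⊆-refl
  arrangements-⊆ (l ∷ ls) s∈ =
    let w , _ , w∈ , _ , s∈w = arrangements-∷⁻ {ls = ls} s∈
    in ⊆-trans (arrangements-⊆ ls w∈) (insertions-⊆ w s∈w)

  -- Deleting the letters of `ls` one after another leaves a word that still contains `base` and has
  -- the same length, hence equals it.
  ∈-arrangements : ∀ ls {w} → (∀ {l} → l ∈ ls → l ∉ letters base) →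
    letters w ↭ ls ++ letters base → All (λ c → proj₂ c < r) w → base ⊆ w →
    w ∈ arrangements ls
  ∈-arrangements [] {w} _ w↭ _ base⊆w =
    here (sym (Pointwise-≡⇒≡ (Sublist.toPointwise
      (trans (sym (length-map proj₁ base)) (trans (sym (↭-length w↭)) (length-map proj₁ w)))
      base⊆w)))
  ∈-arrangements (l ∷ ls) {w} disj w↭ w< base⊆w
    with (_ , z) , v∈w , refl ← ∈-map⁻ proj₁ (∈-resp-↭ (↭-sym w↭) (here refl))
    with w₁ , w₂ , refl ← ∈-∃++ v∈w =
    arrangements-∷⁺ {ls = ls}
      (∈-arrangements ls (disj ∘ there)
        (↭-trans (↭-reflexive (List.map-++ proj₁ w₁ w₂))
          (drop-mid (letters w₁) []
            (↭-trans (↭-reflexive (sym (List.map-++ proj₁ w₁ ((l , z) ∷ w₂)))) w↭)))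
        (All.tail v<)
        (⊆-remove w₁ (λ v∈base → disj (here refl) (∈-map⁺ proj₁ v∈base)) base⊆w))
      (All.head v<)
      (∈-insertions (l , z) w₁ w₂)
    where v< = All-resp-↭ (shift (l , z) w₁ w₂) w<

  arrangements-∉ : ∀ {l} ls {w} → Unique (l ∷ ls ++ letters base) →
    w ∈ arrangements ls → l ∉ letters w
  arrangements-∉ ls (l∉ ∷ _) w∈ l∈w =
    All.lookup l∉ (∈-resp-↭ (arrangements-letters ls w∈) l∈w) refl

  arrangements-unique : ∀ ls → Unique (ls ++ letters base) → Unique (arrangements ls)
  arrangements-unique []       _    = [] ∷ []
  arrangements-unique (l ∷ ls) uniq@(_ ∷ uniq′) =
    concatMap-unique (arrangements-unique ls uniq′)
      (λ {w} w∈ → concatMap-unique (Unique.upTo⁺ r)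
        (λ _ → insertions-unique w (arrangements-∉ ls uniq w∈ ∘ ∈-map⁺ proj₁))
        (λ _ _ → insertions-color-injective w (arrangements-∉ ls uniq w∈)))
      λ {w} {w′} w∈ w′∈ s∈ s∈′ →
        let z  , _ , s∈z  = find (∈-concatMap⁻ (λ z → insertions (l , z) w) {xs = upTo r} s∈)
            z′ , _ , s∈z′ = find (∈-concatMap⁻ (λ z → insertions (l , z) w′) {xs = upTo r} s∈′)
        in insertions-injective w w′ (arrangements-∉ ls uniq w∈) (arrangements-∉ ls uniq w′∈) s∈z s∈z′

-- Inversions and colors of words, and the words of colored permutations

below : ℕ → Word → ℕ
below i []      = 0
below i (d ∷ w) = (if does (proj₁ d ℕ.<? i) then 1 else 0) ℕ.+ below i w

inversions : Word → ℕ
inversions []      = 0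
inversions (c ∷ w) = below (proj₁ c) w ℕ.+ inversions w

totalColor : Word → ℕ
totalColor w = sum (map proj₂ w)

module _ {n r : ℕ} where

  colorWord : ∀ {m} → Vec (Fin n) m → Vec (Fin r) m → Word
  colorWord σ ζ = toList (Vec.zipWith (λ i z → suc (toℕ i) , toℕ z) σ ζ)

  colorWord-letters : ∀ {m} (σ : Vec (Fin n) m) (ζ : Vec (Fin r) m) →
    letters (colorWord σ ζ) ≡ map (suc ∘ toℕ) (toList σ)
  colorWord-letters []      []      = refl
  colorWord-letters (i ∷ σ) (z ∷ ζ) = cong (_ ∷_) (colorWord-letters σ ζ)

  colorWord-colors : ∀ {m} (σ : Vec (Fin n) m) (ζ : Vec (Fin r) m) →
    All (λ c → proj₂ c < r) (colorWord σ ζ)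
  colorWord-colors []      []      = []
  colorWord-colors (i ∷ σ) (z ∷ ζ) = Fin.toℕ<n z ∷ colorWord-colors σ ζ

  colorWord-totalColor : ∀ {m} (σ : Vec (Fin n) m) (ζ : Vec (Fin r) m) →
    totalColor (colorWord σ ζ) ≡ Vec.sum (Vec.map toℕ ζ)
  colorWord-totalColor []      []      = refl
  colorWord-totalColor (i ∷ σ) (z ∷ ζ) = cong (toℕ z ℕ.+_) (colorWord-totalColor σ ζ)

  colorWord-below : ∀ {m} (i : Fin n) (σ : Vec (Fin n) m) (ζ : Vec (Fin r) m) →
    below (suc (toℕ i)) (colorWord σ ζ) ≡ Vec.count (Fin._<? i) σ
  colorWord-below i []      []      = refl
  colorWord-below i (j ∷ σ) (z ∷ ζ) with toℕ j ℕ.<ᵇ toℕ i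
  ... | true  = cong suc (colorWord-below i σ ζ)
  ... | false = colorWord-below i σ ζ

  colorWord-inversions : ∀ {m} (σ : Vec (Fin n) m) (ζ : Vec (Fin r) m) →
    inversions (colorWord σ ζ) ≡ inv σ
  colorWord-inversions []      []      = refl
  colorWord-inversions (i ∷ σ) (z ∷ ζ) =
    cong₂ ℕ._+_ (colorWord-below i σ ζ) (colorWord-inversions σ ζ)

  colorWord-injective : ∀ {m} (σ σ′ : Vec (Fin n) m) (ζ ζ′ : Vec (Fin r) m) →
    colorWord σ ζ ≡ colorWord σ′ ζ′ → σ ≡ σ′ × ζ ≡ ζ′
  colorWord-injective [] [] [] [] _ = refl , refl
  colorWord-injective (i ∷ σ) (i′ ∷ σ′) (z ∷ ζ) (z′ ∷ ζ′) eq =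
    let heads , tails = ∷-injective eq
        σ≡ , ζ≡ = colorWord-injective σ σ′ ζ ζ′ tails
    in cong₂ _∷_ (Fin.toℕ-injective (ℕ.suc-injective (cong proj₁ heads))) σ≡
     , cong₂ _∷_ (Fin.toℕ-injective (cong proj₂ heads)) ζ≡

  colorWord-surjective : ∀ {m} w → length w ≡ m →
    All (λ i → 1 ≤ i × i ≤ n) (letters w) → All (λ c → proj₂ c < r) w →
    ∃₂ λ (σ : Vec (Fin n) m) (ζ : Vec (Fin r) m) → colorWord σ ζ ≡ w
  colorWord-surjective []                refl []                   []         = [] , [] , refl
  colorWord-surjective ((suc i , z) ∷ w) refl ((_ , i<n) ∷ bounds) (z<r ∷ w<) =
    let σ , ζ , eq = colorWord-surjective w refl bounds w<
    in fromℕ< i<n ∷ σ , fromℕ< z<r ∷ ζ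
     , cong₂ _∷_ (cong₂ _,_ (cong suc (Fin.toℕ-fromℕ< i<n)) (Fin.toℕ-fromℕ< z<r)) eq

allVecs-unique : ∀ {xs : List A} n → Unique xs → Unique (allVecs xs n)
allVecs-unique zero    _    = [] ∷ []
allVecs-unique (suc n) uniq =
  Unique.cartesianProductWith⁺ _∷_ (λ { refl → refl , refl }) uniq (allVecs-unique n uniq)

∈-allVecs : ∀ {xs : List A} → (∀ x → x ∈ xs) → ∀ {n} (v : Vec A n) → v ∈ allVecs xs n
∈-allVecs all []      = here refl
∈-allVecs all (x ∷ v) = ∈-cartesianProductWith⁺ _∷_ (all x) (∈-allVecs all v)

module _ {r n : ℕ} where

  open import Data.List.Relation.Unary.Unique.DecPropositional (Fin._≟_ {n}) using (unique?)

  G-unique : Unique (G r n)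
  G-unique = Unique.cartesianProductWith⁺ _coloredBy_ (λ { refl → refl , refl })
    (Unique.filter⁺ (λ σ → unique? (toList σ)) (allVecs-unique n (Unique.allFin⁺ n)))
    (allVecs-unique n (Unique.allFin⁺ r))

  ∈-G⁺ : ∀ {π : Colored r n} → Unique (toList ∣ π ∣) → π ∈ G r n
  ∈-G⁺ {σ coloredBy ζ} uniq = ∈-cartesianProductWith⁺ _coloredBy_
    (∈-filter⁺ (λ σ → unique? (toList σ)) (∈-allVecs ∈-allFin σ) uniq)
    (∈-allVecs ∈-allFin ζ)

  ∈-G⁻ : ∀ {π : Colored r n} → π ∈ G r n → Unique (toList ∣ π ∣)
  ∈-G⁻ π∈
    with σ , ζ , σ∈ , _ , refl ← ∈-cartesianProductWith⁻ _coloredBy_ (permutations n) (allVecs (List.allFin r) n) π∈ =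
    proj₂ (∈-filter⁻ (λ σ → unique? (toList σ)) {xs = allVecs (List.allFin n) n} σ∈)

  word-injective : ∀ {π π′ : Colored r n} → word π ≡ word π′ → π ≡ π′
  word-injective {σ coloredBy ζ} {σ′ coloredBy ζ′} eq
    with refl , refl ← colorWord-injective σ σ′ ζ ζ′ eq = refl

∈-⋯⁻ : ∀ {lo hi i} → i ∈ [ lo ⋯ hi ] → lo ≤ i × i ≤ hi
∈-⋯⁻ {lo} {hi} i∈ with j , j< , refl ← ∈-applyUpTo⁻ (lo ℕ.+_) i∈ =
  ℕ.m≤m+n lo j , ℕ.s≤s⁻¹ (ℕ.<-≤-trans (ℕ.+-monoʳ-< lo j<) (ℕ.≤-reflexive (ℕ.m+[n∸m]≡n lo≤)))
  where
  lo≤ : lo ≤ suc hi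
  lo≤ = ℕ.<⇒≤ (ℕ.m∸n≢0⇒n<m λ eq → contradiction (subst (j <_) eq j<) λ ())

∈-⋯⁺ : ∀ {lo hi i} → lo ≤ i → i ≤ hi → i ∈ [ lo ⋯ hi ]
∈-⋯⁺ {lo} {hi} {i} lo≤i i≤hi = subst (_∈ [ lo ⋯ hi ]) (ℕ.m+[n∸m]≡n lo≤i)
  (∈-applyUpTo⁺ (lo ℕ.+_) (ℕ.∸-monoˡ-< (ℕ.s≤s i≤hi) lo≤i))

⋯-unique : ∀ lo hi → Unique [ lo ⋯ hi ]
⋯-unique lo hi = Unique.applyUpTo⁺₁ (lo ℕ.+_) _
  (λ {i} {j} i<j _ eq → ℕ.<⇒≢ i<j (ℕ.+-cancelˡ-≡ lo i j eq))

-- Neither list has repetitions, so equal membership already gives a permutation. Sums over colored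
-- permutations thereby become sums over words built by insertion.
word-G-↭ : ∀ {r n} lo hi ls → 1 ≤ r → ls ++ [ lo ⋯ hi ] ↭ [ 1 ⋯ n ] →
  map word (G r , n ⟨ lo ∶ hi ⟩) ↭ arrangements r (uncolored lo hi) ls
word-G-↭ {r} {n} lo hi ls 1≤r ls↭ = ∼bag⇒↭ (unique∧set⇒bag
    (Unique.map⁺ word-injective (Unique.filter⁺ (hasSubsequence? lo hi) G-unique))
    (arrangements-unique r base ls uniq)
    (mk⇔ to from))
  where
  base = uncolored lo hi

  all↭ : ls ++ letters base ↭ [ 1 ⋯ n ]
  all↭ = subst (λ is → ls ++ is ↭ [ 1 ⋯ n ]) (sym (letters-uncolored lo hi)) ls↭

  resp : ∀ {xs ys : List ℕ} → xs ↭ ys → Unique xs → Unique ys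
  resp p = ↭ₛ.Unique-resp-↭ (≡.setoid ℕ) (↭⇒↭ₛ p)

  uniq : Unique (ls ++ letters base)
  uniq = resp (↭-sym all↭) (⋯-unique 1 n)

  disjoint : ∀ ls {l} → Unique (ls ++ letters base) → l ∈ ls → l ∉ letters base
  disjoint (l ∷ ls) (l∉ ∷ _)  (here refl) l∈ = All.lookup l∉ (∈-++⁺ʳ ls l∈) refl
  disjoint (_ ∷ ls) (_ ∷ uniq) (there l∈ls)   = disjoint ls uniq l∈ls

  base< : All (λ c → proj₂ c < r) base
  base< = All.map⁺ (All.universal (λ _ → 1≤r) [ lo ⋯ hi ])

  w↭ : ∀ {w} → w ∈ arrangements r base ls → letters w ↭ [ 1 ⋯ n ]
  w↭ w∈ = ↭-trans (arrangements-letters r base ls w∈) all↭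

  to : ∀ {w} → w ∈ map word (G r , n ⟨ lo ∶ hi ⟩) → w ∈ arrangements r base ls
  to w∈ with π@(σ coloredBy ζ) , π∈ , refl ← ∈-map⁻ word w∈
        with π∈G , base⊆ ← ∈-filter⁻ (hasSubsequence? lo hi) {xs = G r n} π∈ =
    ∈-arrangements r base ls (disjoint ls uniq)
      (↭-trans (unique-⊆⇒↭ letters-unique in-range letters-length) (↭-sym all↭))
      (colorWord-colors σ ζ) base⊆
    where
    letters-unique : Unique (letters (word π))
    letters-unique = subst Unique (sym (colorWord-letters σ ζ))
      (Unique.map⁺ (Fin.toℕ-injective ∘ ℕ.suc-injective) (∈-G⁻ π∈G))

    in-range : ∀ {i} → i ∈ letters (word π) → i ∈ [ 1 ⋯ n ]
    in-range i∈ with j , _ , refl ← ∈-map⁻ (suc ∘ toℕ) (subst (_ ∈_) (colorWord-letters σ ζ) i∈) =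
      ∈-⋯⁺ (ℕ.s≤s ℕ.z≤n) (Fin.toℕ<n j)

    letters-length : length (letters (word π)) ≡ length [ 1 ⋯ n ]
    letters-length = trans (cong length (colorWord-letters σ ζ)) (trans (length-map (suc ∘ toℕ) (toList σ))
      (trans (length-toList σ) (sym (List.length-applyUpTo suc n))))

  from : ∀ {w} → w ∈ arrangements r base ls → w ∈ map word (G r , n ⟨ lo ∶ hi ⟩)
  from {w} w∈ with σ , ζ , refl ← colorWord-surjective w
      (trans (sym (length-map proj₁ w)) (trans (↭-length (w↭ w∈)) (List.length-applyUpTo suc n)))
      (All.tabulate (λ i∈ → ∈-⋯⁻ (∈-resp-↭ (w↭ w∈) i∈))) (arrangements-colors r base base< ls w∈) =
    ∈-map⁺ word (∈-filter⁺ (hasSubsequence? lo hi) (∈-G⁺ (Unique.map⁻ {f = suc ∘ toℕ}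
        (subst Unique (colorWord-letters σ ζ) (resp (↭-sym (w↭ w∈)) (⋯-unique 1 n)))))
      (arrangements-⊆ r base ls w∈))

-- Insertion of two consecutive letters

below-↭ : ∀ i {w w′} → w ↭ w′ → below i w ≡ below i w′
below-↭ i Perm.refl      = refl
below-↭ i (prep c p)     = cong (_ ℕ.+_) (below-↭ i p)
below-↭ i (swap {ys = ys} c d p) = trans (cong (λ k → m ℕ.+ (n ℕ.+ k)) (below-↭ i p))
  (solve 3 (λ m n k → m :+ (n :+ k) := n :+ (m :+ k)) refl m n (below i ys))
  where
  open +-*-Solver
  m = if does (proj₁ c ℕ.<? i) then 1 else 0
  n = if does (proj₁ d ℕ.<? i) then 1 else 0
below-↭ i (Perm.trans p q) = trans (below-↭ i p) (below-↭ i q)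

totalColor-↭ : ∀ {w w′} → w ↭ w′ → totalColor w ≡ totalColor w′
totalColor-↭ p = sum-↭ (↭.map⁺ proj₂ p)

adjacent : ColoredInteger → ColoredInteger → Word → List Word
adjacent X Y []      = (X ∷ Y ∷ []) ∷ []
adjacent X Y (c ∷ w) = (X ∷ Y ∷ c ∷ w) ∷ map (c ∷_) (adjacent X Y w)

-- X precedes Y with at least one letter of w in between, so that X and Y are never compared in the
-- computation of descents.
separated : ColoredInteger → ColoredInteger → Word → List Word
separated X Y []      = []
separated X Y (c ∷ w) =
  map (λ s → X ∷ c ∷ s) (insertions Y w) ++ map (c ∷_) (separated X Y w)

adjacent-↭ : ∀ {t X Y} w → t ∈ adjacent X Y w → t ↭ X ∷ Y ∷ w
adjacent-↭ []      (here refl) = ↭-refl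
adjacent-↭ (c ∷ w) (here refl) = ↭-refl
adjacent-↭ {X = X} {Y} (c ∷ w) (there t∈) with t′ , t′∈ , refl ← ∈-map⁻ (c ∷_) t∈ =
  ↭-trans (prep c (adjacent-↭ w t′∈)) (↭-trans (swap c X ↭-refl) (prep X (swap c Y ↭-refl)))

module _ (f : ColoredInteger → ColoredInteger) where

  private
    map-map-∷ : ∀ c ws → map (f c ∷_) (map (map f) ws) ≡ map (map f) (map (c ∷_) ws)
    map-map-∷ c ws = trans (sym (map-∘ ws)) (map-∘ ws)

  map-insertions : ∀ v w → map (map f) (insertions v w) ≡ insertions (f v) (map f w)
  map-insertions v []      = refl
  map-insertions v (c ∷ w) = cong ((f v ∷ f c ∷ map f w) ∷_)
    (trans (sym (map-map-∷ c (insertions v w))) (cong (map (f c ∷_)) (map-insertions v w)))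

  map-adjacent : ∀ X Y w → map (map f) (adjacent X Y w) ≡ adjacent (f X) (f Y) (map f w)
  map-adjacent X Y []      = refl
  map-adjacent X Y (c ∷ w) = cong ((f X ∷ f Y ∷ f c ∷ map f w) ∷_)
    (trans (sym (map-map-∷ c (adjacent X Y w))) (cong (map (f c ∷_)) (map-adjacent X Y w)))

  map-separated : ∀ X Y w → map (map f) (separated X Y w) ≡ separated (f X) (f Y) (map f w)
  map-separated X Y []      = refl
  map-separated X Y (c ∷ w) = trans
    (map-++ (map f) (map (λ s → X ∷ c ∷ s) (insertions Y w)) _)
    (cong₂ _++_
      (trans (trans (sym (map-∘ (insertions Y w))) (map-∘ (insertions Y w)))
             (cong (map (λ s → f X ∷ f c ∷ s)) (map-insertions Y w)))
      (trans (sym (map-map-∷ c (separated X Y w))) (cong (map (f c ∷_)) (map-separated X Y w))))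

-- Exchanging the letters a and a + 1

module Transposition (a : ℕ) where

  transpose : ℕ → ℕ
  transpose i = if does (i ℕ.≟ a) then suc a else (if does (i ℕ.≟ suc a) then a else i)

  transpose-a : transpose a ≡ suc a
  transpose-a rewrite dec-true (a ℕ.≟ a) refl = refl

  transpose-suc : transpose (suc a) ≡ a
  transpose-suc rewrite dec-false (suc a ℕ.≟ a) ℕ.1+n≢n | dec-true (a ℕ.≟ a) refl = refl

  transpose-≢ : ∀ {i} → i ≢ a → i ≢ suc a → transpose i ≡ i
  transpose-≢ {i} i≢a i≢sa rewrite dec-false (i ℕ.≟ a) i≢a | dec-false (i ℕ.≟ suc a) i≢sa = refl

  τ : ColoredInteger → ColoredInteger
  τ (i , z) = transpose i , z

  Avoids : ColoredInteger → Set
  Avoids c = proj₁ c ≢ a × proj₁ c ≢ suc a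

  τ-avoids : ∀ {c} → Avoids c → τ c ≡ c
  τ-avoids (≢a , ≢sa) = cong (_, _) (transpose-≢ ≢a ≢sa)

  map-τ-avoids : ∀ {w} → All Avoids w → map τ w ≡ w
  map-τ-avoids []          = refl
  map-τ-avoids (av ∷ avs) = cong₂ _∷_ (τ-avoids av) (map-τ-avoids avs)

  data Position : ℕ → Set where
    at-a    : Position a
    at-suc  : Position (suc a)
    off     : ∀ {i} → i ≢ a → i ≢ suc a → Position i

  position : ∀ i → Position i
  position i with i ℕ.≟ a | i ℕ.≟ suc a
  ... | yes refl | _        = at-a
  ... | no  _    | yes refl = at-suc
  ... | no  ≢a   | no  ≢sa  = off ≢a ≢sa

  -- No integer lies strictly between a and a + 1, so any other letter compares with both alike. All
  -- invariance under `τ` comes from this and its mirror image.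
  a<⇔suc-a< : ∀ {i} → i ≢ suc a → a < i ⇔ suc a < i
  a<⇔suc-a< ≢sa = mk⇔ (λ a<i → ℕ.≤∧≢⇒< a<i (≢sa ∘ sym)) (ℕ.<-trans ℕ.≤-refl)

  <a⇔<suc-a : ∀ {i} → i ≢ a → i < a ⇔ i < suc a
  <a⇔<suc-a ≢a = mk⇔ ℕ.m<n⇒m<1+n (λ i<sa → ℕ.≤∧≢⇒< (ℕ.s≤s⁻¹ i<sa) ≢a)

  transpose-<⇔ : ∀ {i} j → i ≢ a → i ≢ suc a → transpose j < i ⇔ j < i
  transpose-<⇔ j ≢a ≢sa with position j
  ... | at-a  rewrite transpose-a   = ⇔-sym (a<⇔suc-a< ≢sa)
  ... | at-suc rewrite transpose-suc = a<⇔suc-a< ≢sa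
  ... | off ja jsa rewrite transpose-≢ ja jsa = ⇔-refl

  <-transpose⇔ : ∀ {i} j → i ≢ a → i ≢ suc a → i < transpose j ⇔ i < j
  <-transpose⇔ j ≢a ≢sa with position j
  ... | at-a  rewrite transpose-a   = ⇔-sym (<a⇔<suc-a ≢a)
  ... | at-suc rewrite transpose-suc = <a⇔<suc-a ≢a
  ... | off ja jsa rewrite transpose-≢ ja jsa = ⇔-refl

  below-map-τ : ∀ {i} t → i ≢ a → i ≢ suc a → below i (map τ t) ≡ below i t
  below-map-τ []            ≢a ≢sa = refl
  below-map-τ {i} ((j , _) ∷ t) ≢a ≢sa = cong₂ (λ b k → (if b then 1 else 0) ℕ.+ k)
    (does-⇔ (transpose-<⇔ j ≢a ≢sa) (transpose j ℕ.<? i) (j ℕ.<? i)) (below-map-τ t ≢a ≢sa)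

  below-suc-avoids : ∀ {w} → All Avoids w → below (suc a) w ≡ below a w
  below-suc-avoids []                       = refl
  below-suc-avoids {(j , _) ∷ _} ((≢a , _) ∷ avs) = cong₂ (λ b k → (if b then 1 else 0) ℕ.+ k)
    (does-⇔ (⇔-sym (<a⇔<suc-a ≢a)) (j ℕ.<? suc a) (j ℕ.<? a)) (below-suc-avoids avs)

  below-a-map-τ : ∀ {t} → All (λ c → proj₁ c ≢ a) t → below a (map τ t) ≡ below (suc a) t
  below-a-map-τ []             = refl
  below-a-map-τ {(j , _) ∷ _} (≢a ∷ ≢as) = cong₂ (λ b k → (if b then 1 else 0) ℕ.+ k)
    (does-⇔ (lemma j ≢a) (transpose j ℕ.<? a) (j ℕ.<? suc a)) (below-a-map-τ ≢as)
    where
    lemma : ∀ j → j ≢ a → transpose j < a ⇔ j < suc a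
    lemma j ≢a with position j
    ... | at-a = contradiction refl ≢a
    ... | at-suc rewrite transpose-suc =
      mk⇔ (λ a<a → contradiction a<a (ℕ.<-irrefl refl)) (λ p → contradiction p (ℕ.<-irrefl refl))
    ... | off ja jsa rewrite transpose-≢ ja jsa = <a⇔<suc-a ja

  -- In the absence of a, the map `τ` only renames a + 1 to a, which preserves the order of the
  -- letters.
  inversions-map-τ : ∀ {t} → All (λ c → proj₁ c ≢ a) t → inversions (map τ t) ≡ inversions t
  inversions-map-τ []         = refl
  inversions-map-τ {(i , _) ∷ t} (≢a ∷ ≢as) = cong₂ ℕ._+_ (lemma i ≢a) (inversions-map-τ ≢as)
    where
    lemma : ∀ i → i ≢ a → below (transpose i) (map τ t) ≡ below i t
    lemma i ≢a with position i
    ... | at-a = contradiction refl ≢a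
    ... | at-suc rewrite transpose-suc = below-a-map-τ ≢as
    ... | off ia isa rewrite transpose-≢ ia isa = below-map-τ t ia isa

  module _ {z z′ : ℕ} where

    private
      X Y : ColoredInteger
      X = a , z
      Y = suc a , z′

    -- After the exchange a + 1 stands before a, which is one new inversion; against the other
    -- letters nothing changes.
    inversions-front : ∀ {s} w → All Avoids w → s ∈ insertions Y w →
      inversions (map τ (X ∷ s)) ≡ suc (inversions (X ∷ s))
    inversions-front {s} w avs s∈ = begin
      below (transpose a) (map τ s) ℕ.+ inversions (map τ s)
        ≡⟨ cong₂ ℕ._+_ (cong (λ i → below i (map τ s)) transpose-a) (inversions-map-τ s≢a) ⟩
      below (suc a) (map τ s) ℕ.+ inversions s
        ≡⟨ cong (ℕ._+ inversions s) (trans (below-↭ (suc a) (↭.map⁺ τ s↭)) (front (map τ w) transpose-suc)) ⟩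
      suc (below (suc a) (map τ w)) ℕ.+ inversions s
        ≡⟨ cong (λ v → suc (below (suc a) v) ℕ.+ inversions s) (map-τ-avoids avs) ⟩
      suc (below (suc a) w) ℕ.+ inversions s
        ≡⟨ cong (λ k → suc k ℕ.+ inversions s) (below-suc-avoids avs) ⟩
      suc (below a w) ℕ.+ inversions s
        ≡⟨ cong (λ k → suc (k ℕ.+ inversions s)) (trans (below-↭ a s↭) back) ⟨
      suc (below a s ℕ.+ inversions s) ∎
      where
      open ≡-Reasoning
      s↭ : s ↭ Y ∷ w
      s↭ = insertions-↭ w s∈

      s≢a : All (λ c → proj₁ c ≢ a) s
      s≢a = All-resp-↭ (↭-sym s↭) (ℕ.1+n≢n ∷ All.map proj₁ avs)

      front : ∀ {i} v → i ≡ a → below (suc a) ((i , z′) ∷ v) ≡ suc (below (suc a) v)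
      front v refl rewrite dec-true (a ℕ.<? suc a) ℕ.≤-refl = refl

      back : below a (Y ∷ w) ≡ below a w
      back rewrite dec-false (suc a ℕ.<? a) (λ p → ℕ.<-irrefl refl (ℕ.<-trans p ℕ.≤-refl)) = refl

    inversions-∷ : ∀ c t → Avoids c → inversions (map τ t) ≡ suc (inversions t) →
      inversions (map τ (c ∷ t)) ≡ suc (inversions (c ∷ t))
    inversions-∷ c t (≢a , ≢sa) eq = trans
      (cong₂ ℕ._+_ (trans (cong (λ i → below i (map τ t)) (transpose-≢ ≢a ≢sa)) (below-map-τ t ≢a ≢sa)) eq)
      (ℕ.+-suc _ _)

    inversions-adjacent : ∀ {t} w → All Avoids w → t ∈ adjacent X Y w →
      inversions (map τ t) ≡ suc (inversions t)
    inversions-adjacent []      avs        (here refl) = inversions-front [] avs (here refl)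
    inversions-adjacent (c ∷ w) avs        (here refl) = inversions-front (c ∷ w) avs (here refl)
    inversions-adjacent (c ∷ w) (av ∷ avs) (there t∈) with t′ , t′∈ , refl ← ∈-map⁻ (c ∷_) t∈ =
      inversions-∷ c t′ av (inversions-adjacent w avs t′∈)

    inversions-separated : ∀ {t} w → All Avoids w → t ∈ separated X Y w →
      inversions (map τ t) ≡ suc (inversions t)
    inversions-separated (c ∷ w) avs@(av ∷ avs′) t∈
      with ∈-++⁻ (map (λ s → X ∷ c ∷ s) (insertions Y w)) t∈
    ... | inj₁ t∈ˡ with s , s∈ , refl ← ∈-map⁻ (λ s → X ∷ c ∷ s) t∈ˡ =
      inversions-front (c ∷ w) avs (there (∈-map⁺ (c ∷_) s∈))
    ... | inj₂ t∈ʳ with t′ , t′∈ , refl ← ∈-map⁻ (c ∷_) t∈ʳ =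
      inversions-∷ c t′ av (inversions-separated w avs′ t′∈)

  totalColor-map-τ : ∀ t → totalColor (map τ t) ≡ totalColor t
  totalColor-map-τ []      = refl
  totalColor-map-τ (c ∷ t) = cong (proj₂ c ℕ.+_) (totalColor-map-τ t)

  Invariant : ColoredInteger → ColoredInteger → Set
  Invariant c d = does (τ d ≺? τ c) ≡ does (d ≺? c)

  majFrom-map-τ : ∀ {t} → Linked Invariant t → ∀ p → majFrom p (map τ t) ≡ majFrom p t
  majFrom-map-τ []         p = refl
  majFrom-map-τ [-]        p = refl
  majFrom-map-τ (inv ∷ ls) p =
    cong₂ (λ b k → (if b then p else 0) ℕ.+ k) inv (majFrom-map-τ ls (suc p))

  ≺-map⇔ : ∀ {i i′ j j′ z z′} → (z ≡ z′ → i < j ⇔ i′ < j′) → (i , z) ≺ (j , z′) ⇔ (i′ , z) ≺ (j′ , z′)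
  ≺-map⇔ f = mk⇔
    (Sum.map id λ { (refl , i<j) → refl , Equivalence.to (f refl) i<j })
    (Sum.map id λ { (refl , i<j) → refl , Equivalence.from (f refl) i<j })

  invariantˡ : ∀ c d → Avoids c → Invariant c d
  invariantˡ c d av@(≢a , ≢sa) = trans (cong (λ e → does (τ d ≺? e)) (τ-avoids av))
    (does-⇔ (≺-map⇔ λ _ → transpose-<⇔ (proj₁ d) ≢a ≢sa) (τ d ≺? c) (d ≺? c))

  invariantʳ : ∀ c d → Avoids d → Invariant c d
  invariantʳ c d av@(≢a , ≢sa) = trans (cong (λ e → does (e ≺? τ c)) (τ-avoids {d} av))
    (does-⇔ (≺-map⇔ λ _ → <-transpose⇔ (proj₁ c) ≢a ≢sa) (d ≺? τ c) (d ≺? c))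

  -- Different colors decide the comparison before the letters are looked at. Only neighbours a and
  -- a + 1 of one color are left as an exception.
  invariant-≢ : ∀ c d → proj₂ d ≢ proj₂ c → Invariant c d
  invariant-≢ c d ≢z = does-⇔ (≺-map⇔ λ eq → contradiction eq ≢z) (τ d ≺? τ c) (d ≺? c)

  linked-∷ : ∀ {c t} → Avoids c → Linked Invariant t → Linked Invariant (c ∷ t)
  linked-∷ {t = []}    av _  = [-]
  linked-∷ {c} {d ∷ t} av ls = invariantˡ c d av ∷ ls

  linked-avoids : ∀ {w} → All Avoids w → Linked Invariant w
  linked-avoids []         = []
  linked-avoids (av ∷ avs) = linked-∷ av (linked-avoids avs)

  linked-front : ∀ X {w} → All Avoids w → Linked Invariant (X ∷ w)
  linked-front X []              = [-]
  linked-front X {c ∷ _} avs@(av ∷ _) = invariantʳ X c av ∷ linked-avoids avs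

  linked-insertions : ∀ {X s} w → All Avoids w → s ∈ insertions X w → Linked Invariant s
  linked-insertions []      avs        (here refl) = [-]
  linked-insertions (c ∷ w) avs        (here refl) = linked-front _ avs
  linked-insertions (c ∷ w) (av ∷ avs) (there s∈) with s′ , s′∈ , refl ← ∈-map⁻ (c ∷_) s∈ =
    linked-∷ av (linked-insertions w avs s′∈)

  linked-separated : ∀ {X Y t} w → All Avoids w → t ∈ separated X Y w → Linked Invariant t
  linked-separated {X} {Y} (c ∷ w) (av ∷ avs) t∈
    with ∈-++⁻ (map (λ s → X ∷ c ∷ s) (insertions Y w)) t∈
  ... | inj₁ t∈ˡ with s , s∈ , refl ← ∈-map⁻ (λ s → X ∷ c ∷ s) t∈ˡ =
    invariantʳ X c av ∷ linked-∷ av (linked-insertions w avs s∈)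
  ... | inj₂ t∈ʳ with t′ , t′∈ , refl ← ∈-map⁻ (c ∷_) t∈ʳ =
    linked-∷ av (linked-separated w avs t′∈)

  linked-adjacent : ∀ {X Y t} w → proj₂ Y ≢ proj₂ X → All Avoids w →
    t ∈ adjacent X Y w → Linked Invariant t
  linked-adjacent {X} {Y} []      ≢z avs        (here refl) = invariant-≢ X Y ≢z ∷ [-]
  linked-adjacent {X} {Y} (c ∷ w) ≢z avs        (here refl) = invariant-≢ X Y ≢z ∷ linked-front Y avs
  linked-adjacent (c ∷ w) ≢z (av ∷ avs) (there t∈) with t′ , t′∈ , refl ← ∈-map⁻ (c ∷_) t∈ =
    linked-∷ av (linked-adjacent w ≢z avs t′∈)

  -- Any other letter forms inversions with both members of the adjacent pair or with neither, and
  -- the pair in increasing order is no inversion itself.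
  inversions-adjacent-even : ∀ {z z′ t} w → All Avoids w →
    t ∈ adjacent (a , z) (suc a , z′) w → ∃ λ k → inversions t ≡ (k ℕ.+ k) ℕ.+ inversions w
  inversions-adjacent-even {z} {z′} w avs t∈ = go w avs t∈
    where
    open +-*-Solver
    here-case : ∀ w → All Avoids w →
      inversions ((a , z) ∷ (suc a , z′) ∷ w) ≡ (below a w ℕ.+ below a w) ℕ.+ inversions w
    here-case w avs rewrite dec-false (suc a ℕ.<? a) (λ p → ℕ.<-irrefl refl (ℕ.<-trans p ℕ.≤-refl))
      | below-suc-avoids avs = sym (ℕ.+-assoc (below a w) _ _)

    go : ∀ {t} w → All Avoids w → t ∈ adjacent (a , z) (suc a , z′) w →
      ∃ λ k → inversions t ≡ (k ℕ.+ k) ℕ.+ inversions w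
    go []      avs (here refl) = 0 , here-case [] avs
    -- In front of the word the pair is inverted with exactly the letters below a.
    go (c ∷ w) avs (here refl) = below a (c ∷ w) , here-case (c ∷ w) avs
    go (c@(i , _) ∷ w) ((≢a , ≢sa) ∷ avs) (there t∈) with t′ , t′∈ , refl ← ∈-map⁻ (c ∷_) t∈ =
      let k , eq = go w avs t′∈
          b = if does (a ℕ.<? i) then 1 else 0
      in b ℕ.+ k , trans
        (cong₂ ℕ._+_
          (trans (below-↭ i (adjacent-↭ w t′∈))
            (cong (λ d → b ℕ.+ ((if d then 1 else 0) ℕ.+ below i w))
              (does-⇔ (⇔-sym (a<⇔suc-a< ≢sa)) (suc a ℕ.<? i) (a ℕ.<? i))))
          eq)
        (solve 4 (λ b k m n → (b :+ (b :+ m)) :+ ((k :+ k) :+ n) := ((b :+ k) :+ (b :+ k)) :+ (m :+ n)) refl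
          b k (below i w) (inversions w))

-- Weighted sums

module Sums (S : CommutativeRing c ℓ) where

  open CommutativeRing S renaming (refl to ≈-refl; sym to ≈-sym; trans to ≈-trans)
  open Algebra.Properties.Semiring.Exp semiring using (_^_; ^-congˡ)
  open Algebra.Properties.CommutativeSemigroup +-commutativeSemigroup using (interchange; x∙yz≈y∙xz)
  open BigOperators (Semiring.rawSemiring semiring) public
  open IntegerCoefficients S using (solve; _:=_; _:+_; _:*_; _:-_; :-_; con)
  open Relation.Binary.Reasoning.Setoid setoid

  ∑-cong : ∀ {xs : List A} {f g : A → Carrier} → (∀ {v} → v ∈ xs → f v ≈ g v) → ∑ xs f ≈ ∑ xs g
  ∑-cong {xs = []}     p = ≈-refl
  ∑-cong {xs = v ∷ xs} p = +-cong (p (here refl)) (∑-cong (p ∘ there))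

  ∑-++ : ∀ (xs : List A) {ys} (f : A → Carrier) → ∑ (xs ++ ys) f ≈ ∑ xs f + ∑ ys f
  ∑-++ []       f = ≈-sym (+-identityˡ _)
  ∑-++ (v ∷ xs) f = ≈-trans (+-congˡ (∑-++ xs f)) (≈-sym (+-assoc _ _ _))

  ∑-map : ∀ (h : A → B) xs (f : B → Carrier) → ∑ (map h xs) f ≡ ∑ xs (f ∘ h)
  ∑-map h []       f = refl
  ∑-map h (v ∷ xs) f = cong (f (h v) +_) (∑-map h xs f)

  ∑-concatMap : ∀ (h : A → List B) xs (f : B → Carrier) →
    ∑ (concatMap h xs) f ≈ ∑ xs (λ v → ∑ (h v) f)
  ∑-concatMap h []       f = ≈-refl
  ∑-concatMap h (v ∷ xs) f = ≈-trans (∑-++ (h v) f) (+-congˡ (∑-concatMap h xs f))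

  ∑-zero : ∀ (xs : List A) → ∑ xs (λ _ → 0#) ≈ 0#
  ∑-zero []       = ≈-refl
  ∑-zero (v ∷ xs) = ≈-trans (+-identityˡ _) (∑-zero xs)

  ∑-+ : ∀ (xs : List A) (f g : A → Carrier) → ∑ xs (λ v → f v + g v) ≈ ∑ xs f + ∑ xs g
  ∑-+ []       f g = ≈-sym (+-identityˡ _)
  ∑-+ (v ∷ xs) f g = ≈-trans (+-congˡ (∑-+ xs f g)) (interchange _ _ _ _)

  ∑-*ˡ : ∀ u (xs : List A) (f : A → Carrier) → ∑ xs (λ v → u * f v) ≈ u * ∑ xs f
  ∑-*ˡ u []       f = ≈-sym (zeroʳ u)
  ∑-*ˡ u (v ∷ xs) f = ≈-trans (+-congˡ (∑-*ˡ u xs f)) (≈-sym (distribˡ _ _ _))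

  ∑-*ʳ : ∀ u (xs : List A) (f : A → Carrier) → ∑ xs (λ v → f v * u) ≈ ∑ xs f * u
  ∑-*ʳ u xs f = ≈-trans (∑-cong {xs = xs} (λ _ → *-comm _ _)) (≈-trans (∑-*ˡ u xs f) (*-comm _ _))

  ∑-swap : ∀ (xs : List A) (ys : List B) (f : A → B → Carrier) →
    ∑ xs (λ v → ∑ ys (f v)) ≈ ∑ ys (λ w → ∑ xs (λ v → f v w))
  ∑-swap []       ys f = ≈-sym (∑-zero ys)
  ∑-swap (v ∷ xs) ys f = ≈-trans (+-congˡ (∑-swap xs ys f)) (≈-sym (∑-+ ys _ _))

  ∑-↭ : ∀ {xs ys : List A} (f : A → Carrier) → xs ↭ ys → ∑ xs f ≈ ∑ ys f
  ∑-↭ f Perm.refl          = ≈-refl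
  ∑-↭ f (prep v p)         = +-congˡ (∑-↭ f p)
  ∑-↭ f (swap v w p)       = ≈-trans (x∙yz≈y∙xz _ _ _) (+-congˡ (+-congˡ (∑-↭ f p)))
  ∑-↭ f (Perm.trans p p′)  = ≈-trans (∑-↭ f p) (∑-↭ f p′)

  -- Reduces the double sum over the colors of a pair to its diagonal once the unequal colors have
  -- cancelled.
  ∑-single : ∀ {xs : List A} {v} (f : A → Carrier) → Unique xs → v ∈ xs →
    (∀ {w} → w ∈ xs → v ≢ w → f w ≈ 0#) → ∑ xs f ≈ f v
  ∑-single {xs = _ ∷ xs} f (v∉ ∷ _) (here refl) f0 = ≈-trans
    (+-congˡ (≈-trans (∑-cong (λ w∈ → f0 (there w∈) (All.lookup v∉ w∈))) (∑-zero xs)))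
    (+-identityʳ _)
  ∑-single f (v∉ ∷ uniq) (there v∈) f0 = ≈-trans
    (+-cong (f0 (here refl) (λ eq → All.lookup v∉ v∈ (sym eq))) (∑-single f uniq v∈ (f0 ∘ there)))
    (+-identityˡ _)

  ∏-∷ʳ : ∀ (xs : List A) v (f : A → Carrier) → ∏ (xs ++ v ∷ []) f ≈ ∏ xs f * f v
  ∏-∷ʳ []       v f = ≈-trans (*-identityʳ _) (≈-sym (*-identityˡ _))
  ∏-∷ʳ (w ∷ xs) v f = ≈-trans (*-congˡ (∏-∷ʳ xs v f)) (≈-sym (*-assoc _ _ _))

  []-suc : ∀ n u → [ suc n ]⟨ u ⟩ ≈ 1# + u * [ n ]⟨ u ⟩
  []-suc n u = +-congˡ (begin
    ∑ (applyUpTo suc n) (u ^_)     ≡⟨ cong (λ js → ∑ js (u ^_)) (map-upTo suc n) ⟨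
    ∑ (map suc (upTo n)) (u ^_)    ≡⟨ ∑-map suc (upTo n) (u ^_) ⟩
    ∑ (upTo n) (λ j → u * u ^ j)   ≈⟨ ∑-*ˡ u (upTo n) (u ^_) ⟩
    u * [ n ]⟨ u ⟩                 ∎)

  geometric : ∀ n u → (1# - u) * [ n ]⟨ u ⟩ ≈ 1# - u ^ n
  geometric zero    u = ≈-trans (zeroʳ _) (≈-sym (-‿inverseʳ 1#))
  geometric (suc n) u = begin
    (1# - u) * [ suc n ]⟨ u ⟩              ≈⟨ *-congˡ ([]-suc n u) ⟩
    (1# - u) * (1# + u * [ n ]⟨ u ⟩)       ≈⟨ solve 2 (λ u b → let 𝟙 = con ℤ.1ℤ in
                                                (𝟙 :- u) :* (𝟙 :+ u :* b) := (𝟙 :- u) :+ u :* ((𝟙 :- u) :* b)) ≈-refl u [ n ]⟨ u ⟩ ⟩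
    (1# - u) + u * ((1# - u) * [ n ]⟨ u ⟩) ≈⟨ +-congˡ (*-congˡ (geometric n u)) ⟩
    (1# - u) + u * (1# - u ^ n)            ≈⟨ solve 2 (λ u b → let 𝟙 = con ℤ.1ℤ in
                                                (𝟙 :- u) :+ u :* (𝟙 :- b) := 𝟙 :- u :* b) ≈-refl u (u ^ n) ⟩
    1# - u ^ suc n                         ∎

  []-cong : ∀ n {u v} → u ≈ v → [ n ]⟨ u ⟩ ≈ [ n ]⟨ v ⟩
  []-cong n {u} {v} u≈v = ∑-cong {xs = upTo n} (λ {j} _ → ^-congˡ j u≈v)

  -- Four disjoint cases: either letter may come first, and the two are adjacent or not.
  ∑-insertions² : ∀ X Y w (f : Word → Carrier) →
    ∑ (insertions X w) (λ s → ∑ (insertions Y s) f) ≈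
    (∑ (adjacent X Y w) f + ∑ (separated X Y w) f) + (∑ (adjacent Y X w) f + ∑ (separated Y X w) f)
  ∑-insertions² X Y [] f = solve 2 (λ a b → let 𝟘 = con ℤ.0ℤ in
    (b :+ (a :+ 𝟘)) :+ 𝟘 := (a :+ 𝟘 :+ 𝟘) :+ (b :+ 𝟘 :+ 𝟘)) ≈-refl (f (X ∷ Y ∷ [])) (f (Y ∷ X ∷ []))
  ∑-insertions² X Y (c ∷ w) f = begin
    (f YXcw + (f XYcw + ∑ (map (X ∷_) (map (c ∷_) (insertions Y w))) f))
      + ∑ (map (c ∷_) (insertions X w)) (λ s → ∑ (insertions Y s) f)
      ≡⟨ cong₂ (λ u v → (f YXcw + (f XYcw + u)) + v)
           (trans (∑-map (X ∷_) (map (c ∷_) (insertions Y w)) f) (∑-map (c ∷_) (insertions Y w) (λ s → f (X ∷ s))))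
           (∑-map (c ∷_) (insertions X w) (λ s → ∑ (insertions Y s) f)) ⟩
    (f YXcw + (f XYcw + sXY)) + ∑ (insertions X w) (λ s → f (Y ∷ c ∷ s) + ∑ (map (c ∷_) (insertions Y s)) f)
      ≈⟨ +-congˡ (≈-trans (∑-+ (insertions X w) _ _)
           (+-congˡ (≈-trans (∑-cong {xs = insertions X w} (λ {s} _ → reflexive (∑-map (c ∷_) (insertions Y s) f))) (∑-insertions² X Y w (f ∘ (c ∷_)))))) ⟩
    (f YXcw + (f XYcw + sXY)) + (sYX + ((aXY + pXY) + (aYX + pYX)))
      ≈⟨ solve 8 (λ yx xy sxy syx axy pxy ayx pyx →
           (yx :+ (xy :+ sxy)) :+ (syx :+ ((axy :+ pxy) :+ (ayx :+ pyx)))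
           := ((xy :+ axy) :+ (sxy :+ pxy)) :+ ((yx :+ ayx) :+ (syx :+ pyx))) ≈-refl
           (f YXcw) (f XYcw) sXY sYX aXY pXY aYX pYX ⟩
    ((f XYcw + aXY) + (sXY + pXY)) + ((f YXcw + aYX) + (sYX + pYX))
      ≈⟨ +-cong (+-cong (+-congˡ (reflexive (∑-map (c ∷_) (adjacent X Y w) f))) (split X Y))
                (+-cong (+-congˡ (reflexive (∑-map (c ∷_) (adjacent Y X w) f))) (split Y X)) ⟨
    (∑ (adjacent X Y (c ∷ w)) f + ∑ (separated X Y (c ∷ w)) f) + (∑ (adjacent Y X (c ∷ w)) f + ∑ (separated Y X (c ∷ w)) f) ∎
    where
    YXcw = Y ∷ X ∷ c ∷ w
    XYcw = X ∷ Y ∷ c ∷ w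
    sXY = ∑ (insertions Y w) (λ s → f (X ∷ c ∷ s))
    sYX = ∑ (insertions X w) (λ s → f (Y ∷ c ∷ s))
    aXY = ∑ (adjacent X Y w) (f ∘ (c ∷_))
    aYX = ∑ (adjacent Y X w) (f ∘ (c ∷_))
    pXY = ∑ (separated X Y w) (f ∘ (c ∷_))
    pYX = ∑ (separated Y X w) (f ∘ (c ∷_))

    split : ∀ X Y → ∑ (separated X Y (c ∷ w)) f ≈
      ∑ (insertions Y w) (λ s → f (X ∷ c ∷ s)) + ∑ (separated X Y w) (f ∘ (c ∷_))
    split X Y = ≈-trans (∑-++ (map (λ s → X ∷ c ∷ s) (insertions Y w)) f)
      (reflexive (cong₂ _+_ (∑-map (λ s → X ∷ c ∷ s) (insertions Y w) f) (∑-map (c ∷_) (separated X Y w) f)))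

-- A descent at position 0 does not count, so the letter assumed in front of a
-- word is immaterial there; it only has to differ from the inserted one.
other : ColoredInteger → ColoredInteger
other (i , z) = suc i , z

≢-other : ∀ v → v ≢ other v
≢-other (i , z) eq = ℕ.1+n≢n (sym (cong proj₁ eq))

-- The major index under insertion of a letter and of an adjacent pair

module MajorSums (S : CommutativeRing c ℓ) (y : CommutativeRing.Carrier S) where

  open CommutativeRing S renaming (sym to ≈-sym)
  open Algebra.Properties.Semiring.Exp semiring using (_^_; ^-homo-*; ^-congʳ)
  open Sums S
  open GapSums S y
  open Relation.Binary.Reasoning.Setoid setoid

  ∑-maj-insertions′ : ∀ v p d w →
    ∑ (insertions v w) (λ s → y ^ majFrom p (d ∷ s)) ≈ gapSum 1 (λ _ → 1#) v p d w
  ∑-maj-insertions′ v p d [] = begin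
    y ^ ((if does (v ≺? d) then p else 0) ℕ.+ 0) + 0#   ≈⟨ +-identityʳ _ ⟩
    y ^ ((if does (v ≺? d) then p else 0) ℕ.+ 0)        ≈⟨ ^-congʳ y (ℕ.+-identityʳ (if does (v ≺? d) then p else 0)) ⟩
    y ^ (if does (v ≺? d) then p else 0)                ≈⟨ *-identityʳ _ ⟨
    y ^ (if does (v ≺? d) then p else 0) * 1#           ∎
  ∑-maj-insertions′ v p d (e ∷ w) = +-cong (≈-sym (*-identityʳ _)) (begin
    ∑ (map (e ∷_) (insertions v w)) (λ s → y ^ majFrom p (d ∷ s))
      ≡⟨ ∑-map (e ∷_) (insertions v w) (λ s → y ^ majFrom p (d ∷ s)) ⟩
    ∑ (insertions v w) (λ s → y ^ (k ℕ.+ majFrom (suc p) (e ∷ s)))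
      ≈⟨ ∑-cong {xs = insertions v w} (λ {s} _ → ^-homo-* y k (majFrom (suc p) (e ∷ s))) ⟩
    ∑ (insertions v w) (λ s → y ^ k * y ^ majFrom (suc p) (e ∷ s))
      ≈⟨ ∑-*ˡ (y ^ k) (insertions v w) _ ⟩
    y ^ k * ∑ (insertions v w) (λ s → y ^ majFrom (suc p) (e ∷ s))
      ≈⟨ *-congˡ (∑-maj-insertions′ v (suc p) e w) ⟩
    y ^ k * gapSum 1 (λ _ → 1#) v (suc p) e w ∎)
    where k = if does (e ≺? d) then p else 0

  -- The m + 1 gaps raise the major index by 0, ..., m in some order; this is the gap sum for a
  -- block of one letter with weight 1.
  ∑-maj-insertions : ∀ v w → All (v ≢_) w →
    (1# - y) * ∑ (insertions v w) (λ s → y ^ majFrom 1 s) ≈ y ^ majFrom 1 w * (1# - y ^ suc (length w))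
  ∑-maj-insertions v w v∉w = begin
    (1# - y) * ∑ (insertions v w) (λ s → y ^ majFrom 1 s)
      ≈⟨ *-cong (+-congˡ (-‿cong (≈-sym (*-identityʳ y))))
           (∑-cong {xs = insertions v w} (λ {s} _ → ^-congʳ y (sym (majFrom-0 (other v) s)))) ⟩
    (1# - y ^ 1) * ∑ (insertions v w) (λ s → y ^ majFrom 0 (other v ∷ s))
      ≈⟨ *-congˡ (∑-maj-insertions′ v 0 (other v) w) ⟩
    (1# - y ^ 1) * gapSum 1 (λ _ → 1#) v 0 (other v) w
      ≈⟨ gapSum-total 1 (λ _ → 1#) v
           (λ p → *-congʳ (+-congˡ (-‿cong (*-congʳ (≈-sym (*-identityʳ y))))))
           (other v) w (≢-other v) v∉w ⟩
    y ^ majFrom 1 w * ((1# - y ^ suc (length w)) * 1#)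
      ≈⟨ *-congˡ (*-identityʳ _) ⟩
    y ^ majFrom 1 w * (1# - y ^ suc (length w)) ∎

module _ (a z : ℕ) where

  open Transposition a

  private
    u v : ColoredInteger
    u = a , z
    v = suc a , z

  ≺-suc : does (u ≺? v) ≡ true
  ≺-suc = dec-true (u ≺? v) (inj₂ (refl , ℕ.≤-refl))

  suc-⊀ : does (v ≺? u) ≡ false
  suc-⊀ = trans (does-≺-flip {v} {u} (λ eq → ℕ.1+n≢n (cong proj₁ eq)))
                (cong not ≺-suc)

  suc-≺-avoids : ∀ {d} → Avoids d → does (v ≺? d) ≡ does (u ≺? d)
  suc-≺-avoids {d} av = trans
    (cong₂ (λ i e → does ((i , z) ≺? e)) (sym transpose-a) (sym (τ-avoids {d} av)))
    (invariantˡ d u av)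

  avoids-≺-suc : ∀ {d} → Avoids d → does (d ≺? v) ≡ does (d ≺? u)
  avoids-≺-suc {d} av = trans
    (cong₂ (λ i e → does (e ≺? (i , z))) (sym transpose-a) (sym (τ-avoids {d} av)))
    (invariantʳ u d av)

module AdjacentSums (S : CommutativeRing c ℓ) (y : CommutativeRing.Carrier S) (a z : ℕ) where

  open CommutativeRing S renaming (refl to ≈-refl; sym to ≈-sym; trans to ≈-trans)
  open Algebra.Properties.Semiring.Exp semiring using (_^_; ^-homo-*; ^-congʳ)
  open Sums S
  open GapSums S y
  open IntegerCoefficients S using (solve; _:=_; _:+_; _:*_; _:-_; :-_; con)
  open Transposition a
  open Relation.Binary.Reasoning.Setoid setoid

  private
    u v : ColoredInteger
    u = a , z
    v = suc a , z

    g : ℕ → Carrier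
    g j = 1# - y ^ j

    difference : ∀ {k₁ k₂} k p → k₁ ≡ k → k₂ ≡ suc p ℕ.+ k → y ^ k₁ - y ^ k₂ ≈ y ^ k * g (suc p)
    difference k p refl refl = begin
      y ^ k - y ^ (suc p ℕ.+ k)       ≈⟨ +-congˡ (-‿cong (^-homo-* y (suc p) k)) ⟩
      y ^ k - y ^ suc p * y ^ k       ≈⟨ solve 2 (λ k p → k :- p :* k := k :* (con ℤ.1ℤ :- p)) ≈-refl (y ^ k) (y ^ suc p) ⟩
      y ^ k * g (suc p)               ∎

    regroup : ∀ α p k → α ℕ.+ (suc p ℕ.+ k) ≡ suc p ℕ.+ (α ℕ.+ k)
    regroup = solve′ 3 (λ α p k → α :+′ ((con′ 1 :+′ p) :+′ k) :=′ (con′ 1 :+′ p) :+′ (α :+′ k)) refl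
      where open +-*-Solver renaming (solve to solve′; _:+_ to _:+′_; _:=_ to _:=′_; con to con′)

  -- In a given gap the words with u v and with v u have the same descents, except that v u has one
  -- more inside the pair, at position p + 1. The difference is therefore the term of u v times 1 -
  -- y^(p+1), which is the term of a gap sum with s = 2 and weight `g`.
  ∑-maj-adjacent′ : ∀ p d w → Avoids d → All Avoids w →
    ∑ (adjacent u v w) (λ t → y ^ majFrom p (d ∷ t)) - ∑ (adjacent v u w) (λ t → y ^ majFrom p (d ∷ t)) ≈
    gapSum 2 g u p d w
  ∑-maj-adjacent′ p d [] av [] = ≈-trans (+-cong (+-identityʳ _) (-‿cong (+-identityʳ _)))
    (difference α p k₁ k₂)
    where
    α = if does (u ≺? d) then p else 0

    k₁ : majFrom p (d ∷ u ∷ v ∷ []) ≡ α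
    k₁ = trans (cong (λ b → α ℕ.+ ((if b then suc p else 0) ℕ.+ 0)) (suc-⊀ a z)) (ℕ.+-identityʳ α)

    k₂ : majFrom p (d ∷ v ∷ u ∷ []) ≡ suc p ℕ.+ α
    k₂ = trans (cong₂ (λ b b′ → (if b then p else 0) ℕ.+ ((if b′ then suc p else 0) ℕ.+ 0)) (suc-≺-avoids a z {d} av) (≺-suc a z))
           (trans (regroup α p 0) (cong (suc p ℕ.+_) (ℕ.+-identityʳ α)))
  ∑-maj-adjacent′ p d (e ∷ w) av (av′ ∷ avs) = begin
    (y ^ majFrom p (d ∷ u ∷ v ∷ e ∷ w) + ∑ (map (e ∷_) (adjacent u v w)) (λ t → y ^ majFrom p (d ∷ t)))
      - (y ^ majFrom p (d ∷ v ∷ u ∷ e ∷ w) + ∑ (map (e ∷_) (adjacent v u w)) (λ t → y ^ majFrom p (d ∷ t)))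
      ≈⟨ +-cong (+-congˡ (pull u v)) (-‿cong (+-congˡ (pull v u))) ⟩
    (y ^ majFrom p (d ∷ u ∷ v ∷ e ∷ w) + y ^ ε * Σ₁) - (y ^ majFrom p (d ∷ v ∷ u ∷ e ∷ w) + y ^ ε * Σ₂)
      ≈⟨ solve 5 (λ a b e s s′ → (a :+ e :* s) :- (b :+ e :* s′) := (a :- b) :+ e :* (s :- s′)) ≈-refl
           (y ^ majFrom p (d ∷ u ∷ v ∷ e ∷ w)) (y ^ majFrom p (d ∷ v ∷ u ∷ e ∷ w)) (y ^ ε) Σ₁ Σ₂ ⟩
    (y ^ majFrom p (d ∷ u ∷ v ∷ e ∷ w) - y ^ majFrom p (d ∷ v ∷ u ∷ e ∷ w)) + y ^ ε * (Σ₁ - Σ₂)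
      ≈⟨ +-cong (difference (α ℕ.+ (β ℕ.+ M)) p k₁ k₂) (*-congˡ (∑-maj-adjacent′ (suc p) e w av′ avs)) ⟩
    gapSum 2 g u p d (e ∷ w) ∎
    where
    ε = if does (e ≺? d) then p else 0
    α = if does (u ≺? d) then p else 0
    β = if does (e ≺? u) then suc (suc p) else 0
    M = majFrom (suc (suc (suc p))) (e ∷ w)
    Σ₁ = ∑ (adjacent u v w) (λ t → y ^ majFrom (suc p) (e ∷ t))
    Σ₂ = ∑ (adjacent v u w) (λ t → y ^ majFrom (suc p) (e ∷ t))

    pull : ∀ X Y → ∑ (map (e ∷_) (adjacent X Y w)) (λ t → y ^ majFrom p (d ∷ t)) ≈
                   y ^ ε * ∑ (adjacent X Y w) (λ t → y ^ majFrom (suc p) (e ∷ t))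
    pull X Y = begin
      ∑ (map (e ∷_) (adjacent X Y w)) (λ t → y ^ majFrom p (d ∷ t))
        ≡⟨ ∑-map (e ∷_) (adjacent X Y w) (λ t → y ^ majFrom p (d ∷ t)) ⟩
      ∑ (adjacent X Y w) (λ t → y ^ (ε ℕ.+ majFrom (suc p) (e ∷ t)))
        ≈⟨ ∑-cong {xs = adjacent X Y w} (λ {t} _ → ^-homo-* y ε (majFrom (suc p) (e ∷ t))) ⟩
      ∑ (adjacent X Y w) (λ t → y ^ ε * y ^ majFrom (suc p) (e ∷ t))
        ≈⟨ ∑-*ˡ (y ^ ε) (adjacent X Y w) _ ⟩
      y ^ ε * ∑ (adjacent X Y w) (λ t → y ^ majFrom (suc p) (e ∷ t)) ∎

    k₁ : majFrom p (d ∷ u ∷ v ∷ e ∷ w) ≡ α ℕ.+ (β ℕ.+ M)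
    k₁ = cong₂ (λ b b′ → α ℕ.+ ((if b then suc p else 0) ℕ.+ ((if b′ then suc (suc p) else 0) ℕ.+ M)))
           (suc-⊀ a z) (avoids-≺-suc a z {e} av′)

    k₂ : majFrom p (d ∷ v ∷ u ∷ e ∷ w) ≡ suc p ℕ.+ (α ℕ.+ (β ℕ.+ M))
    k₂ = trans (cong₂ (λ b b′ → (if b then p else 0) ℕ.+ ((if b′ then suc p else 0) ℕ.+ (β ℕ.+ M)))
                  (suc-≺-avoids a z {d} av) (≺-suc a z))
           (regroup α p (β ℕ.+ M))

  ∑-maj-adjacent : ∀ w → All Avoids w →
    (1# - y * y) * (∑ (adjacent u v w) (λ t → y ^ majFrom 1 t) - ∑ (adjacent v u w) (λ t → y ^ majFrom 1 t)) ≈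
    y ^ majFrom 1 w * ((1# - y ^ suc (suc (length w))) * (1# - y ^ suc (length w)))
  ∑-maj-adjacent w avs = begin
    (1# - y * y) * (∑ (adjacent u v w) (λ t → y ^ majFrom 1 t) - ∑ (adjacent v u w) (λ t → y ^ majFrom 1 t))
      ≈⟨ *-cong (+-congˡ (-‿cong (*-congˡ (≈-sym (*-identityʳ y))))) (+-cong (shifted u v) (-‿cong (shifted v u))) ⟩
    (1# - y ^ 2) * (∑ (adjacent u v w) (λ t → y ^ majFrom 0 (d ∷ t)) - ∑ (adjacent v u w) (λ t → y ^ majFrom 0 (d ∷ t)))
      ≈⟨ *-congˡ (∑-maj-adjacent′ 0 d w (ℕ.m+1+n≢n 1 , ℕ.1+n≢n) avs) ⟩
    (1# - y ^ 2) * gapSum 2 g u 0 d w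
      ≈⟨ gapSum-total 2 g u g-step d w (λ eq → ℕ.m+1+n≢n 1 (sym (cong proj₁ eq)))
           (All.map (λ { (≢a , _) eq → ≢a (sym (cong proj₁ eq)) }) avs) ⟩
    y ^ majFrom 1 w * ((1# - y ^ suc (suc (length w))) * (1# - y ^ suc (length w))) ∎
    where
    d : ColoredInteger
    -- The letter assumed in front has to avoid both a and a + 1; `other u` would be v.
    d = suc (suc a) , z

    shifted : ∀ X Y → ∑ (adjacent X Y w) (λ t → y ^ majFrom 1 t) ≈ ∑ (adjacent X Y w) (λ t → y ^ majFrom 0 (d ∷ t))
    shifted X Y = ∑-cong {xs = adjacent X Y w} (λ {t} _ → ^-congʳ y (sym (majFrom-0 d t)))

    g-step : ∀ p → (1# - y ^ suc p) * g (suc (suc p)) ≈ (1# - y ^ 2 * y ^ p) * g (suc p)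
    -- Both sides are (1 - y^(p+1)) (1 - y^(p+2)).
    g-step p = solve 2 (λ y Y → let 𝟙 = con ℤ.1ℤ in
      (𝟙 :- y :* Y) :* (𝟙 :- y :* (y :* Y)) := (𝟙 :- (y :* (y :* 𝟙)) :* Y) :* (𝟙 :- y :* Y)) ≈-refl y (y ^ p)

-- The weight of a word, and its sums over insertions of letters and pairs

module Weighted (S : CommutativeRing c ℓ) (ε x : CommutativeRing.Carrier S) (r : ℕ) where

  open CommutativeRing S renaming (refl to ≈-refl; sym to ≈-sym; trans to ≈-trans)
  open Algebra.Properties.CommutativeSemiring.Exp commutativeSemiring
    using (_^_; ^-homo-*; ^-congʳ; ^-congˡ; ^-assocʳ; ^-distrib-*)
  open Algebra.Properties.Ring ring using (-1*x≈-x; -‿distribˡ-*)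
  open Sums S
  open IntegerCoefficients S using (solve; _:=_; _:+_; _:*_; _:-_; :-_; con)
  open Relation.Binary.Reasoning.Setoid setoid

  y : Carrier
  y = x ^ r

  weight : Word → Carrier
  weight w = ε ^ inversions w * x ^ (r ℕ.* majFrom 1 w ℕ.+ totalColor w)

  weight-factors : ∀ w → weight w ≈ (ε ^ inversions w * x ^ totalColor w) * y ^ majFrom 1 w
  weight-factors w = begin
    ε ^ inversions w * x ^ (r ℕ.* majFrom 1 w ℕ.+ totalColor w)
      ≈⟨ *-congˡ (^-homo-* x (r ℕ.* majFrom 1 w) (totalColor w)) ⟩
    ε ^ inversions w * (x ^ (r ℕ.* majFrom 1 w) * x ^ totalColor w)
      ≈⟨ *-congˡ (*-congʳ (^-assocʳ x r (majFrom 1 w))) ⟨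
    ε ^ inversions w * (y ^ majFrom 1 w * x ^ totalColor w)
      ≈⟨ solve 3 (λ e m c → e :* (m :* c) := e :* c :* m) ≈-refl _ _ _ ⟩
    (ε ^ inversions w * x ^ totalColor w) * y ^ majFrom 1 w ∎

  1^n≈1 : ∀ n → 1# ^ n ≈ 1#
  1^n≈1 zero    = ≈-refl
  1^n≈1 (suc n) = ≈-trans (*-identityˡ _) (1^n≈1 n)

  module _ (ε²≈1 : ε * ε ≈ 1#) where

    ε^k+k≈1 : ∀ k → ε ^ (k ℕ.+ k) ≈ 1#
    ε^k+k≈1 k = begin
      ε ^ (k ℕ.+ k)      ≈⟨ ^-homo-* ε k k ⟩
      ε ^ k * ε ^ k      ≈⟨ ^-distrib-* ε ε k ⟨
      (ε * ε) ^ k        ≈⟨ ^-congˡ k ε²≈1 ⟩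
      1# ^ k             ≈⟨ 1^n≈1 k ⟩
      1#                 ∎

    -- The exponent is even: (m + 1) (m + 2) exceeds m (m + 1) by twice m + 1.
    ε^[m*[1+m]]≈1 : ∀ m → ε ^ (m ℕ.* suc m) ≈ 1#
    ε^[m*[1+m]]≈1 zero    = ≈-refl
    ε^[m*[1+m]]≈1 (suc m) = begin
      ε ^ (suc m ℕ.* suc (suc m))
        ≈⟨ ^-congʳ ε (solve′ 1 (λ m → (con′ 1 :+′ m) :*′ (con′ 2 :+′ m)
             :=′ ((con′ 1 :+′ m) :+′ (con′ 1 :+′ m)) :+′ m :*′ (con′ 1 :+′ m)) refl m) ⟩
      ε ^ ((suc m ℕ.+ suc m) ℕ.+ m ℕ.* suc m)
        ≈⟨ ^-homo-* ε (suc m ℕ.+ suc m) (m ℕ.* suc m) ⟩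
      ε ^ (suc m ℕ.+ suc m) * ε ^ (m ℕ.* suc m)
        ≈⟨ *-cong (ε^k+k≈1 (suc m)) (ε^[m*[1+m]]≈1 m) ⟩
      1# * 1#
        ≈⟨ *-identityˡ 1# ⟩
      1# ∎
      where open +-*-Solver renaming (solve to solve′; _:+_ to _:+′_; _:*_ to _:*′_; _:=_ to _:=′_; con to con′)

    -- The last power (ε^m x)^((m+1) r) has lost its sign, since ε^(m (m+1)) = 1. So the numerator
    -- is the same for both signs and only the denominator 1 - ε^m x sees ε.
    factor-geometric : ∀ m → (1# - ε ^ m * x) * [ suc m ℕ.* r ]⟨ ε ^ m * x ⟩ ≈ 1# - y ^ suc m
    factor-geometric m = begin
      (1# - ε ^ m * x) * [ suc m ℕ.* r ]⟨ ε ^ m * x ⟩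
        ≈⟨ geometric (suc m ℕ.* r) (ε ^ m * x) ⟩
      1# - (ε ^ m * x) ^ (suc m ℕ.* r)
        ≈⟨ +-congˡ (-‿cong (^-distrib-* (ε ^ m) x (suc m ℕ.* r))) ⟩
      1# - (ε ^ m) ^ (suc m ℕ.* r) * x ^ (suc m ℕ.* r)
        ≈⟨ +-congˡ (-‿cong (*-cong trivial (≈-trans (^-congʳ x (ℕ.*-comm (suc m) r)) (≈-sym (^-assocʳ x r (suc m)))))) ⟩
      1# - 1# * y ^ suc m
        ≈⟨ +-congˡ (-‿cong (*-identityˡ _)) ⟩
      1# - y ^ suc m ∎
      where
      trivial : (ε ^ m) ^ (suc m ℕ.* r) ≈ 1#
      trivial = begin
        (ε ^ m) ^ (suc m ℕ.* r)     ≈⟨ ^-assocʳ (ε ^ m) (suc m) r ⟨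
        ((ε ^ m) ^ suc m) ^ r       ≈⟨ ^-congˡ r (^-assocʳ ε m (suc m)) ⟩
        (ε ^ (m ℕ.* suc m)) ^ r     ≈⟨ ^-congˡ r (ε^[m*[1+m]]≈1 m) ⟩
        1# ^ r                      ≈⟨ 1^n≈1 r ⟩
        1#                          ∎

  letterSum : ℕ → Word → Carrier
  letterSum i w = ∑ (upTo r) (λ z → ∑ (insertions (i , z) w) weight)

  pairSum : ℕ → Word → Carrier
  pairSum a w = ∑ (upTo r) (λ z → ∑ (insertions (a , z) w) (letterSum (suc a)))

  -- The factors of the claimed product for i = m + 1 and i = m + 2.
  pairFactor : ℕ → Carrier
  pairFactor m = [ suc m ℕ.* r ]⟨ ε ^ m * x ⟩ * [ suc (suc m) ℕ.* r ]⟨ ε ^ suc m * x ⟩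

  -- Cancellation of 1 - x^j is a parameter here and is supplied for polynomials at the end; every
  -- division below uses it for some j.
  module _ (regular : ∀ j → 1 ≤ j → ∀ {f g} → (1# - x ^ j) * f ≈ (1# - x ^ j) * g → f ≈ g) (1≤r : 1 ≤ r) where

    private
      regular′ : ∀ {u} j → 1 ≤ j → u ≈ x ^ j → ∀ {f g} → (1# - u) * f ≈ (1# - u) * g → f ≈ g
      regular′ j 1≤j u≈ eq = regular j 1≤j
        (≈-trans (*-congʳ (+-congˡ (-‿cong (≈-sym u≈)))) (≈-trans eq (*-congʳ (+-congˡ (-‿cong u≈)))))

    module Plain (ε≈1 : ε ≈ 1#) where

      private
        ε^n≈1 : ∀ n → ε ^ n ≈ 1#
        ε^n≈1 n = ≈-trans (^-congˡ n ε≈1) (1^n≈1 n)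

        weight≈ : ∀ w → weight w ≈ x ^ totalColor w * y ^ majFrom 1 w
        weight≈ w = ≈-trans (weight-factors w)
          (*-congʳ (≈-trans (*-congʳ (ε^n≈1 (inversions w))) (*-identityˡ _)))

      -- With m the length of w, the colors contribute [r] at x and the gaps (1 - y^(m+1)) / (1 -
      -- y). Since 1 - y is (1 - x) times [r] at x, the product is (1 - y^(m+1)) / (1 - x). Both
      -- denominators are multiplied out first and cancelled afterwards.
      letterSum-closed : ∀ i w → i ∉ letters w → letterSum i w ≈ weight w * [ suc (length w) ℕ.* r ]⟨ x ⟩
      letterSum-closed i w i∉w = regular′ r 1≤r ≈-refl (regular′ 1 ℕ.≤-refl (≈-sym (*-identityʳ x)) (begin
        (1# - x) * ((1# - y) * letterSum i w)
          ≈⟨ *-congˡ (≈-trans (≈-sym (∑-*ˡ (1# - y) (upTo r) _)) (∑-cong {xs = upTo r} (λ {z} _ → colored z))) ⟩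
        (1# - x) * ∑ (upTo r) (λ z → x ^ z * (weight w * Q))
          ≈⟨ *-congˡ (∑-*ʳ _ (upTo r) (x ^_)) ⟩
        (1# - x) * ([ r ]⟨ x ⟩ * (weight w * Q))
          ≈⟨ *-assoc _ _ _ ⟨
        (1# - x) * [ r ]⟨ x ⟩ * (weight w * Q)
          ≈⟨ *-congʳ (geometric r x) ⟩
        (1# - y) * (weight w * Q)
          ≈⟨ *-congˡ (*-congˡ (+-congˡ (-‿cong (≈-trans (^-assocʳ x r (suc (length w))) (^-congʳ x (ℕ.*-comm r (suc (length w)))))))) ⟩
        (1# - y) * (weight w * (1# - x ^ (suc (length w) ℕ.* r)))
          ≈⟨ *-congˡ (*-congˡ (geometric (suc (length w) ℕ.* r) x)) ⟨
        (1# - y) * (weight w * ((1# - x) * [ suc (length w) ℕ.* r ]⟨ x ⟩))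
          ≈⟨ solve 4 (λ a b c d → a :* (b :* (c :* d)) := c :* (a :* (b :* d))) ≈-refl _ _ _ _ ⟩
        (1# - x) * ((1# - y) * (weight w * [ suc (length w) ℕ.* r ]⟨ x ⟩)) ∎))
        where
        Q = 1# - y ^ suc (length w)

        colored : ∀ z → (1# - y) * ∑ (insertions (i , z) w) weight ≈ x ^ z * (weight w * Q)
        colored z = begin
          (1# - y) * ∑ (insertions (i , z) w) weight
            ≈⟨ *-congˡ (≈-trans (∑-cong (λ {s} s∈ → ≈-trans (weight≈ s)
                 (*-congʳ (^-congʳ x (totalColor-↭ (insertions-↭ w s∈))))))
                 (∑-*ˡ (x ^ (z ℕ.+ totalColor w)) (insertions (i , z) w) _)) ⟩
          (1# - y) * (x ^ (z ℕ.+ totalColor w) * ∑ (insertions (i , z) w) (λ s → y ^ majFrom 1 s))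
            ≈⟨ solve 3 (λ a b c → a :* (b :* c) := b :* (a :* c)) ≈-refl _ _ _ ⟩
          x ^ (z ℕ.+ totalColor w) * ((1# - y) * ∑ (insertions (i , z) w) (λ s → y ^ majFrom 1 s))
            ≈⟨ *-cong (^-homo-* x z (totalColor w))
                 (MajorSums.∑-maj-insertions S y (i , z) w
                   (All.tabulate (λ {c} c∈ eq → i∉w (subst (_∈ letters w) (sym (cong proj₁ eq)) (∈-map⁺ proj₁ c∈))))) ⟩
          (x ^ z * x ^ totalColor w) * (y ^ majFrom 1 w * Q)
            ≈⟨ solve 4 (λ a b c d → (a :* b) :* (c :* d) := a :* ((b :* c) :* d)) ≈-refl _ _ _ _ ⟩
          x ^ z * ((x ^ totalColor w * y ^ majFrom 1 w) * Q)
            ≈⟨ *-congˡ (*-congʳ (weight≈ w)) ⟨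
          x ^ z * (weight w * Q) ∎

      pairSum-closed : ∀ a w → a ∉ letters w → suc a ∉ letters w → pairSum a w ≈ weight w * pairFactor (length w)
      pairSum-closed a w a∉w sa∉w = begin
        pairSum a w
          ≈⟨ ∑-cong {xs = upTo r} (λ {z} _ → ≈-trans (∑-cong {xs = insertions (a , z) w} (λ s∈ → inner s∈))
               (∑-*ʳ [ suc (suc (length w)) ℕ.* r ]⟨ ε ^ suc (length w) * x ⟩ (insertions (a , z) w) weight)) ⟩
        ∑ (upTo r) (λ z → ∑ (insertions (a , z) w) weight * [ suc (suc (length w)) ℕ.* r ]⟨ ε ^ suc (length w) * x ⟩)
          ≈⟨ ∑-*ʳ _ (upTo r) _ ⟩
        letterSum a w * [ suc (suc (length w)) ℕ.* r ]⟨ ε ^ suc (length w) * x ⟩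
          ≈⟨ *-congʳ (≈-trans (letterSum-closed a w a∉w) (*-congˡ ([]-cong (suc (length w) ℕ.* r) (signless (length w))))) ⟩
        weight w * [ suc (length w) ℕ.* r ]⟨ ε ^ length w * x ⟩ * [ suc (suc (length w)) ℕ.* r ]⟨ ε ^ suc (length w) * x ⟩
          ≈⟨ *-assoc _ _ _ ⟩
        weight w * pairFactor (length w) ∎
        where
        signless : ∀ n → x ≈ ε ^ n * x
        signless n = ≈-sym (≈-trans (*-congʳ (ε^n≈1 n)) (*-identityˡ x))

        inner : ∀ {z s} → s ∈ insertions (a , z) w →
          letterSum (suc a) s ≈ weight s * [ suc (suc (length w)) ℕ.* r ]⟨ ε ^ suc (length w) * x ⟩
        inner {z} {s} s∈ with s↭ ← insertions-↭ w s∈ = ≈-trans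
          (letterSum-closed (suc a) s (λ sa∈ → case (∈-resp-↭ (↭.map⁺ proj₁ s↭) sa∈)))
          (*-congˡ (≈-trans (reflexive (cong (λ n → [ suc n ℕ.* r ]⟨ x ⟩) (↭-length s↭)))
             ([]-cong (suc (suc (length w)) ℕ.* r) (signless (suc (length w))))))
          where
          case : suc a ∉ a ∷ letters w
          case (here eq)   = ℕ.1+n≢n eq
          case (there sa∈) = sa∉w sa∈

    module Alternating (ε≈-1 : ε ≈ - 1#) (a : ℕ) (w : Word) (a∉w : a ∉ letters w) (sa∉w : suc a ∉ letters w) where

      open Transposition a

      private
        ε²≈1 : ε * ε ≈ 1#
        ε²≈1 = ≈-trans (*-cong ε≈-1 ε≈-1) (solve 0 ((:- con ℤ.1ℤ) :* (:- con ℤ.1ℤ) := con ℤ.1ℤ) ≈-refl)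

        avs : All Avoids w
        avs = All.tabulate λ c∈ → (λ eq → a∉w (subst (_∈ letters w) eq (∈-map⁺ proj₁ c∈)))
                                 , (λ eq → sa∉w (subst (_∈ letters w) eq (∈-map⁺ proj₁ c∈)))

        m : ℕ
        m = length w

        Q : Carrier
        Q = (1# - y ^ suc (suc m)) * (1# - y ^ suc m)

      weight-map-τ : ∀ t → inversions (map τ t) ≡ suc (inversions t) → majFrom 1 (map τ t) ≡ majFrom 1 t →
        weight (map τ t) ≈ - weight t
      weight-map-τ t inv≡ maj≡ = begin
        ε ^ inversions (map τ t) * x ^ (r ℕ.* majFrom 1 (map τ t) ℕ.+ totalColor (map τ t))
          ≡⟨ cong₂ (λ i j → ε ^ i * x ^ j) inv≡ (cong₂ (λ i j → r ℕ.* i ℕ.+ j) maj≡ (totalColor-map-τ t)) ⟩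
        ε * ε ^ inversions t * x ^ (r ℕ.* majFrom 1 t ℕ.+ totalColor t)
          ≈⟨ *-assoc _ _ _ ⟩
        ε * weight t
          ≈⟨ *-congʳ ε≈-1 ⟩
        - 1# * weight t
          ≈⟨ -1*x≈-x _ ⟩
        - weight t ∎

      module _ (z z′ : ℕ) where

        private
          X Y X′ Y′ : ColoredInteger
          X  = a , z
          Y  = suc a , z′
          -- The images under `τ`: z remains the color of the first place and z′ that of the second.
          X′ = suc a , z
          Y′ = a , z′

          cancels : ∀ ts → (∀ {t} → t ∈ ts → weight (map τ t) ≈ - weight t) →
            ∑ ts weight + ∑ (map (map τ) ts) weight ≈ 0#
          cancels ts flip = begin
            ∑ ts weight + ∑ (map (map τ) ts) weight    ≡⟨ cong (∑ ts weight +_) (∑-map (map τ) ts weight) ⟩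
            ∑ ts weight + ∑ ts (weight ∘ map τ)        ≈⟨ ∑-+ ts weight (weight ∘ map τ) ⟨
            ∑ ts (λ t → weight t + weight (map τ t))   ≈⟨ ∑-cong (λ t∈ → ≈-trans (+-congˡ (flip t∈)) (-‿inverseʳ _)) ⟩
            ∑ ts (λ _ → 0#)                            ≈⟨ ∑-zero ts ⟩
            0#                                         ∎

          τX≡X′ : τ X ≡ X′
          τX≡X′ = cong (_, z) transpose-a

          τY≡Y′ : τ Y ≡ Y′
          τY≡Y′ = cong (_, z′) transpose-suc

        adjacent-τ : map (map τ) (adjacent X Y w) ≡ adjacent X′ Y′ w
        adjacent-τ = trans (map-adjacent τ X Y w)
          (trans (cong₂ (λ X Y → adjacent X Y (map τ w)) τX≡X′ τY≡Y′) (cong (adjacent X′ Y′) (map-τ-avoids avs)))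

        separated-τ : map (map τ) (separated X Y w) ≡ separated X′ Y′ w
        separated-τ = trans (map-separated τ X Y w)
          (trans (cong₂ (λ X Y → separated X Y (map τ w)) τX≡X′ τY≡Y′) (cong (separated X′ Y′) (map-τ-avoids avs)))

        ∑-separated : ∑ (separated X Y w) weight + ∑ (separated X′ Y′ w) weight ≈ 0#
        ∑-separated = ≈-trans (reflexive (cong (λ ts → ∑ (separated X Y w) weight + ∑ ts weight) (sym separated-τ)))
          (cancels (separated X Y w) λ {t} t∈ →
            weight-map-τ t (inversions-separated w avs t∈) (majFrom-map-τ (linked-separated w avs t∈) 1))

        ∑-adjacent-≢ : z ≢ z′ → ∑ (adjacent X Y w) weight + ∑ (adjacent X′ Y′ w) weight ≈ 0#
        ∑-adjacent-≢ z≢z′ = ≈-trans (reflexive (cong (λ ts → ∑ (adjacent X Y w) weight + ∑ ts weight) (sym adjacent-τ)))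
          (cancels (adjacent X Y w) λ {t} t∈ →
            weight-map-τ t (inversions-adjacent w avs t∈) (majFrom-map-τ (linked-adjacent w (z≢z′ ∘ sym) avs t∈) 1))

      -- For equal colors the exchange also moves the major index, so the two sums do not cancel.
      -- Their signs are opposite, which leaves the difference of major index sums for the two
      -- orders; the two letters of color z contribute x^(2z).
      ∑-adjacent : ∀ z →
        (1# - y * y) * (∑ (adjacent (a , z) (suc a , z) w) weight + ∑ (adjacent (suc a , z) (a , z) w) weight) ≈
        (x * x) ^ z * (weight w * Q)
      ∑-adjacent z = begin
        (1# - y * y) * (∑ uv weight + ∑ vu weight)
          ≈⟨ *-congˡ (+-cong
               (≈-trans (∑-cong ascending) (∑-*ˡ K uv _))
               (≈-trans (∑-cong descending) (∑-*ˡ (- K) vu _))) ⟩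
        (1# - y * y) * (K * ∑ uv (λ t → y ^ majFrom 1 t) + - K * ∑ vu (λ t → y ^ majFrom 1 t))
          ≈⟨ solve 4 (λ y k s s′ → y :* (k :* s :+ (:- k) :* s′) := k :* (y :* (s :- s′))) ≈-refl (1# - y * y) K _ _ ⟩
        K * ((1# - y * y) * (∑ uv (λ t → y ^ majFrom 1 t) - ∑ vu (λ t → y ^ majFrom 1 t)))
          ≈⟨ *-congˡ (AdjacentSums.∑-maj-adjacent S y a z w avs) ⟩
        K * (y ^ majFrom 1 w * Q)
          ≈⟨ *-congʳ (*-congˡ (≈-trans (^-homo-* x z _) (*-congˡ (^-homo-* x z _)))) ⟩
        ε ^ inversions w * (x ^ z * (x ^ z * x ^ totalColor w)) * (y ^ majFrom 1 w * Q)
          ≈⟨ solve 5 (λ e z c m q → e :* (z :* (z :* c)) :* (m :* q) := (z :* z) :* (((e :* c) :* m) :* q)) ≈-refl _ _ _ _ _ ⟩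
        (x ^ z * x ^ z) * (((ε ^ inversions w * x ^ totalColor w) * y ^ majFrom 1 w) * Q)
          ≈⟨ *-cong (^-distrib-* x x z) (*-congʳ (weight-factors w)) ⟨
        (x * x) ^ z * (weight w * Q) ∎
        where
        uv = adjacent (a , z) (suc a , z) w
        vu = adjacent (suc a , z) (a , z) w
        K = ε ^ inversions w * x ^ (z ℕ.+ (z ℕ.+ totalColor w))

        even : ∀ {t} → t ∈ uv → ε ^ inversions t ≈ ε ^ inversions w
        even t∈ with k , eq ← inversions-adjacent-even w avs t∈ = ≈-trans (^-congʳ ε eq)
          (≈-trans (^-homo-* ε (k ℕ.+ k) _) (≈-trans (*-congʳ (ε^k+k≈1 ε²≈1 k)) (*-identityˡ _)))

        ascending : ∀ {t} → t ∈ uv → weight t ≈ K * y ^ majFrom 1 t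
        ascending {t} t∈ = ≈-trans (weight-factors t)
          (*-congʳ (*-cong (even t∈) (^-congʳ x (totalColor-↭ (adjacent-↭ w t∈)))))

        descending : ∀ {t} → t ∈ vu → weight t ≈ - K * y ^ majFrom 1 t
        -- A word with a + 1 before a is the image of one with a before a + 1; the exchange adds one
        -- inversion and hence the minus sign.
        descending {t} t∈ with t′ , t′∈ , refl ← ∈-map⁻ (map τ) (subst (t ∈_) (sym (adjacent-τ z z)) t∈) = begin
          weight (map τ t′)
            ≈⟨ weight-factors (map τ t′) ⟩
          (ε ^ inversions (map τ t′) * x ^ totalColor (map τ t′)) * y ^ majFrom 1 (map τ t′)
            ≈⟨ *-congʳ (*-cong (≈-trans (^-congʳ ε (inversions-adjacent w avs t′∈))
                 (≈-trans (*-cong ε≈-1 (even t′∈)) (-1*x≈-x _)))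
                 (^-congʳ x (trans (totalColor-map-τ t′) (totalColor-↭ (adjacent-↭ w t′∈))))) ⟩
          (- ε ^ inversions w * x ^ (z ℕ.+ (z ℕ.+ totalColor w))) * y ^ majFrom 1 (map τ t′)
            ≈⟨ *-congʳ (-‿distribˡ-* _ _) ⟨
          - K * y ^ majFrom 1 (map τ t′) ∎

      private
        -- The arguments are the colors of the first and of the second place, not of a and a + 1. In
        -- this indexing `τ` pairs a term of `A′ z z′` with a term of `B′ z z′`.
        A′ B′ T : ℕ → ℕ → Carrier
        A′ z z′ = ∑ (adjacent (a , z) (suc a , z′) w) weight + ∑ (separated (a , z) (suc a , z′) w) weight
        B′ z z′ = ∑ (adjacent (suc a , z) (a , z′) w) weight + ∑ (separated (suc a , z) (a , z′) w) weight
        T z z′ = A′ z z′ + B′ z z′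

        T≈ : ∀ z z′ → T z z′ ≈ ∑ (adjacent (a , z) (suc a , z′) w) weight + ∑ (adjacent (suc a , z) (a , z′) w) weight
        T≈ z z′ = begin
          (d + s) + (d′ + s′)    ≈⟨ solve 4 (λ d s d′ s′ → (d :+ s) :+ (d′ :+ s′) := (d :+ d′) :+ (s :+ s′)) ≈-refl d s d′ s′ ⟩
          (d + d′) + (s + s′)    ≈⟨ +-congˡ (∑-separated z z′) ⟩
          (d + d′) + 0#          ≈⟨ +-identityʳ _ ⟩
          d + d′                 ∎
          where
          d  = ∑ (adjacent (a , z) (suc a , z′) w) weight
          s  = ∑ (separated (a , z) (suc a , z′) w) weight
          d′ = ∑ (adjacent (suc a , z) (a , z′) w) weight
          s′ = ∑ (separated (suc a , z) (a , z′) w) weight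

      pairSum-diagonal : pairSum a w ≈ ∑ (upTo r) (λ z → T z z)
      pairSum-diagonal = begin
        pairSum a w
          ≈⟨ ∑-cong {xs = upTo r} (λ {z} _ → ≈-trans
               (∑-swap (insertions (a , z) w) (upTo r) (λ s z′ → ∑ (insertions (suc a , z′) s) weight))
               (∑-cong {xs = upTo r} (λ {z′} _ → ∑-insertions² (a , z) (suc a , z′) w weight))) ⟩
        ∑ (upTo r) (λ z → ∑ (upTo r) (λ z′ → A′ z z′ + B′ z′ z))
          ≈⟨ ∑∑-+ A′ (λ z z′ → B′ z′ z) ⟩
        ∑ (upTo r) (λ z → ∑ (upTo r) (A′ z)) + ∑ (upTo r) (λ z → ∑ (upTo r) (λ z′ → B′ z′ z))
          -- Where a + 1 comes first, the color of a is that of the second place, so the two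
          -- summation variables change roles.
          ≈⟨ +-congˡ (∑-swap (upTo r) (upTo r) (λ z z′ → B′ z′ z)) ⟩
        ∑ (upTo r) (λ z → ∑ (upTo r) (A′ z)) + ∑ (upTo r) (λ z → ∑ (upTo r) (B′ z))
          ≈⟨ ∑∑-+ A′ B′ ⟨
        ∑ (upTo r) (λ z → ∑ (upTo r) (T z))
          ≈⟨ ∑-cong {xs = upTo r} (λ {z} z∈ → ∑-single (T z) (Unique.upTo⁺ r) z∈
               (λ {z′} _ z≢z′ → ≈-trans (T≈ z z′) (∑-adjacent-≢ z z′ z≢z′))) ⟩
        ∑ (upTo r) (λ z → T z z) ∎
        where
        ∑∑-+ : ∀ (F H : ℕ → ℕ → Carrier) → ∑ (upTo r) (λ z → ∑ (upTo r) (λ z′ → F z z′ + H z z′)) ≈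
          ∑ (upTo r) (λ z → ∑ (upTo r) (F z)) + ∑ (upTo r) (λ z → ∑ (upTo r) (H z))
        ∑∑-+ F H = ≈-trans (∑-cong {xs = upTo r} (λ {z} _ → ∑-+ (upTo r) (F z) (H z))) (∑-+ (upTo r) _ _)

      pairSum-closed : pairSum a w ≈ weight w * pairFactor m
      -- The two cancelled factors are 1 - y², where y² = x^(2r), and 1 - x².
      pairSum-closed = regular′ (r ℕ.+ r) (ℕ.≤-trans 1≤r (ℕ.m≤m+n r r)) (≈-sym (^-homo-* x r r))
        (regular′ 2 (ℕ.s≤s ℕ.z≤n) (*-congˡ (≈-sym (*-identityʳ x))) (begin
        (1# - x * x) * ((1# - y * y) * pairSum a w)
          ≈⟨ *-congˡ (*-congˡ pairSum-diagonal) ⟩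
        (1# - x * x) * ((1# - y * y) * ∑ (upTo r) (λ z → T z z))
          ≈⟨ *-congˡ (≈-trans (≈-sym (∑-*ˡ (1# - y * y) (upTo r) _))
               (∑-cong {xs = upTo r} (λ {z} _ → ≈-trans (*-congˡ (T≈ z z)) (∑-adjacent z)))) ⟩
        (1# - x * x) * ∑ (upTo r) (λ z → (x * x) ^ z * (weight w * Q))
          ≈⟨ *-congˡ (∑-*ʳ _ (upTo r) ((x * x) ^_)) ⟩
        (1# - x * x) * ([ r ]⟨ x * x ⟩ * (weight w * Q))
          ≈⟨ *-assoc _ _ _ ⟨
        (1# - x * x) * [ r ]⟨ x * x ⟩ * (weight w * Q)
          -- The sum over the common color z closes to 1 - (x²)^r, that is 1 - y², the denominator
          -- brought in by `∑-adjacent`.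
          ≈⟨ *-congʳ (≈-trans (geometric r (x * x)) (+-congˡ (-‿cong (^-distrib-* x x r)))) ⟩
        (1# - y * y) * (weight w * ((1# - y ^ suc (suc m)) * (1# - y ^ suc m)))
          ≈⟨ *-congˡ (*-congˡ (*-cong (factor-geometric ε²≈1 (suc m)) (factor-geometric ε²≈1 m))) ⟨
        (1# - y * y) * (weight w * (((1# - ε ^ suc m * x) * K₂) * ((1# - ε ^ m * x) * K₁)))
          ≈⟨ solve 6 (λ y w u k₂ v k₁ → y :* (w :* ((u :* k₂) :* (v :* k₁))) := (u :* v) :* (y :* (w :* (k₁ :* k₂)))) ≈-refl _ _ _ _ _ _ ⟩
        ((1# - ε ^ suc m * x) * (1# - ε ^ m * x)) * ((1# - y * y) * (weight w * pairFactor m))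
          ≈⟨ *-congʳ factors ⟩
        (1# - x * x) * ((1# - y * y) * (weight w * pairFactor m)) ∎))
        where
        K₁ = [ suc m ℕ.* r ]⟨ ε ^ m * x ⟩
        K₂ = [ suc (suc m) ℕ.* r ]⟨ ε ^ suc m * x ⟩

        -- The signs ε^m and ε^(m+1) are opposite, so these are 1 - x and 1 + x in some order.
        factors : (1# - ε ^ suc m * x) * (1# - ε ^ m * x) ≈ 1# - x * x
        factors = begin
          (1# - ε * ε ^ m * x) * (1# - ε ^ m * x)
            ≈⟨ *-congʳ (+-congˡ (-‿cong (*-congʳ (*-congʳ ε≈-1)))) ⟩
          (1# - - 1# * ε ^ m * x) * (1# - ε ^ m * x)
            ≈⟨ solve 2 (λ e x → let 𝟙 = con ℤ.1ℤ in (𝟙 :- (:- 𝟙) :* e :* x) :* (𝟙 :- e :* x) := 𝟙 :- (e :* e) :* (x :* x)) ≈-refl (ε ^ m) x ⟩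
          1# - (ε ^ m * ε ^ m) * (x * x)
            ≈⟨ +-congˡ (-‿cong (*-congʳ (≈-trans (≈-sym (^-homo-* ε m m)) (ε^k+k≈1 ε²≈1 m)))) ⟩
          1# - 1# * (x * x)
            ≈⟨ +-congˡ (-‿cong (*-identityˡ _)) ⟩
          1# - x * x ∎

    pairSum-closed : ε ≈ 1# ⊎ ε ≈ - 1# → ∀ a w → a ∉ letters w → suc a ∉ letters w →
      pairSum a w ≈ weight w * pairFactor (length w)
    pairSum-closed (inj₁ ε≈1)  = Plain.pairSum-closed ε≈1
    pairSum-closed (inj₂ ε≈-1) = Alternating.pairSum-closed ε≈-1

-- Words without descents and without inversions, and insertion of a smallest letter

_⊏_ : ColoredInteger → ColoredInteger → Set
c ⊏ d = c ≺ d × proj₁ c < proj₁ d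

below-⊏ : ∀ {c w} → All (c ⊏_) w → below (proj₁ c) w ≡ 0
below-⊏ []                       = refl
below-⊏ {c} {d ∷ _} ((_ , c<d) ∷ ps) rewrite dec-false (proj₁ d ℕ.<? proj₁ c) (ℕ.<-asym c<d) = below-⊏ ps

inversions-increasing : ∀ {w} → AllPairs _⊏_ w → inversions w ≡ 0
inversions-increasing []       = refl
inversions-increasing (p ∷ ps) = cong₂ ℕ._+_ (below-⊏ p) (inversions-increasing ps)

⊏⇒⊀ : ∀ {c d} → c ⊏ d → does (d ≺? c) ≡ false
⊏⇒⊀ {c} {d} (c≺d , _) = dec-false (d ≺? c) (λ d≺c → ≺-irrefl {c} (≺-trans {c} {d} {c} c≺d d≺c))

majFrom-increasing : ∀ p {w} → AllPairs _⊏_ w → majFrom p w ≡ 0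
majFrom-increasing p []                    = refl
majFrom-increasing p ([] ∷ [])             = refl
majFrom-increasing p {c ∷ d ∷ w} ((c⊏d ∷ _) ∷ ps) rewrite ⊏⇒⊀ {c} {d} c⊏d = majFrom-increasing (suc p) ps

uncolored-increasing : ∀ lo hi → AllPairs _⊏_ (uncolored lo hi)
uncolored-increasing lo hi = AllPairs.map⁺ (AllPairs.applyUpTo⁺₁ (lo ℕ.+_) (suc hi ℕ.∸ lo)
  (λ i<j _ → inj₂ (refl , ℕ.+-monoʳ-< lo i<j) , ℕ.+-monoʳ-< lo i<j))

totalColor-uncolored : ∀ lo hi → totalColor (uncolored lo hi) ≡ 0
totalColor-uncolored lo hi = go [ lo ⋯ hi ]
  where
  go : ∀ is → totalColor (map (_, 0) is) ≡ 0
  go []       = refl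
  go (_ ∷ is) = go is

⊏-uncolored : ∀ {i lo} hi z → i < lo → All ((i , z) ⊏_) (uncolored lo hi)
⊏-uncolored {i} {lo} hi z i<lo = All.map⁺ (All.tabulate λ j∈ →
  let i<j = ℕ.<-≤-trans i<lo (proj₁ (∈-⋯⁻ j∈)) in smaller z i<j , i<j)
  where
  smaller : ∀ {j} z → i < j → (i , z) ≺ (j , 0)
  smaller zero    i<j = inj₂ (refl , i<j)
  smaller (suc z) i<j = inj₁ (ℕ.s≤s ℕ.z≤n)

-- In reverse order of insertion, as in `arrangements`: a goes in just before a + 1, matching
-- `pairSum`.
data Paired : List ℕ → Set where
  []   : Paired []
  pair : ∀ a {ls} → Paired ls → Paired (suc a ∷ a ∷ ls)

module Totals (S : CommutativeRing c ℓ) (ε x : CommutativeRing.Carrier S) (r : ℕ) where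

  open CommutativeRing S renaming (refl to ≈-refl; sym to ≈-sym; trans to ≈-trans)
  open Algebra.Properties.Semiring.Exp semiring using (_^_; ^-congʳ)
  open Sums S
  open Weighted S ε x r
  open IntegerCoefficients S using (solve; _:=_; _:+_; _:*_; con)
  open Relation.Binary.Reasoning.Setoid setoid

  module _ (v : ColoredInteger) where

    -- A smallest letter placed behind j letters of an increasing word creates j inversions and a
    -- single descent, at position j. Moving it one place to the right thus multiplies the term by ε
    -- y. The gaps here start right behind d, and the inversion with d is not counted.
    ∑-small-insertions′ : ∀ p d w → All (v ⊏_) (d ∷ w) → AllPairs _⊏_ (d ∷ w) →
      ∑ (insertions v w) (λ s → ε ^ inversions s * y ^ majFrom p (d ∷ s)) ≈
      y ^ p * [ suc (length w) ]⟨ ε * y ⟩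
    ∑-small-insertions′ p d [] (v⊏d ∷ []) _ = begin
      1# * y ^ ((if does (v ≺? d) then p else 0) ℕ.+ 0) + 0#
        ≈⟨ +-congʳ (*-congˡ (^-congʳ y (trans (cong (λ b → (if b then p else 0) ℕ.+ 0) (dec-true (v ≺? d) (proj₁ v⊏d))) (ℕ.+-identityʳ p)))) ⟩
      1# * y ^ p + 0#
        ≈⟨ solve 1 (λ Y → con ℤ.1ℤ :* Y :+ con ℤ.0ℤ := Y :* (con ℤ.1ℤ :+ con ℤ.0ℤ)) ≈-refl (y ^ p) ⟩
      y ^ p * [ 1 ]⟨ ε * y ⟩ ∎
    ∑-small-insertions′ p d (e ∷ w) (v⊏d ∷ v⊏@(v⊏e ∷ v⊏w)) ((d⊏e ∷ d⊏w) ∷ inc) = begin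
      ε ^ inversions (v ∷ e ∷ w) * y ^ majFrom p (d ∷ v ∷ e ∷ w)
        + ∑ (map (e ∷_) (insertions v w)) (λ s → ε ^ inversions s * y ^ majFrom p (d ∷ s))
        ≈⟨ +-cong (*-cong (^-congʳ ε (inversions-increasing (v⊏ ∷ inc))) (^-congʳ y front))
             (≈-trans (reflexive (∑-map (e ∷_) (insertions v w) _))
               (≈-trans (∑-cong rest) (≈-trans (∑-*ˡ ε (insertions v w) _)
                 (*-congˡ (∑-small-insertions′ (suc p) e w v⊏ inc))))) ⟩
      1# * y ^ p + ε * (y * y ^ p * [ suc (length w) ]⟨ ε * y ⟩)
        ≈⟨ solve 4 (λ e y Y b → con ℤ.1ℤ :* Y :+ e :* (y :* Y :* b) := Y :* (con ℤ.1ℤ :+ (e :* y) :* b)) ≈-refl ε y (y ^ p) _ ⟩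
      y ^ p * (1# + ε * y * [ suc (length w) ]⟨ ε * y ⟩)
        ≈⟨ *-congˡ ([]-suc (suc (length w)) (ε * y)) ⟨
      y ^ p * [ suc (suc (length w)) ]⟨ ε * y ⟩ ∎
      where
      front : majFrom p (d ∷ v ∷ e ∷ w) ≡ p
      front = trans (cong₂ (λ b k → (if b then p else 0) ℕ.+ k) (dec-true (v ≺? d) (proj₁ v⊏d))
        (majFrom-increasing (suc p) (v⊏ ∷ inc))) (ℕ.+-identityʳ p)

      rest : ∀ {s} → s ∈ insertions v w → ε ^ inversions (e ∷ s) * y ^ majFrom p (d ∷ e ∷ s) ≈
        ε * (ε ^ inversions s * y ^ majFrom (suc p) (e ∷ s))
      rest {s} s∈ = ≈-trans
        (*-cong (^-congʳ ε (cong (ℕ._+ inversions s) one))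
                (^-congʳ y (cong (λ b → (if b then p else 0) ℕ.+ majFrom (suc p) (e ∷ s)) (⊏⇒⊀ {d} {e} d⊏e))))
        (*-assoc _ _ _)
        where
        one : below (proj₁ e) s ≡ 1
        one = trans (below-↭ (proj₁ e) (insertions-↭ w s∈))
          (cong₂ (λ b k → (if b then 1 else 0) ℕ.+ k) (dec-true (proj₁ v ℕ.<? proj₁ e) (proj₂ v⊏e)) (below-⊏ (AllPairs.head inc)))

    -- The gap in front of d creates neither a descent nor an inversion and gives the term 1; each
    -- later gap also has the inversion with d, hence one more ε.
    ∑-small-insertions : ∀ d w → All (v ⊏_) (d ∷ w) → AllPairs _⊏_ (d ∷ w) →
      ∑ (insertions v (d ∷ w)) (λ s → ε ^ inversions s * y ^ majFrom 1 s) ≈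
      [ suc (length (d ∷ w)) ]⟨ ε * y ⟩
    ∑-small-insertions d w v⊏@(v⊏d ∷ v⊏w) inc@(d⊏w ∷ _) = begin
      ε ^ inversions (v ∷ d ∷ w) * y ^ majFrom 1 (v ∷ d ∷ w)
        + ∑ (map (d ∷_) (insertions v w)) (λ s → ε ^ inversions s * y ^ majFrom 1 s)
        ≈⟨ +-cong (*-cong (^-congʳ ε (inversions-increasing (v⊏ ∷ inc))) (^-congʳ y (majFrom-increasing 1 (v⊏ ∷ inc))))
             (≈-trans (reflexive (∑-map (d ∷_) (insertions v w) _))
               (≈-trans (∑-cong rest) (≈-trans (∑-*ˡ ε (insertions v w) _)
                 (*-congˡ (∑-small-insertions′ 1 d w v⊏ inc))))) ⟩
      1# * 1# + ε * (y * 1# * [ suc (length w) ]⟨ ε * y ⟩)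
        ≈⟨ solve 3 (λ e y b → let 𝟙 = con ℤ.1ℤ in 𝟙 :* 𝟙 :+ e :* (y :* 𝟙 :* b) := 𝟙 :+ (e :* y) :* b) ≈-refl ε y _ ⟩
      1# + ε * y * [ suc (length w) ]⟨ ε * y ⟩
        ≈⟨ []-suc (suc (length w)) (ε * y) ⟨
      [ suc (suc (length w)) ]⟨ ε * y ⟩ ∎
      where
      rest : ∀ {s} → s ∈ insertions v w → ε ^ inversions (d ∷ s) * y ^ majFrom 1 (d ∷ s) ≈
        ε * (ε ^ inversions s * y ^ majFrom 1 (d ∷ s))
      rest {s} s∈ = ≈-trans (*-congʳ (^-congʳ ε (cong (ℕ._+ inversions s) one))) (*-assoc _ _ _)
        where
        one : below (proj₁ d) s ≡ 1
        one = trans (below-↭ (proj₁ d) (insertions-↭ w s∈))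
          (cong₂ (λ b k → (if b then 1 else 0) ℕ.+ k) (dec-true (proj₁ v ℕ.<? proj₁ d) (proj₂ v⊏d)) (below-⊏ d⊏w))

  total : Word → List ℕ → Carrier
  total base ls = ∑ (arrangements r base ls) weight

  ∑-arrangements-∷ : ∀ base l ls (f : Word → Carrier) → ∑ (arrangements r base (l ∷ ls)) f ≈
    ∑ (arrangements r base ls) (λ w → ∑ (upTo r) (λ z → ∑ (insertions (l , z) w) f))
  ∑-arrangements-∷ base l ls f = ≈-trans (∑-concatMap _ (arrangements r base ls) f)
    (∑-cong {xs = arrangements r base ls} (λ {w} _ → ∑-concatMap (λ z → insertions (l , z) w) (upTo r) f))

  weight-uncolored : ∀ lo hi → weight (uncolored lo hi) ≈ 1#
  weight-uncolored lo hi = begin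
    weight w                                             ≈⟨ weight-factors w ⟩
    ε ^ inversions w * x ^ totalColor w * y ^ majFrom 1 w
      ≈⟨ *-cong (*-cong (^-congʳ ε (inversions-increasing inc)) (^-congʳ x (totalColor-uncolored lo hi)))
                (^-congʳ y (majFrom-increasing 1 inc)) ⟩
    1# * 1# * 1#                                         ≈⟨ solve 0 (con ℤ.1ℤ :* con ℤ.1ℤ :* con ℤ.1ℤ := con ℤ.1ℤ) ≈-refl ⟩
    1#                                                   ∎
    where
    w = uncolored lo hi
    inc = uncolored-increasing lo hi

  total-[] : ∀ lo hi → total (uncolored lo hi) [] ≈ 1#
  total-[] lo hi = ≈-trans (+-identityʳ _) (weight-uncolored lo hi)

  total-small : ∀ l lo hi k → l < lo → length (uncolored lo hi) ≡ suc k →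
    total (uncolored lo hi) (l ∷ []) ≈ [ suc (suc k) ]⟨ ε * y ⟩ * [ r ]⟨ x ⟩
  total-small l lo hi k l<lo len = begin
    total base (l ∷ [])
      ≈⟨ ≈-trans (∑-arrangements-∷ base l [] weight) (+-identityʳ _) ⟩
    letterSum l base
      ≈⟨ ∑-cong {xs = upTo r} (λ {z} _ → colored z) ⟩
    ∑ (upTo r) (λ z → x ^ z * [ suc (suc k) ]⟨ ε * y ⟩)
      ≈⟨ ∑-*ʳ _ (upTo r) (x ^_) ⟩
    [ r ]⟨ x ⟩ * [ suc (suc k) ]⟨ ε * y ⟩
      ≈⟨ *-comm _ _ ⟩
    [ suc (suc k) ]⟨ ε * y ⟩ * [ r ]⟨ x ⟩ ∎
    where
    base = uncolored lo hi

    nonempty : ∀ v w → length w ≡ suc k → All (v ⊏_) w → AllPairs _⊏_ w →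
      ∑ (insertions v w) (λ s → ε ^ inversions s * y ^ majFrom 1 s) ≈ [ suc (suc k) ]⟨ ε * y ⟩
    nonempty v (d ∷ w) refl v⊏ inc = ∑-small-insertions v d w v⊏ inc

    colored : ∀ z → ∑ (insertions (l , z) base) weight ≈ x ^ z * [ suc (suc k) ]⟨ ε * y ⟩
    colored z = begin
      ∑ (insertions (l , z) base) weight
        ≈⟨ ≈-trans (∑-cong split) (∑-*ˡ (x ^ z) (insertions (l , z) base) _) ⟩
      x ^ z * ∑ (insertions (l , z) base) (λ s → ε ^ inversions s * y ^ majFrom 1 s)
        ≈⟨ *-congˡ (nonempty (l , z) base len (⊏-uncolored hi z l<lo) (uncolored-increasing lo hi)) ⟩
      x ^ z * [ suc (suc k) ]⟨ ε * y ⟩ ∎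
      where
      split : ∀ {s} → s ∈ insertions (l , z) base → weight s ≈ x ^ z * (ε ^ inversions s * y ^ majFrom 1 s)
      split {s} s∈ = begin
        weight s
          ≈⟨ weight-factors s ⟩
        ε ^ inversions s * x ^ totalColor s * y ^ majFrom 1 s
          ≈⟨ *-congʳ (*-congˡ (^-congʳ x (trans (totalColor-↭ (insertions-↭ base s∈))
               (trans (cong (z ℕ.+_) (totalColor-uncolored lo hi)) (ℕ.+-identityʳ z))))) ⟩
        ε ^ inversions s * x ^ z * y ^ majFrom 1 s
          ≈⟨ solve 3 (λ e z m → e :* z :* m := z :* (e :* m)) ≈-refl _ _ _ ⟩
        x ^ z * (ε ^ inversions s * y ^ majFrom 1 s) ∎

  -- Here n is the number of factors: i runs from m + 1 to m + n.
  factors : ℕ → ℕ → Carrier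
  factors m n = ∏ (applyUpTo (suc m ℕ.+_) n) (λ i → [ i ℕ.* r ]⟨ ε ^ (i ℕ.∸ 1) * x ⟩)

  factors-2+ : ∀ m n → factors m (suc (suc n)) ≈ factors m n * pairFactor (n ℕ.+ m)
  factors-2+ m n = begin
    ∏ (applyUpTo f (suc (suc n))) F                     ≡⟨ cong (λ is → ∏ is F) (applyUpTo-∷ʳ f (suc n)) ⟨
    ∏ (applyUpTo f (suc n) ++ f (suc n) ∷ []) F         ≈⟨ ∏-∷ʳ (applyUpTo f (suc n)) _ F ⟩
    ∏ (applyUpTo f (suc n)) F * F (f (suc n))           ≡⟨ cong (λ is → ∏ is F * F (f (suc n))) (applyUpTo-∷ʳ f n) ⟨
    ∏ (applyUpTo f n ++ f n ∷ []) F * F (f (suc n))     ≈⟨ *-congʳ (∏-∷ʳ (applyUpTo f n) _ F) ⟩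
    ∏ (applyUpTo f n) F * F (f n) * F (f (suc n))       ≈⟨ *-assoc _ _ _ ⟩
    factors m n * (F (f n) * F (f (suc n)))
      ≡⟨ cong (factors m n *_) (cong₂ (λ i j → F (suc i) * F (suc j)) (ℕ.+-comm m n) (trans (ℕ.+-suc m n) (cong suc (ℕ.+-comm m n)))) ⟩
    factors m n * pairFactor (n ℕ.+ m)                  ∎
    where
    f = suc m ℕ.+_
    F : ℕ → Carrier
    F i = [ i ℕ.* r ]⟨ ε ^ (i ℕ.∸ 1) * x ⟩

  module _ (regular : ∀ j → 1 ≤ j → ∀ {f g} → (1# - x ^ j) * f ≈ (1# - x ^ j) * g → f ≈ g) (1≤r : 1 ≤ r)
           (sign : ε ≈ 1# ⊎ ε ≈ - 1#) (base : Word) where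

    -- The factor gained by a pair depends on the word only through its length, which all
    -- arrangements of `ls` share, so it leaves the sum.
    total-pair : ∀ a ls → Unique (suc a ∷ a ∷ ls ++ letters base) →
      total base (suc a ∷ a ∷ ls) ≈ total base ls * pairFactor (length ls ℕ.+ length base)
    total-pair a ls (sa∉ ∷ uniq) = begin
      total base (suc a ∷ a ∷ ls)
        ≈⟨ ≈-trans (∑-arrangements-∷ base (suc a) (a ∷ ls) weight) (∑-arrangements-∷ base a ls (letterSum (suc a))) ⟩
      ∑ (arrangements r base ls) (pairSum a)
        ≈⟨ ∑-cong (λ {w} w∈ → ≈-trans
             (pairSum-closed regular 1≤r sign a w (arrangements-∉ r base ls uniq w∈)
               (arrangements-∉ r base ls (All.tail sa∉ ∷ AllPairs.tail uniq) w∈))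
             (*-congˡ (reflexive (cong pairFactor (w-length w∈))))) ⟩
      ∑ (arrangements r base ls) (λ w → weight w * pairFactor (length ls ℕ.+ length base))
        ≈⟨ ∑-*ʳ _ (arrangements r base ls) weight ⟩
      total base ls * pairFactor (length ls ℕ.+ length base) ∎
      where
      w-length : ∀ {w} → w ∈ arrangements r base ls → length w ≡ length ls ℕ.+ length base
      w-length {w} w∈ = trans (sym (List.length-map proj₁ w)) (trans (↭-length (arrangements-letters r base ls w∈))
        (trans (List.length-++ ls) (cong (length ls ℕ.+_) (List.length-map proj₁ base))))

    -- The letters `ls` are those inserted before the pairs: none in case (i), the letter 1 in case
    -- (ii).
    total-paired : ∀ {ps} → Paired ps → ∀ ls → Unique ((ps ++ ls) ++ letters base) →
      total base (ps ++ ls) ≈ total base ls * factors (length ls ℕ.+ length base) (length ps)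
    total-paired []                ls uniq = ≈-sym (*-identityʳ _)
    total-paired (pair a {ps} prd) ls uniq = begin
      total base (suc a ∷ a ∷ ps ++ ls)
        ≈⟨ total-pair a (ps ++ ls) uniq ⟩
      total base (ps ++ ls) * pairFactor (length (ps ++ ls) ℕ.+ length base)
        ≈⟨ *-cong (total-paired prd ls (AllPairs.tail (AllPairs.tail uniq)))
             (reflexive (cong pairFactor (trans (cong (ℕ._+ length base) (List.length-++ ps)) (ℕ.+-assoc (length ps) _ _)))) ⟩
      total base ls * factors m (length ps) * pairFactor (length ps ℕ.+ m)
        ≈⟨ *-assoc _ _ _ ⟩
      total base ls * (factors m (length ps) * pairFactor (length ps ℕ.+ m))
        ≈⟨ *-congˡ (factors-2+ m (length ps)) ⟨
      total base ls * factors m (suc (suc (length ps))) ∎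
      where m = length ls ℕ.+ length base

-- Parity, and the letters outside the block

even-+ : ∀ d {e} → d % 2 ≡ 0 → (d ℕ.+ e) % 2 ≡ e % 2
even-+ zero          _  = refl
even-+ (suc (suc d)) eq = even-+ d eq

even-difference : ∀ d e → (d ℕ.+ e) % 2 ≡ e % 2 → d % 2 ≡ 0
even-difference zero          e             _  = refl
even-difference (suc zero)    (suc (suc e)) eq = even-difference 1 e eq
even-difference (suc (suc d)) e             eq = even-difference d e eq

paired-applyDownFrom : ∀ f → (∀ j → f (suc j) ≡ suc (f j)) → ∀ d → d % 2 ≡ 0 → Paired (applyDownFrom f d)
paired-applyDownFrom f step zero          _  = []
paired-applyDownFrom f step (suc (suc d)) eq = subst (λ i → Paired (i ∷ f d ∷ applyDownFrom f d))
  (sym (step d)) (pair (f d) (paired-applyDownFrom f step d eq))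

paired-++ : ∀ {ps qs} → Paired ps → Paired qs → Paired (ps ++ qs)
paired-++ []         q = q
paired-++ (pair a p) q = pair a (paired-++ p q)

-- The letters n, n - 1, ..., b + 1, so that b + 1 is inserted first.
higher : ℕ → ℕ → List ℕ
higher b n = applyDownFrom (ℕ._+ suc b) (n ℕ.∸ b)

m∸n≡m∸o+o∸n : ∀ {m n o} → n ≤ o → o ≤ m → m ℕ.∸ n ≡ (m ℕ.∸ o) ℕ.+ (o ℕ.∸ n)
m∸n≡m∸o+o∸n {m} {n} {o} n≤o o≤m =
  trans (cong (ℕ._∸ n) (sym (ℕ.m∸n+n≡m o≤m))) (ℕ.+-∸-assoc (m ℕ.∸ o) n≤o)

module _ (n k b : ℕ) (k≤b : k ≤ b) (b≤n : b ≤ n) where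

  lo : ℕ
  lo = b ℕ.∸ k ℕ.+ 1

  length-uncolored : length (uncolored lo b) ≡ k
  length-uncolored = trans (List.length-map (_, 0) [ lo ⋯ b ]) (trans (List.length-applyUpTo (lo ℕ.+_) _)
    (trans (cong (suc b ℕ.∸_) (ℕ.+-comm (b ℕ.∸ k) 1)) (ℕ.m∸[m∸n]≡n k≤b)))

  -- The three pieces cover 1, ..., n and their lengths add up to n, which forces them to be
  -- disjoint.
  letters-↭ : (higher b n ++ applyDownFrom suc (b ℕ.∸ k)) ++ [ lo ⋯ b ] ↭ [ 1 ⋯ n ]
  letters-↭ = ↭-sym (unique-⊆⇒↭ (⋯-unique 1 n) covers lengths)
    where
    covers : ∀ {i} → i ∈ [ 1 ⋯ n ] → i ∈ (higher b n ++ applyDownFrom suc (b ℕ.∸ k)) ++ [ lo ⋯ b ]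
    covers {i} i∈ with ∈-⋯⁻ {1} {n} i∈
    covers {suc j} i∈ | _ , j<n with suc j ℕ.≤? b
    ... | no  j≮b = ∈-++⁺ˡ (∈-++⁺ˡ (subst (_∈ higher b n)
      (trans (ℕ.+-suc (j ℕ.∸ b) b) (cong suc (ℕ.m∸n+n≡m b≤j)))
      (∈-applyDownFrom⁺ (ℕ._+ suc b) (ℕ.∸-monoˡ-< j<n b≤j))))
      where b≤j = ℕ.s≤s⁻¹ (ℕ.≰⇒> j≮b)
    ... | yes j<b with j ℕ.<? b ℕ.∸ k
    ...   | yes j< = ∈-++⁺ˡ (∈-++⁺ʳ (higher b n) (∈-applyDownFrom⁺ suc j<))
    ...   | no  j≮ = ∈-++⁺ʳ (higher b n ++ applyDownFrom suc (b ℕ.∸ k))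
      (∈-⋯⁺ (ℕ.≤-trans (ℕ.≤-reflexive (ℕ.+-comm (b ℕ.∸ k) 1)) (ℕ.s≤s (ℕ.≮⇒≥ j≮))) j<b)

    lengths : length [ 1 ⋯ n ] ≡ length ((higher b n ++ applyDownFrom suc (b ℕ.∸ k)) ++ [ lo ⋯ b ])
    lengths = sym (begin
      length ((higher b n ++ applyDownFrom suc (b ℕ.∸ k)) ++ [ lo ⋯ b ])
        ≡⟨ List.length-++ (higher b n ++ applyDownFrom suc (b ℕ.∸ k)) ⟩
      length (higher b n ++ applyDownFrom suc (b ℕ.∸ k)) ℕ.+ length [ lo ⋯ b ]
        ≡⟨ cong₂ ℕ._+_ (trans (List.length-++ (higher b n)) (cong₂ ℕ._+_ (List.length-applyDownFrom (ℕ._+ suc b) (n ℕ.∸ b)) (List.length-applyDownFrom suc (b ℕ.∸ k))))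
             (trans (sym (List.length-map (_, 0) [ lo ⋯ b ])) length-uncolored) ⟩
      (n ℕ.∸ b) ℕ.+ (b ℕ.∸ k) ℕ.+ k
        ≡⟨ ℕ.+-assoc (n ℕ.∸ b) _ _ ⟩
      (n ℕ.∸ b) ℕ.+ (b ℕ.∸ k ℕ.+ k)
        ≡⟨ cong ((n ℕ.∸ b) ℕ.+_) (ℕ.m∸n+n≡m k≤b) ⟩
      (n ℕ.∸ b) ℕ.+ b
        ≡⟨ ℕ.m∸n+n≡m b≤n ⟩
      n
        ≡⟨ List.length-applyUpTo suc n ⟨
      length [ 1 ⋯ n ] ∎)
      where open ≡.≡-Reasoning

-- From characters of colored permutations to weights of words

module ColoredSums (R : CommutativeRing c ℓ) (S : CommutativeRing c ℓ) where

  private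
    module R where
      open CommutativeRing R public
      open Algebra.Properties.CommutativeSemiring.Exp commutativeSemiring public
  open Characters R
  open CommutativeRing S renaming (refl to ≈-refl; sym to ≈-sym; trans to ≈-trans)
  open Algebra.Properties.CommutativeSemiring.Exp commutativeSemiring
    using (_^_; ^-congʳ; ^-distrib-*)
  open Sums S
  open Relation.Binary.Reasoning.Setoid setoid

  -- The map `κ` stands for the embedding of constants and `q` for the indeterminate; S stays
  -- abstract, so no list of coefficients is unfolded.
  module Evaluation
    (κ : R.Carrier → Carrier)
    (κ-cong : ∀ {u v} → u R.≈ v → κ u ≈ κ v)
    (κ-* : ∀ u v → κ (u R.* v) ≈ κ u * κ v)
    (κ-1 : κ R.1# ≈ 1#)
    (κ--1 : κ (R.- R.1#) ≈ - 1#)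
    (q : Carrier)
    (r n : ℕ) (1≤r : 1 ≤ r)
    (ζ : R.Carrier) (ζ^r≈1 : ζ R.^ r R.≈ R.1#)
    (ε : R.Carrier) (sign : IsSign ε) (h : ℕ)
    (regular : ∀ j → 1 ≤ j → ∀ {f g} →
       (1# - (κ (ζ R.^ h) * q) ^ j) * f ≈ (1# - (κ (ζ R.^ h) * q) ^ j) * g → f ≈ g)
    where

    x : Carrier
    x = κ (ζ R.^ h) * q

    factor : ℕ → Carrier
    factor i = [ i ℕ.* r ]⟨ κ ((ε R.^ (i ℕ.∸ 1)) R.* (ζ R.^ h)) * q ⟩

    open Weighted S (κ ε) x r
    open Totals S (κ ε) x r

    κ-^ : ∀ u j → κ (u R.^ j) ≈ κ u ^ j
    κ-^ u zero    = κ-1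
    κ-^ u (suc j) = ≈-trans (κ-* u (u R.^ j)) (*-congˡ (κ-^ u j))

    private
      1^ : ∀ j → R.1# R.^ j R.≈ R.1#
      1^ zero    = R.refl
      1^ (suc j) = R.trans (R.*-identityˡ _) (1^ j)

    ζ^r*≈1 : ∀ j → ζ R.^ (r ℕ.* j) R.≈ R.1#
    ζ^r*≈1 j = R.trans (R.sym (R.^-assocʳ ζ r j)) (R.trans (R.^-congˡ j ζ^r≈1) (1^ j))

    -- In x^fmaj the root occurs with exponent h fmaj. Its part h r m is a multiple of r and
    -- disappears, which leaves the exponent h col of the character.
    x^-reduces : ∀ m j → x ^ (r ℕ.* m ℕ.+ j) ≈ κ (ζ R.^ (h ℕ.* j)) * q ^ (r ℕ.* m ℕ.+ j)
    x^-reduces m j = begin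
      x ^ F                           ≈⟨ ^-distrib-* (κ (ζ R.^ h)) q F ⟩
      κ (ζ R.^ h) ^ F * q ^ F         ≈⟨ *-congʳ (κ-^ (ζ R.^ h) F) ⟨
      κ ((ζ R.^ h) R.^ F) * q ^ F     ≈⟨ *-congʳ (κ-cong ζ-reduces) ⟩
      κ (ζ R.^ (h ℕ.* j)) * q ^ F     ∎
      where
      F = r ℕ.* m ℕ.+ j

      exponent : h ℕ.* F ≡ r ℕ.* (h ℕ.* m) ℕ.+ h ℕ.* j
      exponent = solve′ 4 (λ h r m j → h :*′ (r :*′ m :+′ j) :=′ r :*′ (h :*′ m) :+′ h :*′ j) refl h r m j
        where open +-*-Solver renaming (solve to solve′; _:+_ to _:+′_; _:*_ to _:*′_; _:=_ to _:=′_)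

      ζ-reduces : (ζ R.^ h) R.^ F R.≈ ζ R.^ (h ℕ.* j)
      ζ-reduces = R.trans (R.^-assocʳ ζ h F) (R.trans (R.^-congʳ ζ exponent)
        (R.trans (R.^-homo-* ζ (r ℕ.* (h ℕ.* m)) (h ℕ.* j))
          (R.trans (R.*-congʳ (ζ^r*≈1 (h ℕ.* m))) (R.*-identityˡ _))))

    y≈q^r : y ≈ q ^ r
    y≈q^r = begin
      x ^ r                                    ≡⟨ cong (x ^_) exponent ⟨
      x ^ (r ℕ.* 1 ℕ.+ 0)                      ≈⟨ x^-reduces 1 0 ⟩
      κ (ζ R.^ (h ℕ.* 0)) * q ^ (r ℕ.* 1 ℕ.+ 0)
        ≈⟨ *-cong (≈-trans (reflexive (cong (λ i → κ (ζ R.^ i)) (ℕ.*-zeroʳ h))) κ-1) (^-congʳ q exponent) ⟩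
      1# * q ^ r                               ≈⟨ *-identityˡ _ ⟩
      q ^ r                                    ∎
      where
      exponent : r ℕ.* 1 ℕ.+ 0 ≡ r
      exponent = trans (ℕ.+-identityʳ (r ℕ.* 1)) (ℕ.*-identityʳ r)

    character-weight : ∀ (π : Colored r n) → κ (χ ζ ε h π) * q ^ fmaj π ≈ weight (word π)
    character-weight π@(σ coloredBy ζs) = begin
      κ ((ε R.^ inv σ) R.* (ζ R.^ (h ℕ.* col π))) * q ^ fmaj π
        ≈⟨ *-congʳ (≈-trans (κ-* (ε R.^ inv σ) (ζ R.^ (h ℕ.* col π))) (*-congʳ (κ-^ ε (inv σ)))) ⟩
      κ ε ^ inv σ * κ (ζ R.^ (h ℕ.* col π)) * q ^ fmaj π
        ≈⟨ *-assoc (κ ε ^ inv σ) (κ (ζ R.^ (h ℕ.* col π))) (q ^ fmaj π) ⟩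
      κ ε ^ inv σ * (κ (ζ R.^ (h ℕ.* col π)) * q ^ fmaj π)
        ≈⟨ *-congˡ (x^-reduces (majF π) (col π)) ⟨
      κ ε ^ inv σ * x ^ (r ℕ.* majF π ℕ.+ col π)
        ≡⟨ cong₂ (λ i j → κ ε ^ i * x ^ (r ℕ.* majF π ℕ.+ j)) (colorWord-inversions σ ζs) (colorWord-totalColor σ ζs) ⟨
      weight (word π) ∎

    module _ (k b : ℕ) (k≤b : k ≤ b) (b≤n : b ≤ n) where

      private
        low = lo n k b k≤b b≤n
        base = uncolored low b
        upper = higher b n
        outside = upper ++ applyDownFrom suc (b ℕ.∸ k)

      characterSum : Carrier
      characterSum = ∑ (G r , n ⟨ b ℕ.∸ k ℕ.+ 1 ∶ b ⟩) (λ π → κ (χ ζ ε h π) * q ^ fmaj π)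

      -- The equation lets the caller present the letters as pairs followed by a remainder, empty or
      -- consisting of 1.
      sum-total : ∀ ls → ls ≡ outside → characterSum ≈ total base ls
      sum-total ls refl = begin
        ∑ (G r , n ⟨ low ∶ b ⟩) (λ π → κ (χ ζ ε h π) * q ^ fmaj π)
          ≈⟨ ∑-cong {xs = G r , n ⟨ low ∶ b ⟩} (λ {π} _ → character-weight π) ⟩
        ∑ (G r , n ⟨ low ∶ b ⟩) (λ π → weight (word π))
          ≡⟨ ∑-map word (G r , n ⟨ low ∶ b ⟩) weight ⟨
        ∑ (map word (G r , n ⟨ low ∶ b ⟩)) weight
          ≈⟨ ∑-↭ weight (word-G-↭ low b ls 1≤r (letters-↭ n k b k≤b b≤n)) ⟩
        total base ls ∎

      letters-unique : Unique (outside ++ letters base)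
      letters-unique = subst (λ is → Unique (outside ++ is)) (sym (letters-uncolored low b))
        (↭ₛ.Unique-resp-↭ (≡.setoid ℕ) (↭⇒↭ₛ (↭-sym (letters-↭ n k b k≤b b≤n))) (⋯-unique 1 n))

      private
        sign′ : κ ε ≈ 1# ⊎ κ ε ≈ - 1#
        sign′ = Sum.map (λ ε≈ → ≈-trans (κ-cong ε≈) κ-1) (λ ε≈ → ≈-trans (κ-cong ε≈) κ--1) sign

      total-factors : ∀ {ps} ls m j → Paired ps → ps ++ ls ≡ outside →
        length ls ℕ.+ k ≡ m → length ps ≡ j →
        total base (ps ++ ls) ≈ total base ls * factors m j
      total-factors {ps} ls _ _ prd eq refl refl = ≈-trans
        (total-paired regular 1≤r sign′ base prd ls (subst (λ is → Unique (is ++ letters base)) (sym eq) letters-unique))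
        (*-congˡ (reflexive (cong (λ m → factors (length ls ℕ.+ m) (length ps)) (length-uncolored n k b k≤b b≤n))))

      factors-product : ∀ m m′ → suc m ≡ m′ → factors m (n ℕ.∸ m) ≈ ∏ [ m′ ⋯ n ] factor
      factors-product m _ refl = ∏-cong [ suc m ⋯ n ] λ i → []-cong (i ℕ.* r) (begin
        κ ε ^ (i ℕ.∸ 1) * (κ (ζ R.^ h) * q)
          ≈⟨ *-assoc (κ ε ^ (i ℕ.∸ 1)) (κ (ζ R.^ h)) q ⟨
        κ ε ^ (i ℕ.∸ 1) * κ (ζ R.^ h) * q
          ≈⟨ *-congʳ (≈-trans (κ-* (ε R.^ (i ℕ.∸ 1)) (ζ R.^ h)) (*-congʳ (κ-^ ε (i ℕ.∸ 1)))) ⟨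
        κ ((ε R.^ (i ℕ.∸ 1)) R.* (ζ R.^ h)) * q ∎)
        where
        ∏-cong : ∀ is {f g : ℕ → Carrier} → (∀ i → f i ≈ g i) → ∏ is f ≈ ∏ is g
        ∏-cong []       p = ≈-refl
        ∏-cong (i ∷ is) p = *-cong (p i) (∏-cong is p)

      module _ (b%2≡n%2 : b % 2 ≡ n % 2) where

        private
          n∸b-even : (n ℕ.∸ b) % 2 ≡ 0
          n∸b-even = even-difference (n ℕ.∸ b) b (trans (cong (_% 2) (ℕ.m∸n+n≡m b≤n)) (sym b%2≡n%2))

          b∸k-parity : (b ℕ.∸ k) % 2 ≡ (n ℕ.∸ k) % 2
          b∸k-parity = sym (trans (cong (_% 2) (m∸n≡m∸o+o∸n k≤b b≤n)) (even-+ (n ℕ.∸ b) n∸b-even))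

          upper-paired : Paired upper
          upper-paired = paired-applyDownFrom (ℕ._+ suc b) (λ _ → refl) (n ℕ.∸ b) n∸b-even

          length-upper-++ : ∀ f d → length (upper ++ applyDownFrom f d) ≡ (n ℕ.∸ b) ℕ.+ d
          length-upper-++ f d = trans (List.length-++ upper)
            (cong₂ ℕ._+_ (List.length-applyDownFrom (ℕ._+ suc b) (n ℕ.∸ b)) (List.length-applyDownFrom f d))

        even-case : (n ℕ.∸ k) % 2 ≡ 0 → characterSum ≈ ∏ [ k ℕ.+ 1 ⋯ n ] factor
        even-case n∸k-even = begin
          characterSum
            ≈⟨ sum-total (outside ++ []) (List.++-identityʳ outside) ⟩
          total base (outside ++ [])
            ≈⟨ total-factors [] k (n ℕ.∸ k)
                 (paired-++ upper-paired (paired-applyDownFrom suc (λ _ → refl) (b ℕ.∸ k) (trans b∸k-parity n∸k-even)))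
                 (List.++-identityʳ outside) refl
                 (trans (length-upper-++ suc (b ℕ.∸ k)) (sym (m∸n≡m∸o+o∸n k≤b b≤n))) ⟩
          total base [] * factors k (n ℕ.∸ k)
            ≈⟨ *-cong (total-[] low b) (factors-product k (k ℕ.+ 1) (ℕ.+-comm 1 k)) ⟩
          1# * ∏ [ k ℕ.+ 1 ⋯ n ] factor
            ≈⟨ *-identityˡ _ ⟩
          ∏ [ k ℕ.+ 1 ⋯ n ] factor ∎

        odd-case : 1 ≤ k → (n ℕ.∸ k) % 2 ≡ 1 →
          characterSum ≈ ([ k ℕ.+ 1 ]⟨ κ ε * q ^ r ⟩ * [ r ]⟨ x ⟩) * ∏ [ k ℕ.+ 2 ⋯ n ] factor
        odd-case 1≤k n∸k-odd = odd (b ℕ.∸ k) k refl refl 1≤k (trans b∸k-parity n∸k-odd)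
          where
          -- The names d and k′ for b - k and k allow matching on successors: b - k is odd and k is
          -- positive.
          odd : ∀ d k′ → b ℕ.∸ k ≡ d → k ≡ k′ → 1 ≤ k′ → d % 2 ≡ 1 →
            characterSum ≈ ([ k ℕ.+ 1 ]⟨ κ ε * q ^ r ⟩ * [ r ]⟨ x ⟩) * ∏ [ k ℕ.+ 2 ⋯ n ] factor
          odd (suc d) (suc k′) b∸k≡ k≡ _ d-odd = begin
            characterSum
              ≈⟨ sum-total (ps ++ 1 ∷ []) ps-1 ⟩
            total base (ps ++ 1 ∷ [])
              ≈⟨ total-factors (1 ∷ []) (suc k) (n ℕ.∸ suc k)
                   (paired-++ upper-paired (paired-applyDownFrom (suc ∘ suc) (λ _ → refl) d (even d d-odd)))
                   ps-1 refl ps-length ⟩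
            total base (1 ∷ []) * factors (suc k) (n ℕ.∸ suc k)
              ≈⟨ *-cong small (factors-product (suc k) (k ℕ.+ 2) (ℕ.+-comm 2 k)) ⟩
            ([ k ℕ.+ 1 ]⟨ κ ε * q ^ r ⟩ * [ r ]⟨ x ⟩) * ∏ [ k ℕ.+ 2 ⋯ n ] factor ∎
            where
            -- Here b - k = d + 1 with d even: the letters d + 1, ..., 2 form pairs, and 1 stays at
            -- the end of the list, where insertion begins.
            ps = upper ++ applyDownFrom (suc ∘ suc) d

            even : ∀ d → suc d % 2 ≡ 1 → d % 2 ≡ 0
            even zero          _  = refl
            even (suc (suc d)) eq = even d eq

            ps-1 : ps ++ 1 ∷ [] ≡ outside
            ps-1 = trans (List.++-assoc upper _ _)
              (cong (upper ++_) (trans (applyDownFrom-∷ʳ suc d) (cong (applyDownFrom suc) (sym b∸k≡))))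

            ps-length : length ps ≡ n ℕ.∸ suc k
            ps-length = trans (length-upper-++ (suc ∘ suc) d) (trans
              (cong ℕ.pred (trans (sym (ℕ.+-suc (n ℕ.∸ b) d)) (trans (cong ((n ℕ.∸ b) ℕ.+_) (sym b∸k≡)) (sym (m∸n≡m∸o+o∸n k≤b b≤n)))))
              (ℕ.pred[m∸n]≡m∸[1+n] n k))

            small : total base (1 ∷ []) ≈ [ k ℕ.+ 1 ]⟨ κ ε * q ^ r ⟩ * [ r ]⟨ x ⟩
            small = ≈-trans
              (total-small 1 low b k′ (subst (λ e → 1 < e ℕ.+ 1) (sym b∸k≡) (ℕ.s≤s (ℕ.m≤n+m 1 d)))
                (trans (length-uncolored n k b k≤b b≤n) k≡))
              (*-congʳ (≈-trans
                (reflexive (cong (λ j → [ j ]⟨ κ ε * y ⟩) (trans (cong suc (sym k≡)) (ℕ.+-comm 1 k))))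
                ([]-cong (k ℕ.+ 1) (*-congˡ y≈q^r))))

-- Cancellation of 1 - t

module _ (S : CommutativeRing c ℓ) where

  open CommutativeRing S renaming (refl to ≈-refl)
  open IntegerCoefficients S using (solve; _:=_; _:+_; _:*_; _:-_; con)
  open Relation.Binary.Reasoning.Setoid setoid

  -- The hypothesis says (1 - t) (f - g) = 0; as a fixed point equation it is accessible to
  -- induction on the degree.
  difference-fixed : ∀ t f g → (1# - t) * f ≈ (1# - t) * g → f - g ≈ t * (f - g)
  difference-fixed t f g eq = begin
    f - g
      ≈⟨ solve 3 (λ t f g → let 𝟙 = con ℤ.1ℤ in
           f :- g := ((𝟙 :- t) :* f :- (𝟙 :- t) :* g) :+ t :* (f :- g)) ≈-refl t f g ⟩
    ((1# - t) * f - (1# - t) * g) + t * (f - g)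
      ≈⟨ +-congʳ (+-congʳ eq) ⟩
    ((1# - t) * g - (1# - t) * g) + t * (f - g)
      ≈⟨ +-congʳ (-‿inverseʳ _) ⟩
    0# + t * (f - g)
      ≈⟨ +-identityˡ _ ⟩
    t * (f - g) ∎

module _ (R : CommutativeRing c ℓ) where

  private
    module R = CommutativeRing R
  open Polynomials R
  open PolynomialRing R

  1-t-regular : ∀ t f g → coeff t 0 R.≈ R.0# →
    (constant R.1# +ᴾ (-ᴾ t)) *ᴾ f ≈ᴾ (constant R.1# +ᴾ (-ᴾ t)) *ᴾ g → f ≈ᴾ g
  1-t-regular t f g t₀≈0 eq = Algebra.Properties.Group.x∙y⁻¹≈ε⇒x≈y +-group f g
    (fixed⇒zero t (f - g) t₀≈0 (difference-fixed commutativeRing t f g eq))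
    where open CommutativeRing commutativeRing using (_-_; +-group)

  -- A positive power of u q is divisible by q.
  constantTerm-^ : ∀ u j → 1 ≤ j → coeff ((constant u *ᴾ q) ^ᴾ j) 0 R.≈ R.0#
  constantTerm-^ u (suc j) _ = R.trans (coeff-* (constant u *ᴾ q) ((constant u *ᴾ q) ^ᴾ j) 0)
    (R.trans (R.*-congʳ (R.trans (coeff-* (constant u) q 0) (R.zeroʳ u))) (R.zeroˡ _))

open import Data.Nat.Base using (_+_; _*_; _∸_)

theorem2p2 :
  ∀ {c ℓ} (R : CommutativeRing c ℓ) →
  let open CommutativeRing R using (Carrier) renaming (_*_ to _*ᴿ_)
      open Polynomials R
      open Characters R
  in
  (r n : ℕ) → 1 ≤ r → 1 ≤ n →
  (ζ : Carrier) → IsPrimitiveRoot r ζ →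
  (ε : Carrier) → IsSign ε →
  (h : ℕ) → h < r →
  (k b : ℕ) → 1 ≤ k → k ≤ n ∸ 1 → k ≤ b → b ≤ n → b % 2 ≡ n % 2 →
  ((n ∸ k) % 2 ≡ 0 →
    (∑[ π ∈ G r , n ⟨ b ∸ k + 1 ∶ b ⟩ ] constant (χ ζ ε h π) *ᴾ (q ^ᴾ fmaj π))
      ≈ᴾ
    (∏[ i ∈ [ k + 1 ⋯ n ] ] [ i * r ]⟨ constant ((ε ^ᴿ (i ∸ 1)) *ᴿ (ζ ^ᴿ h)) *ᴾ q ⟩))
  ×
  ((n ∸ k) % 2 ≡ 1 →
    (∑[ π ∈ G r , n ⟨ b ∸ k + 1 ∶ b ⟩ ] constant (χ ζ ε h π) *ᴾ (q ^ᴾ fmaj π))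
      ≈ᴾ
    (([ k + 1 ]⟨ constant ε *ᴾ (q ^ᴾ r) ⟩ *ᴾ [ r ]⟨ constant (ζ ^ᴿ h) *ᴾ q ⟩)
      *ᴾ (∏[ i ∈ [ k + 2 ⋯ n ] ] [ i * r ]⟨ constant ((ε ^ᴿ (i ∸ 1)) *ᴿ (ζ ^ᴿ h)) *ᴾ q ⟩)))
theorem2p2 R r n 1≤r _ ζ (ζ^r≈1 , _) ε sign h _ k b 1≤k _ k≤b b≤n b≡n =
  even-case k b k≤b b≤n b≡n , odd-case k b k≤b b≤n b≡n 1≤k
  where
  open Polynomials R using (constant; q; _*ᴾ_; _^ᴾ_)
  open Characters R using (_^ᴿ_)
  open PolynomialRing R using (commutativeRing; constant-cong; constant-*)
  open CommutativeRing R using () renaming (refl to ≈-refl)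
  open ColoredSums.Evaluation R commutativeRing constant constant-cong constant-* (λ _ → ≈-refl) (λ _ → ≈-refl)
    q r n 1≤r ζ ζ^r≈1 ε sign h
    (λ j 1≤j {f} {g} → 1-t-regular R ((constant (ζ ^ᴿ h) *ᴾ q) ^ᴾ j) f g (constantTerm-^ R (ζ ^ᴿ h) j 1≤j))
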